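{- Let $h=(h(n))_{n\ge1}$ be a sequence of positive real numbers with $h(1)=1$, and let $n\ge2$. The matrix $M_n^h$ is primitive. Consequently, its spectral radius $\rho_n^h>0$ is an algebraically simple eigenvalue of $M_n^h$, and every other eigenvalue $\beta$ of $M_n^h$ satisfies $|\beta|<\rho_n^h$. Moreover, there exist vectors $x,y\in\mathbb R^{n-1}$ with all components positive, normalized by \[ \sum_{k=1}^{n-1}x_k=1,\qquad y^Tx=1, \] such that \[ M_n^hx=\rho_n^hx,\qquad y^TM_n^h=\rho_n^hy^T, \] and \[ \lim_{m\to\infty}\left(\frac{M_n^h}{\rho_n^h}\right)^m=xy^T. \]
   Context: Let $\sigma(k)=\sum_{d\mid k}d$. The sequence $(c_n)_{n\ge0}$ is defined by $c_0:=1$ and $c_n:=\sum_{k=0}^{n-1}(-1)^{n-k+1}\sigma(n-k+1)\,c_k$ for $n\ge1$. For $n\ge2$, $M_n^h$ is the $(n-1)\times(n-1)$ matrix with entries, for $1\le i,j\le n-1$, \[ (M_n^h)_{ij}=\begin{cases} c_{i-j+1}\,h(j), & i\ge j-1,\\ 0, & j>i+1.\end{cases} \] A real square matrix $A$ with nonnegative entries is called primitive if there is an integer $k\ge1$ such that all entries of $A^k$ are strictly positive. -}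

module Defs where

open import Level using (Level; _⊔_) renaming (suc to lsuc)
open import Algebra.Apartness.Bundles using (HeytingField)
open import Algebra.Bundles using (CommutativeRing)
open import Algebra.Bundles.Raw using (RawRing)
import Algebra.Definitions.RawSemiring as RawSemiringDefs
import Algebra.Properties.Ring as RingProperties
open import Data.Bool.Base using (if_then_else_)
open import Data.Fin.Base using (Fin; zero; suc; toℕ; punchIn)
import Data.Fin.Properties as Fin
open import Data.Integer.Base as ℤ using (ℤ; +_; -[1+_]; 0ℤ; 1ℤ; -1ℤ)
open import Data.List.Base as List using (List; []; _∷_)
open import Data.Nat.Base as ℕ using (ℕ; zero; suc; _∸_)
open import Data.Nat.Divisibility using (_∣?_)
open import Data.Nat.Induction using (<-rec)
import Data.Nat.ListAction as ListAction
import Data.Nat.Properties as ℕ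
open import Data.Product.Base using (∃; Σ; _×_; _,_; proj₁; proj₂)
open import Data.Sum.Base using (_⊎_)
open import Data.Vec.Functional using (Vector)
open import Relation.Binary.Core using (Rel)
open import Relation.Binary.Structures using (IsStrictPartialOrder)
open import Relation.Nullary.Decidable using (does)
open import Relation.Nullary.Negation using (¬_)

------------------------------------------------------------------------
-- The real numbers

-- The standard library has no type of real numbers, so they are given
-- axiomatically, as an Archimedean Cauchy-complete ordered field.
-- Classically these axioms determine ℝ up to unique isomorphism.  They
-- are phrased constructively (strict order, and apartness in place of
-- inequality), so that Cauchy reals satisfy them without excluded middle.

record RealField (c ℓ₁ ℓ₂ ℓ₃ : Level) : Set (lsuc (c ⊔ ℓ₁ ⊔ ℓ₂ ⊔ ℓ₃)) where
  infix 4 _<_ _≤_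
  field
    heytingField : HeytingField c ℓ₁ ℓ₂

  open HeytingField heytingField public

  commutativeRing : CommutativeRing c ℓ₁
  commutativeRing = record { isCommutativeRing = isCommutativeRing }

  open CommutativeRing commutativeRing public using (rawRing; ring)
  open RawRing rawRing public using (rawSemiring)

  field
    _<_                  : Rel Carrier ℓ₃
    isStrictPartialOrder : IsStrictPartialOrder _≈_ _<_
    <⇒#                  : ∀ {x y} → x < y → x # y
    #⇒<⊎>                : ∀ {x y} → x # y → x < y ⊎ y < x
    +-monoˡ-<            : ∀ z {x y} → x < y → x + z < y + z
    *-pos                : ∀ {x y} → 0# < x → 0# < y → 0# < x * y

  _≤_ : Rel Carrier ℓ₃
  x ≤ y = ¬ (y < x)

  -- |x - y| < ε
  Within : Carrier → Carrier → Carrier → Set ℓ₃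
  Within ε x y = (x - y < ε) × (y - x < ε)

  _⟶_ : (ℕ → Carrier) → Carrier → Set (c ⊔ ℓ₃)
  a ⟶ l = ∀ ε → 0# < ε → ∃ λ N → ∀ m → N ℕ.≤ m → Within ε (a m) l

  Cauchy : (ℕ → Carrier) → Set (c ⊔ ℓ₃)
  Cauchy a = ∀ ε → 0# < ε → ∃ λ N → ∀ m n → N ℕ.≤ m → N ℕ.≤ n → Within ε (a m) (a n)

  module S = RawSemiringDefs rawSemiring

  field
    archimedean : ∀ x → ∃ λ n → x < n S.× 1#
    complete    : ∀ a → Cauchy a → ∃ λ l → a ⟶ l

  fromℤ : ℤ → Carrier
  fromℤ (+ n)    = n S.× 1#
  fromℤ -[1+ n ] = - (suc n S.× 1#)

  recip : ∀ x → 0# < x → Carrier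
  recip x 0<x = proj₁ (#⇒invertible (#-sym (<⇒# 0<x)))

  -- #⇒invertible literally inverts x - 0#.
  recip-inverseʳ : ∀ x (0<x : 0# < x) → x * recip x 0<x ≈ 1#
  recip-inverseʳ x 0<x =
    trans (*-congʳ (sym (trans (+-congˡ -0#≈0#) (+-identityʳ x))))
          (proj₂ (proj₂ (#⇒invertible (#-sym (<⇒# 0<x)))))
    where open RingProperties ring using (-0#≈0#)

------------------------------------------------------------------------
-- Matrices over a ring

module Matrices {a ℓ} (R : RawRing a ℓ) where
  open RawRing R
  open RawSemiringDefs rawSemiring using (sum; _^_)

  Matrix : ℕ → ℕ → Set a
  Matrix m n = Fin m → Fin n → Carrier

  scalar : ∀ {n} → Carrier → Matrix n n
  scalar x i j = if does (i Fin.≟ j) then x else 0#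

  matrixRawRing : ℕ → RawRing a ℓ
  matrixRawRing n = record
    { Carrier = Matrix n n
    ; _≈_     = λ A B → ∀ i j → A i j ≈ B i j
    ; _+_     = λ A B i j → A i j + B i j
    ; _*_     = λ A B i k → sum (λ j → A i j * B j k)
    ; -_      = λ A i j → - A i j
    ; 0#      = λ _ _ → 0#
    ; 1#      = scalar 1#
    }

  infixr 8 _^ₘ_
  _^ₘ_ : ∀ {n} → Matrix n n → ℕ → Matrix n n
  _^ₘ_ {n} = RawSemiringDefs._^_ (RawRing.rawSemiring (matrixRawRing n))

  dot : ∀ {n} → Vector Carrier n → Vector Carrier n → Carrier
  dot u v = sum (λ i → u i * v i)

  infixr 7 _*ᵥ_ _·ᵥ_
  infixl 7 _ᵥ*_

  _*ᵥ_ : ∀ {m n} → Matrix m n → Vector Carrier n → Vector Carrier m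
  (A *ᵥ v) i = dot (A i) v

  _ᵥ*_ : ∀ {m n} → Vector Carrier m → Matrix m n → Vector Carrier n
  (v ᵥ* A) j = dot v (λ i → A i j)

  _·ᵥ_ : ∀ {n} → Carrier → Vector Carrier n → Vector Carrier n
  (x ·ᵥ v) i = x * v i

  infix 4 _≈ᵥ_
  _≈ᵥ_ : ∀ {n} → Rel (Vector Carrier n) ℓ
  u ≈ᵥ v = ∀ i → u i ≈ v i

  -- Laplace expansion along the first row.
  det : ∀ {n} → Matrix n n → Carrier
  det {zero}  A = 1#
  det {suc n} A = sum λ j →
    (- 1#) ^ toℕ j * (A zero j * det (λ i k → A (suc i) (punchIn j k)))

------------------------------------------------------------------------
-- Polynomials in one variable

-- Coefficient lists, constant term first; trailing zeros are permitted,
-- so equality compares coefficients.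
module Polynomials {a ℓ} (R : RawRing a ℓ) where
  open RawRing R

  Poly : Set a
  Poly = List Carrier

  coeff : Poly → ℕ → Carrier
  coeff []      _       = 0#
  coeff (a ∷ p) zero    = a
  coeff (a ∷ p) (suc k) = coeff p k

  const : Carrier → Poly
  const a = a ∷ []

  X : Poly
  X = 0# ∷ 1# ∷ []

  infixl 6 _+ₚ_
  _+ₚ_ : Poly → Poly → Poly
  []      +ₚ q       = q
  (a ∷ p) +ₚ []      = a ∷ p
  (a ∷ p) +ₚ (b ∷ q) = (a + b) ∷ (p +ₚ q)

  infixl 7 _*ₚ_
  _*ₚ_ : Poly → Poly → Poly
  []      *ₚ q = []
  (a ∷ p) *ₚ q = List.map (a *_) q +ₚ (0# ∷ (p *ₚ q))

  polyRawRing : RawRing a ℓ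
  polyRawRing = record
    { Carrier = Poly
    ; _≈_     = λ p q → ∀ k → coeff p k ≈ coeff q k
    ; _+_     = _+ₚ_
    ; _*_     = _*ₚ_
    ; -_      = List.map (-_)
    ; 0#      = []
    ; 1#      = const 1#
    }

  eval : Poly → Carrier → Carrier
  eval []      x = 0#
  eval (a ∷ p) x = a + x * eval p x

------------------------------------------------------------------------
-- The sequence c

σ : ℕ → ℕ
σ k = ListAction.sum (List.filter (_∣? k) (List.applyUpTo suc k))

module ℤΣ = RawSemiringDefs ℤ.+-*-rawSemiring

c-step : ∀ n → (∀ {k} → k ℕ.< n → ℤ) → ℤ
c-step zero      _   = 1ℤ
c-step n@(suc _) rec = ℤΣ.sum {n} λ k →
  (-1ℤ ℤ.^ (n ∸ toℕ k ℕ.+ 1)) ℤ.* (+ σ (n ∸ toℕ k ℕ.+ 1)) ℤ.* rec (Fin.toℕ<n k)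

c : ℕ → ℤ
c = <-rec (λ _ → ℤ) c-step

------------------------------------------------------------------------
-- Spectral theory of real matrices

module RealMatrices {c ℓ₁ ℓ₂ ℓ₃} (ℝ : RealField c ℓ₁ ℓ₂ ℓ₃) where
  open RealField ℝ public
  open RawSemiringDefs rawSemiring public using (sum)
  open Matrices rawRing public

  ℂ : Set c
  ℂ = Carrier × Carrier

  infix 4 _≈ᶜ_
  _≈ᶜ_ : Rel ℂ ℓ₁
  (a , b) ≈ᶜ (a′ , b′) = (a ≈ a′) × (b ≈ b′)

  ℂ-rawRing : RawRing c ℓ₁
  ℂ-rawRing = record
    { Carrier = ℂ
    ; _≈_     = _≈ᶜ_
    ; _+_     = λ (a , b) (a′ , b′) → (a + a′) , (b + b′)
    ; _*_     = λ (a , b) (a′ , b′) → (a * a′ - b * b′) , (a * b′ + b * a′)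
    ; -_      = λ (a , b) → (- a) , (- b)
    ; 0#      = 0# , 0#
    ; 1#      = 1# , 0#
    }

  fromReal : Carrier → ℂ
  fromReal a = a , 0#

  Nonzeroᶜ : ℂ → Set ℓ₂
  Nonzeroᶜ (a , b) = (a # 0#) ⊎ (b # 0#)

  -- r = |z|, i.e. r is the nonnegative square root of re² + im².
  IsModulus : ℂ → Carrier → Set (ℓ₁ ⊔ ℓ₃)
  IsModulus (a , b) r = (0# ≤ r) × (r * r ≈ a * a + b * b)

  module Mᶜ = Matrices ℂ-rawRing
  module P  = Polynomials rawRing
  module Mₚ = Matrices P.polyRawRing
  module Pᴿ = RawRing P.polyRawRing

  IsEigenvalue : ∀ {n} → Matrix n n → ℂ → Set (c ⊔ ℓ₁ ⊔ ℓ₂)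
  IsEigenvalue {n} A β = ∃ λ (v : Vector ℂ n) →
    (∃ λ i → Nonzeroᶜ (v i)) ×
    ((λ i j → fromReal (A i j)) Mᶜ.*ᵥ v) Mᶜ.≈ᵥ (β Mᶜ.·ᵥ v)

  -- The largest modulus of an eigenvalue.
  IsSpectralRadius : ∀ {n} → Matrix n n → Carrier → Set (c ⊔ ℓ₁ ⊔ ℓ₂ ⊔ ℓ₃)
  IsSpectralRadius A ρ =
    (∃ λ β → IsEigenvalue A β × IsModulus β ρ) ×
    (∀ β → IsEigenvalue A β → ∃ λ r → IsModulus β r × r ≤ ρ)

  charPoly : ∀ {n} → Matrix n n → P.Poly
  charPoly A = Mₚ.det (λ i j → Mₚ.scalar P.X i j Pᴿ.+ Pᴿ.- P.const (A i j))

  -- p = (X - a)ᵐ q with q(a) ≠ 0.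
  HasRootOfMultiplicity : P.Poly → Carrier → ℕ → Set (c ⊔ ℓ₁ ⊔ ℓ₂)
  HasRootOfMultiplicity p a m = ∃ λ q →
    p Pᴿ.≈ (P.X Pᴿ.+ Pᴿ.- P.const a) ^ₚ m Pᴿ.* q × P.eval q a # 0#
    where open RawSemiringDefs Pᴿ.rawSemiring renaming (_^_ to _^ₚ_)

  IsAlgebraicallySimpleEigenvalue : ∀ {n} → Matrix n n → Carrier → Set (c ⊔ ℓ₁ ⊔ ℓ₂)
  IsAlgebraicallySimpleEigenvalue A ρ =
    IsEigenvalue A (fromReal ρ) × HasRootOfMultiplicity (charPoly A) ρ 1

  IsPrimitive : ∀ {n} → Matrix n n → Set ℓ₃
  IsPrimitive A =
    (∀ i j → 0# ≤ A i j) ×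
    (∃ λ k → 1 ℕ.≤ k × (∀ i j → 0# < (A ^ₘ k) i j))

  _/[_,_] : ∀ {n} → Matrix n n → ∀ ρ → 0# < ρ → Matrix n n
  (A /[ ρ , 0<ρ ]) i j = A i j * recip ρ 0<ρ

  -- Convergence in the finite-dimensional space of matrices, entrywise.
  _⟶ₘ_ : ∀ {n} → (ℕ → Matrix n n) → Matrix n n → Set (c ⊔ ℓ₃)
  A ⟶ₘ L = ∀ i j → (λ m → A m i j) ⟶ L i j

  -- x yᵀ
  outer : ∀ {n} → Vector Carrier n → Vector Carrier n → Matrix n n
  outer x y i j = x i * y j

------------------------------------------------------------------------
-- The matrix Mₙʰ

module HessenbergMatrix {ℓc ℓ₁ ℓ₂ ℓ₃} (ℝ : RealField ℓc ℓ₁ ℓ₂ ℓ₃) where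
  open RealMatrices ℝ

  -- Fin indices start at 0: the mathematical indices are toℕ i + 1 and
  -- toℕ j + 1.  The value h 0 is never used.
  M : (ℕ → Carrier) → (n : ℕ) → Matrix (n ∸ 1) (n ∸ 1)
  M h n i j = entry (suc (toℕ i)) (suc (toℕ j))
    where
    entry : ℕ → ℕ → Carrier
    entry i j = if does (j ∸ 1 ℕ.≤? i) then fromℤ (c (i ℕ.+ 1 ∸ j)) * h j else 0#

{-# OPTIONS --safe #-}
module Submission where

-- The numbers cₙ are positive: multiplying the defining recurrence by the
-- first terms 1 + x - x² of Euler's product leaves cₙ = 2cₙ₋₁ + 5cₙ₋₄ - cₙ₋₅ + …,
-- whose remaining terms are dominated because cₙ₊₁ ≥ 2cₙ for n ≥ 2.  Hence Mₙʰ
-- is Hessenberg with positive entries up to the superdiagonal, and its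
-- (n-1)-st power is positive.
--
-- For a primitive matrix A and u > 0 the componentwise ratios of Aᵐv to Aᵐu
-- lie in shrinking intervals: a positive power of A contracts them by a fixed
-- factor.  Their limits form a positive left eigenvector.  With Aᵀ and
-- u = (1, …, 1) this produces the right eigenvector x; with A and u = x it
-- produces y, together with (A/ρ)ᵐ → x yᵀ.  An eigenvector v for β ≠ ρ has
-- y · v = 0, so (β/ρ)ᵐ v → 0 and |β| < ρ.
--
-- Simplicity of ρ uses the Hessenberg shape: the cofactors w of the first
-- column of X - A satisfy wᵀ(X - A) = (det(X - A), 0, …, 0).  Multiplying by x
-- gives det(X - A) x₁ = (X - ρ)(w · x), and w(ρ) is a positive multiple of y.

open import Defs
open import Algebra.Bundles using (CommutativeRing)
open import Algebra.Bundles.Raw using (RawRing)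
open import Algebra.Solver.Ring.AlmostCommutativeRing using (fromCommutativeRing; _-Raw-AlmostCommutative⟶_)
import Algebra.Apartness.Properties.HeytingCommutativeRing as HCRProperties
import Algebra.Definitions.RawSemiring as RawSemiringDefs
import Algebra.Properties.AbelianGroup as AbelianGroupProperties
import Algebra.Properties.Monoid.Sum as MonoidSum
import Algebra.Properties.Ring as RingProperties
import Algebra.Properties.Semiring.Mult.TCOptimised as SemiringMult
import Algebra.Properties.Semiring.Sum as SemiringSum
import Algebra.Solver.Ring as RingSolver
open import Data.Bool.Base using (true; false; if_then_else_)
open import Data.Fin.Base using (Fin; zero; suc; toℕ; inject₁; fromℕ; fromℕ<; punchIn)
import Data.Fin.Properties as Fin
open import Data.Integer.Base as ℤ using (ℤ; +_; -[1+_]; 0ℤ; -1ℤ)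
import Data.Integer.Properties as ℤ
open import Data.Integer.Solver using (module +-*-Solver)
open import Data.List.Base as List using ([]; _∷_)
open import Data.Maybe.Base using (Maybe; just; nothing)
open import Data.Nat.Base as ℕ using (ℕ; zero; suc)
open import Data.Nat.Divisibility using (_∣?_)
open import Data.Nat.Induction using (<-wellFounded)
import Data.Nat.ListAction as ListAction
import Data.Nat.Properties as ℕ
open import Data.Product.Base using (∃; Σ; _×_; _,_; proj₁; proj₂)
open import Data.Sum.Base using (_⊎_; inj₁; inj₂; [_,_]′)
open import Data.Vec.Functional using (Vector)
open import Function.Base using (_∘_; _$_)
import Induction.WellFounded as WellFounded
open import Level using (_⊔_)
open import Relation.Binary.Structures using (IsStrictPartialOrder; IsPreorder)
import Relation.Binary.PropositionalEquality as ≡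
open ≡ using (_≡_)
import Relation.Binary.Reasoning.Base.Triple as TripleReasoning
import Relation.Binary.Reasoning.Setoid as SetoidReasoning
open import Relation.Nullary.Decidable using (Dec; yes; no; does; toWitness)
open import Relation.Nullary.Negation using (¬_; contradiction)
open import Relation.Unary using (Pred; Decidable)

-- The axioms for the reals are constructive: `x ≤ y` is a negation, and neither order nor equality
-- is decidable. A Perron vector therefore cannot be found by maximising over a compact simplex.
-- Limits come from `complete` applied to intervals that shrink geometrically, case distinctions
-- come from cotransitivity of `_<_`, and equalities and weak inequalities are proved by refuting
-- apartness or strict inequality.
--
-- For `c`, positivity and doubling are carried through one induction. Among the first eleven
-- coefficients of `d`, each negative one is paired with the positive one just before it. The
-- remaining coefficients are bounded crudely by a quadratic, and doubling makes their total cost at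
-- most 1548 `c m`, against a reserve of 4 `c (10 + m)`, which is at least 2048 `c m`.
--
-- The last cofactor is the product of the negated superdiagonal entries of `X - A`, a positive
-- constant. This is what keeps `w` from vanishing at `ρ`, without an argument about ranks.

-- Positivity of the sequence `c`

module CPositive where
  open +-*-Solver
  open MonoidSum ℤ.+-0-monoid using (sum-cong-≗; sum-init-last)

  sum-filter-bound : ∀ {p} {P : Pred ℕ p} (P? : Decidable P) (f : ℕ → ℕ) n b → (∀ i → i ℕ.< n → f i ℕ.≤ b) →
                     ListAction.sum (List.filter P? (List.applyUpTo f n)) ℕ.≤ n ℕ.* b
  sum-filter-bound P? f zero    b f≤b = ℕ.z≤n
  sum-filter-bound P? f (suc n) b f≤b with P? (f 0)
  ... | yes _ = ℕ.+-mono-≤ (f≤b 0 (ℕ.s≤s ℕ.z≤n)) (sum-filter-bound P? (f ∘ suc) n b (λ i i<n → f≤b (suc i) (ℕ.s≤s i<n)))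
  ... | no  _ = ℕ.≤-trans (sum-filter-bound P? (f ∘ suc) n b (λ i i<n → f≤b (suc i) (ℕ.s≤s i<n))) (ℕ.m≤n+m (n ℕ.* b) b)

  σ≤² : ∀ k → σ k ℕ.≤ k ℕ.* k
  σ≤² k = sum-filter-bound (_∣? k) suc k k (λ i i<k → i<k)

  -- α i = (-1)ⁱ σ(i + 2) is the coefficient of c (n - 1 - i) in the recurrence for c n.
  α : ℕ → ℤ
  α i = (-1ℤ ℤ.^ (suc i ℕ.+ 1)) ℤ.* (+ σ (suc i ℕ.+ 1))

  ∣α∣≤ : ∀ i → ℤ.∣ α i ∣ ℕ.≤ (i ℕ.+ 2) ℕ.* (i ℕ.+ 2)
  ∣α∣≤ i = ℕ.≤-trans (ℕ.≤-reflexive (begin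
    ℤ.∣ (-1ℤ ℤ.^ (suc i ℕ.+ 1)) ℤ.* (+ σ (suc i ℕ.+ 1)) ∣        ≡⟨ ℤ.abs-* (-1ℤ ℤ.^ (suc i ℕ.+ 1)) (+ σ (suc i ℕ.+ 1)) ⟩
    ℤ.∣ -1ℤ ℤ.^ (suc i ℕ.+ 1) ∣ ℕ.* σ (suc i ℕ.+ 1)              ≡⟨ ≡.cong (ℕ._* σ (suc i ℕ.+ 1)) (∣-1^∣ (suc i ℕ.+ 1)) ⟩
    1 ℕ.* σ (suc i ℕ.+ 1)                                        ≡⟨ ℕ.*-identityˡ _ ⟩
    σ (suc i ℕ.+ 1)                                              ≡⟨ ≡.cong σ (≡.sym (ℕ.+-suc i 1)) ⟩
    σ (i ℕ.+ 2)                                                  ∎)) (σ≤² (i ℕ.+ 2))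
    where
    open ≡.≡-Reasoning
    ∣-1^∣ : ∀ k → ℤ.∣ -1ℤ ℤ.^ k ∣ ≡ 1
    ∣-1^∣ zero    = ≡.refl
    ∣-1^∣ (suc k) = ≡.trans (ℤ.abs-* -1ℤ (-1ℤ ℤ.^ k)) (≡.trans (ℕ.*-identityˡ _) (∣-1^∣ k))

  -- An opaque copy of c, which keeps the type checker from unfolding the
  -- well-founded recursion.
  abstract
    e : ℕ → ℤ
    e = c

    e≡c : ∀ n → e n ≡ c n
    e≡c n = ≡.refl

  -- The convolution of `f` with `e`, that is, the sum of `f i * e (n - 1 - i)` over `i < n`. It
  -- recurses from the newest value of `e`, so that splitting off the leading coefficient holds by
  -- computation.
  history : (ℕ → ℤ) → ℕ → ℤ
  history f zero    = 0ℤ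
  history f (suc n) = f 0 ℤ.* e n ℤ.+ history (f ∘ suc) n

  -- The recurrence sums from the oldest value and `history` from the newest, so the induction peels
  -- off the last summand.
  sum-history : ∀ f n → ℤΣ.sum {n} (λ k → f (n ℕ.∸ suc (toℕ k)) ℤ.* e (toℕ k)) ≡ history f n
  sum-history f zero    = ≡.refl
  sum-history f (suc n) = begin
    ℤΣ.sum {suc n} g
      ≡⟨ sum-init-last g ⟩
    ℤΣ.sum {n} (g ∘ inject₁) ℤ.+ g (fromℕ n)
      ≡⟨ ≡.cong₂ ℤ._+_ (≡.trans (sum-cong-≗ init) (sum-history (f ∘ suc) n)) last ⟩
    history (f ∘ suc) n ℤ.+ f 0 ℤ.* e n
      ≡⟨ ℤ.+-comm (history (f ∘ suc) n) (f 0 ℤ.* e n) ⟩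
    history f (suc n) ∎
    where
    open ≡.≡-Reasoning
    g : Vector ℤ (suc n)
    g k = f (suc n ℕ.∸ suc (toℕ k)) ℤ.* e (toℕ k)
    init : ∀ k → g (inject₁ k) ≡ f (suc (n ℕ.∸ suc (toℕ k))) ℤ.* e (toℕ k)
    init k rewrite Fin.toℕ-inject₁ k = ≡.cong (λ i → f i ℤ.* e (toℕ k)) (ℕ.+-∸-assoc 1 (Fin.toℕ<n k))
    last : g (fromℕ n) ≡ f 0 ℤ.* e n
    last rewrite Fin.toℕ-fromℕ n | ℕ.n∸n≡0 n = ≡.refl

  -- Well-founded recursion does not compute at an open argument. The fixed-point theorem unfolds it
  -- once `c-step` is known to respect pointwise equality of the recursive calls.
  c-unfold : ∀ n → c (suc n) ≡ ℤΣ.sum {suc n} (λ k → α (suc n ℕ.∸ suc (toℕ k)) ℤ.* c (toℕ k))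
  c-unfold n = ≡.trans (FP.unfold-wfRec {suc n}) (sum-cong-≗ term)
    where
    extensional : ∀ m {r s : ∀ {k} → k ℕ.< m → ℤ} → (∀ {k} (k<m : k ℕ.< m) → r k<m ≡ s k<m) → c-step m r ≡ c-step m s
    extensional zero    r≡s = ≡.refl
    extensional (suc m) r≡s = sum-cong-≗ {suc m} (λ k →
      ≡.cong (λ x → (-1ℤ ℤ.^ (suc m ℕ.∸ toℕ k ℕ.+ 1)) ℤ.* (+ σ (suc m ℕ.∸ toℕ k ℕ.+ 1)) ℤ.* x) (r≡s (Fin.toℕ<n k)))
    module FP = WellFounded.FixPoint <-wellFounded (λ _ → ℤ) c-step extensional
    term : ∀ (k : Fin (suc n)) → (-1ℤ ℤ.^ (suc n ℕ.∸ toℕ k ℕ.+ 1)) ℤ.* (+ σ (suc n ℕ.∸ toℕ k ℕ.+ 1)) ℤ.* c (toℕ k)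
                                ≡ α (suc n ℕ.∸ suc (toℕ k)) ℤ.* c (toℕ k)
    term k = ≡.cong (λ j → (-1ℤ ℤ.^ (j ℕ.+ 1)) ℤ.* (+ σ (j ℕ.+ 1)) ℤ.* c (toℕ k)) (ℕ.+-∸-assoc 1 (ℕ.≤-pred (Fin.toℕ<n k)))

  e-unfold : ∀ n → e (suc n) ≡ history α (suc n)
  e-unfold n = ≡.trans (e≡c (suc n)) (≡.trans (c-unfold n) (≡.trans
    (sum-cong-≗ {suc n} (λ k → ≡.cong (α (suc n ℕ.∸ suc (toℕ k)) ℤ.*_) (≡.sym (e≡c (toℕ k)))))
    (sum-history α (suc n))))

  -- Multiplying the generating function Σ (-1)ᵏ σ(k + 1) xᵏ of the
  -- recurrence by 1 + x - x², the beginning of Euler's product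
  -- ∏ (1 - (-x)ᵏ), makes its first coefficients small.
  abstract
    d : ℕ → ℤ
    d i = α (suc (suc i)) ℤ.+ α (suc i) ℤ.- α i

    d≡ : ∀ i → d i ≡ α (suc (suc i)) ℤ.+ α (suc i) ℤ.- α i
    d≡ i = ≡.refl

  history-cong : ∀ {f g} → (∀ i → f i ≡ g i) → ∀ n → history f n ≡ history g n
  history-cong f≡g zero    = ≡.refl
  history-cong f≡g (suc n) = ≡.cong₂ (λ x y → x ℤ.* e n ℤ.+ y) (f≡g 0) (history-cong (f≡g ∘ suc) n)

  history-d : ∀ n → history d n ≡ history (λ i → α (suc (suc i))) n ℤ.+ history (λ i → α (suc i)) n ℤ.- history α n
  history-d n = ≡.trans (history-cong d≡ n) (go α (λ i → α (suc i)) (λ i → α (suc (suc i))) n)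
    where
    go : ∀ f g h n → history (λ i → h i ℤ.+ g i ℤ.- f i) n ≡ history h n ℤ.+ history g n ℤ.- history f n
    go f g h zero    = ≡.refl
    go f g h (suc n) = ≡.trans (≡.cong (ℤ._+_ ((h 0 ℤ.+ g 0 ℤ.- f 0) ℤ.* e n)) (go (f ∘ suc) (g ∘ suc) (h ∘ suc) n))
      (solve 7 (λ h g f k H G F → (h :+ g :- f) :* k :+ (H :+ G :- F) := (h :* k :+ H) :+ (g :* k :+ G) :- (f :* k :+ F)) ≡.refl
        (h 0) (g 0) (f 0) (e n) (history (h ∘ suc) n) (history (g ∘ suc) n) (history (f ∘ suc) n))

  -- The recurrences at `3 + n`, `2 + n` and `1 + n` are combined with signs +, +, -. Since `α 0` is
  -- 3 and `α 1` is -4, the coefficient of `e (2 + n)` becomes 3 - 1 = 2, one copy of `e (1 + n)`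
  -- cancels as -4 + 3 + 1 = 0, and everything older is collected in `d`.
  e-recurrence : ∀ n → e (3 ℕ.+ n) ≡ + 2 ℤ.* e (2 ℕ.+ n) ℤ.+ history d (suc n)
  e-recurrence n = begin
    e (3 ℕ.+ n)
      ≡⟨ solve 3 (λ x y z → x := x :+ y :- z :- y :+ z) ≡.refl (e (3 ℕ.+ n)) (e (2 ℕ.+ n)) (e (1 ℕ.+ n)) ⟩
    e (3 ℕ.+ n) ℤ.+ e (2 ℕ.+ n) ℤ.- e (1 ℕ.+ n) ℤ.- e (2 ℕ.+ n) ℤ.+ e (1 ℕ.+ n)
      ≡⟨ ≡.cong₂ (λ s t → s ℤ.- e (2 ℕ.+ n) ℤ.+ t)
           (≡.cong₂ ℤ._-_ (≡.cong₂ ℤ._+_ (e-unfold (2 ℕ.+ n)) (e-unfold (1 ℕ.+ n))) (e-unfold n)) ≡.refl ⟩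
    history α (3 ℕ.+ n) ℤ.+ history α (2 ℕ.+ n) ℤ.- history α (1 ℕ.+ n) ℤ.- e (2 ℕ.+ n) ℤ.+ e (1 ℕ.+ n)
      ≡⟨ solve 5 (λ e f h g k → (con (+ 3) :* e :+ (con -[1+ 3 ] :* f :+ h)) :+ (con (+ 3) :* f :+ g) :- k :- e :+ f
                              := con (+ 2) :* e :+ (h :+ g :- k)) ≡.refl
           (e (2 ℕ.+ n)) (e (1 ℕ.+ n)) (history (λ i → α (suc (suc i))) (suc n)) (history (λ i → α (suc i)) (suc n)) (history α (suc n)) ⟩
    + 2 ℤ.* e (2 ℕ.+ n) ℤ.+ (history (λ i → α (suc (suc i))) (suc n) ℤ.+ history (λ i → α (suc i)) (suc n) ℤ.- history α (suc n))
      ≡⟨ ≡.cong (ℤ._+_ (+ 2 ℤ.* e (2 ℕ.+ n))) (history-d (suc n)) ⟨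
    + 2 ℤ.* e (2 ℕ.+ n) ℤ.+ history d (suc n) ∎
    where open ≡.≡-Reasoning
  ≤-by : ∀ {x y e} → 0ℤ ℤ.≤ e → e ≡ y ℤ.- x → x ℤ.≤ y
  ≤-by 0≤e e≡y-x = ℤ.0≤i-j⇒j≤i (≡.subst (0ℤ ℤ.≤_) e≡y-x 0≤e)

  0≤-minus : ∀ {x y} → x ℤ.≤ y → 0ℤ ℤ.≤ y ℤ.- x
  0≤-minus = ℤ.i≤j⇒0≤j-i

  +-nonneg : ∀ {x y} → 0ℤ ℤ.≤ x → 0ℤ ℤ.≤ y → 0ℤ ℤ.≤ x ℤ.+ y
  +-nonneg = ℤ.+-mono-≤

  *-nonneg : ∀ {x y} → 0ℤ ℤ.≤ x → 0ℤ ℤ.≤ y → 0ℤ ℤ.≤ x ℤ.* y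
  *-nonneg {+ m} {+ n} _ _ = ≡.subst (0ℤ ℤ.≤_) (ℤ.pos-* m n) (ℤ.+≤+ ℕ.z≤n)

  0≤+ : ∀ {n} → 0ℤ ℤ.≤ + n
  0≤+ = ℤ.+≤+ ℕ.z≤n

  -- The offset `N` is a parameter because dropping the leading coefficient of a `history` raises it
  -- by one.
  weight : ℕ → ℕ → ℤ
  weight N i = + 3 ℤ.* (+ (i ℕ.+ N) ℤ.* + (i ℕ.+ N))

  ∣i∣≤n⇒ : ∀ {i n} → ℤ.∣ i ∣ ℕ.≤ n → (i ℤ.≤ + n) × (ℤ.- (+ n) ℤ.≤ i)
  ∣i∣≤n⇒ {+ i} {n}     i≤n = ℤ.+≤+ i≤n , ℤ.neg-≤-pos
  ∣i∣≤n⇒ { -[1+ i ] } {suc n} (ℕ.s≤s i≤n) = ℤ.-≤+ , ℤ.-≤- i≤n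

  -- `d i` combines three values `α j` with `j ≤ 2 + i`, each of absolute value at most
  -- `(j + 2)² ≤ (i + 4)²`.
  d+weight-nonneg : ∀ i → 0ℤ ℤ.≤ d i ℤ.+ weight 4 i
  d+weight-nonneg i rewrite d≡ i = ≡.subst (0ℤ ℤ.≤_)
    (solve 4 (λ a b g w → (b :- (:- w)) :+ (a :- (:- w)) :+ (w :- g) := (b :+ a :- g) :+ con (+ 3) :* w) ≡.refl (α (suc i)) (α (suc (suc i))) (α i) W)
    (+-nonneg (+-nonneg (0≤-minus (proj₂ (bound (suc (suc i)) ℕ.≤-refl)))
                        (0≤-minus (proj₂ (bound (suc i) (ℕ.n≤1+n _)))))
              (0≤-minus (proj₁ (bound i (ℕ.≤-trans (ℕ.n≤1+n _) (ℕ.n≤1+n _))))))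
    where
    W = + (i ℕ.+ 4) ℤ.* + (i ℕ.+ 4)
    bound : ∀ j → j ℕ.≤ 2 ℕ.+ i → (α j ℤ.≤ W) × (ℤ.- W ℤ.≤ α j)
    bound j j≤ = ≡.subst (λ w → (α j ℤ.≤ w) × (ℤ.- w ℤ.≤ α j)) (ℤ.pos-* (i ℕ.+ 4) (i ℕ.+ 4))
      (∣i∣≤n⇒ (ℕ.≤-trans (∣α∣≤ j) (ℕ.*-mono-≤ j+2≤ j+2≤)))
      where
      j+2≤ : j ℕ.+ 2 ℕ.≤ i ℕ.+ 4
      j+2≤ = ℕ.≤-trans (ℕ.+-monoˡ-≤ 2 j≤) (ℕ.≤-reflexive (≡.trans (≡.cong (ℕ._+ 2) (ℕ.+-comm 2 i)) (ℕ.+-assoc i 2 2)))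

  -- The sequence begins 1, 3, 5, 10, and the step from 3 to 5 does not double. Hence doubling is
  -- claimed from index 2 on.
  record GrowsUpTo (n : ℕ) : Set where
    field
      positive : ∀ k → k ℕ.≤ n → + 1 ℤ.≤ e k
      doubles  : ∀ k → 2 ℕ.≤ k → k ℕ.< n → + 2 ℤ.* e k ℤ.≤ e (suc k)

    nonneg : ∀ k → k ℕ.≤ n → 0ℤ ℤ.≤ e k
    nonneg k k≤n = ℤ.≤-trans 0≤+ (positive k k≤n)

    increasing : ∀ k → k ℕ.< n → e k ℤ.≤ e (suc k)
    increasing zero          _   rewrite e≡c 0 | e≡c 1 = ℤ.+≤+ (ℕ.s≤s ℕ.z≤n)
    increasing (suc zero)    _   rewrite e≡c 1 | e≡c 2 = ℤ.+≤+ (ℕ.s≤s (ℕ.s≤s (ℕ.s≤s ℕ.z≤n)))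
    increasing k@(suc (suc _)) k<n = ℤ.≤-trans
      (≤-by (nonneg k (ℕ.<⇒≤ k<n)) (solve 1 (λ x → x := con (+ 2) :* x :- x) ≡.refl (e k)))
      (doubles k (ℕ.s≤s (ℕ.s≤s ℕ.z≤n)) k<n)

  history-nonneg : ∀ {n} → GrowsUpTo n → ∀ f → (∀ i → 0ℤ ℤ.≤ f i) → ∀ m → m ℕ.≤ suc n → 0ℤ ℤ.≤ history f m
  history-nonneg grows f 0≤f zero    _     = 0≤+
  history-nonneg grows f 0≤f (suc m) (ℕ.s≤s m≤n) = +-nonneg (*-nonneg (0≤f 0) (GrowsUpTo.nonneg grows m m≤n))
    (history-nonneg grows (f ∘ suc) (0≤f ∘ suc) m (ℕ.m≤n⇒m≤1+n m≤n))

  history-+ : ∀ f g n → history (λ i → f i ℤ.+ g i) n ≡ history f n ℤ.+ history g n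
  history-+ f g zero    = ≡.refl
  history-+ f g (suc n) = ≡.trans (≡.cong (ℤ._+_ ((f 0 ℤ.+ g 0) ℤ.* e n)) (history-+ (f ∘ suc) (g ∘ suc) n))
    (solve 5 (λ f g k F G → (f :+ g) :* k :+ (F :+ G) := (f :* k :+ F) :+ (g :* k :+ G)) ≡.refl
      (f 0) (g 0) (e n) (history (f ∘ suc) n) (history (g ∘ suc) n))

  -- Σ_{k ≥ 0} 3 (N + k)² 2⁻ᵏ
  capacity : ℤ → ℤ
  capacity N = + 6 ℤ.* (N ℤ.* N) ℤ.+ + 12 ℤ.* N ℤ.+ + 18

  -- `capacity N` equals `weight N 0` plus half of `capacity (N + 1)`, and doubling gives
  -- `e m ≤ e (suc m) / 2`. So the bound passes from `m` and `N + 1` to `suc m` and `N`. Up to index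
  -- 2, where doubling is not yet available, it is computed.
  history-weight : ∀ {n} → GrowsUpTo n → ∀ m → m ℕ.≤ n → ∀ N → history (weight N) (suc m) ℤ.≤ capacity (+ N) ℤ.* e m
  history-weight grows 0 _ N rewrite e≡c 0 = ≤-by
    (+-nonneg (+-nonneg (*-nonneg (0≤+ {3}) (*-nonneg (0≤+ {N}) (0≤+ {N}))) (*-nonneg (0≤+ {12}) (0≤+ {N}))) (0≤+ {18}))
    (solve 1 (λ N → con (+ 3) :* (N :* N) :+ con (+ 12) :* N :+ con (+ 18)
       := (con (+ 6) :* (N :* N) :+ con (+ 12) :* N :+ con (+ 18)) :* con (+ 1)
          :- (con (+ 3) :* (N :* N) :* con (+ 1) :+ con (+ 0))) ≡.refl (+ N))
  history-weight grows 1 _ N rewrite e≡c 0 | e≡c 1 = ≤-by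
    (+-nonneg (+-nonneg (*-nonneg (0≤+ {6}) (*-nonneg (0≤+ {N}) (0≤+ {N}))) (*-nonneg (0≤+ {30}) (0≤+ {N}))) (0≤+ {51}))
    (solve 1 (λ N → con (+ 6) :* (N :* N) :+ con (+ 30) :* N :+ con (+ 51)
       := (con (+ 6) :* (N :* N) :+ con (+ 12) :* N :+ con (+ 18)) :* con (+ 3)
          :- (con (+ 3) :* (N :* N) :* con (+ 3) :+ (con (+ 3) :* ((con (+ 1) :+ N) :* (con (+ 1) :+ N)) :* con (+ 1) :+ con (+ 0)))) ≡.refl (+ N))
  history-weight grows 2 _ N rewrite e≡c 0 | e≡c 1 | e≡c 2 = ≤-by
    (+-nonneg (+-nonneg (*-nonneg (0≤+ {3}) (*-nonneg (0≤+ {N}) (0≤+ {N}))) (*-nonneg (0≤+ {30}) (0≤+ {N}))) (0≤+ {69}))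
    (solve 1 (λ N → con (+ 3) :* (N :* N) :+ con (+ 30) :* N :+ con (+ 69)
       := (con (+ 6) :* (N :* N) :+ con (+ 12) :* N :+ con (+ 18)) :* con (+ 5)
          :- (con (+ 3) :* (N :* N) :* con (+ 5) :+ (con (+ 3) :* ((con (+ 1) :+ N) :* (con (+ 1) :+ N)) :* con (+ 3)
               :+ (con (+ 3) :* ((con (+ 2) :+ N) :* (con (+ 2) :+ N)) :* con (+ 1) :+ con (+ 0))))) ≡.refl (+ N))
  history-weight grows (suc m@(suc (suc _))) m<n N = begin
    weight N 0 ℤ.* e (suc m) ℤ.+ history (weight N ∘ suc) (suc m)
      ≡⟨ ≡.cong (ℤ._+_ (weight N 0 ℤ.* e (suc m))) (history-cong (λ i → ≡.cong (λ k → + 3 ℤ.* (+ k ℤ.* + k)) (≡.sym (ℕ.+-suc i N))) (suc m)) ⟩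
    weight N 0 ℤ.* e (suc m) ℤ.+ history (weight (suc N)) (suc m)
      ≤⟨ ℤ.+-monoʳ-≤ (weight N 0 ℤ.* e (suc m)) (history-weight grows m (ℕ.<⇒≤ m<n) (suc N)) ⟩
    weight N 0 ℤ.* e (suc m) ℤ.+ capacity (+ suc N) ℤ.* e m
      ≤⟨ ≤-by (*-nonneg (+-nonneg (+-nonneg (*-nonneg (0≤+ {3}) (*-nonneg (0≤+ {N}) (0≤+ {N}))) (*-nonneg (0≤+ {12}) (0≤+ {N}))) (0≤+ {18}))
                        (0≤-minus (GrowsUpTo.doubles grows m (ℕ.s≤s (ℕ.s≤s ℕ.z≤n)) m<n)))
           (solve 3 (λ N x y → (con (+ 3) :* (N :* N) :+ con (+ 12) :* N :+ con (+ 18)) :* (y :- con (+ 2) :* x)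
              := (con (+ 6) :* (N :* N) :+ con (+ 12) :* N :+ con (+ 18)) :* y
                 :- (con (+ 3) :* (N :* N) :* y
                    :+ (con (+ 6) :* ((con (+ 1) :+ N) :* (con (+ 1) :+ N)) :+ con (+ 12) :* (con (+ 1) :+ N) :+ con (+ 18)) :* x)) ≡.refl (+ N) (e m) (e (suc m))) ⟩
    capacity (+ N) ℤ.* e (suc m) ∎
    where open ℤ.≤-Reasoning

  iterated-doubling : ∀ {n} → GrowsUpTo n → ∀ m → 2 ℕ.≤ m → ∀ j → j ℕ.+ m ℕ.≤ n → ((+ 2) ℤ.^ j) ℤ.* e m ℤ.≤ e (j ℕ.+ m)
  iterated-doubling grows m 2≤m zero    _   = ℤ.≤-reflexive (ℤ.*-identityˡ (e m))
  iterated-doubling grows m 2≤m (suc j) j+m<n = begin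
    (+ 2 ℤ.* ((+ 2) ℤ.^ j)) ℤ.* e m     ≡⟨ ℤ.*-assoc (+ 2) ((+ 2) ℤ.^ j) (e m) ⟩
    + 2 ℤ.* (((+ 2) ℤ.^ j) ℤ.* e m)     ≤⟨ ℤ.*-monoˡ-≤-nonNeg (+ 2) (iterated-doubling grows m 2≤m j (ℕ.<⇒≤ j+m<n)) ⟩
    + 2 ℤ.* e (j ℕ.+ m)               ≤⟨ GrowsUpTo.doubles grows (j ℕ.+ m) (ℕ.≤-trans 2≤m (ℕ.m≤n+m m j)) j+m<n ⟩
    e (suc j ℕ.+ m)                   ∎
    where open ℤ.≤-Reasoning

  -- Nine doublings and one monotone step from an index of at least 2; the two smaller indices are
  -- evaluated. The constant only has to make `4 * 512` exceed the 1548 of the tail estimate.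
  512e≤ : ∀ m {n} → GrowsUpTo n → 10 ℕ.+ m ℕ.≤ n → + 512 ℤ.* e m ℤ.≤ e (10 ℕ.+ m)
  512e≤ 0 grows _ rewrite e≡c 0 | e≡c 10 = ℤ.+≤+ (ℕ.≤ᵇ⇒≤ 512 5515 _)
  512e≤ 1 grows _ rewrite e≡c 1 | e≡c 11 = ℤ.+≤+ (ℕ.≤ᵇ⇒≤ 1536 13440 _)
  512e≤ m@(suc (suc _)) grows m+10≤n = ℤ.≤-trans (iterated-doubling grows m (ℕ.s≤s (ℕ.s≤s ℕ.z≤n)) 9 (ℕ.<⇒≤ m+10≤n))
    (GrowsUpTo.increasing grows (9 ℕ.+ m) m+10≤n)

  -- Indexed by both summands, which lets them be inferred.
  record NonNegativeSum (K H : ℤ) : Set where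
    constructor nonNegativeSum
    field
      0≤K+H : 0ℤ ℤ.≤ K ℤ.+ H

  -- Such a pair contributes `q * (e (suc k) - e k) + p * e (suc k)`, which is nonnegative because
  -- `e` increases. `K` is a reserve passed along unchanged, to be spent on the tail.
  absorb-pair : ∀ {n} → GrowsUpTo n → ∀ q p k → k ℕ.< n → ∀ {K H} → NonNegativeSum K H →
                NonNegativeSum K (+ (q ℕ.+ p) ℤ.* e (suc k) ℤ.+ (ℤ.- + q ℤ.* e k ℤ.+ H))
  absorb-pair grows q p k k<n {K} {H} (nonNegativeSum 0≤K+H) = nonNegativeSum (≡.subst (0ℤ ℤ.≤_)
    (solve 6 (λ q p K x y H → (K :+ H) :+ (q :* (x :- y) :+ p :* x) := K :+ ((q :+ p) :* x :+ ((:- q) :* y :+ H))) ≡.refl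
      (+ q) (+ p) K (e (suc k)) (e k) H)
    (+-nonneg 0≤K+H (+-nonneg (*-nonneg (0≤+ {q}) (0≤-minus (increasing k k<n))) (*-nonneg (0≤+ {p}) (nonneg (suc k) k<n)))))
    where open GrowsUpTo grows

  history-suc : ∀ f n {a h} → f 0 ≡ a → history (λ i → f (suc i)) n ≡ h → history f (suc n) ≡ a ℤ.* e n ℤ.+ h
  history-suc f n f₀≡a hist≡h = ≡.cong₂ (λ a h → a ℤ.* e n ℤ.+ h) f₀≡a hist≡h

  history-d-expand : ∀ m → history d (12 ℕ.+ m) ≡
    + 0 ℤ.* e (11 ℕ.+ m) ℤ.+ (+ 5 ℤ.* e (10 ℕ.+ m) ℤ.+ (ℤ.- + 1 ℤ.* e (9 ℕ.+ m) ℤ.+ (+ 10 ℤ.* e (8 ℕ.+ m) ℤ.+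
    (ℤ.- + 5 ℤ.* e (7 ℕ.+ m) ℤ.+ (+ 10 ℤ.* e (6 ℕ.+ m) ℤ.+ (ℤ.- + 10 ℤ.* e (5 ℕ.+ m) ℤ.+ (+ 19 ℤ.* e (4 ℕ.+ m) ℤ.+
    (ℤ.- + 2 ℤ.* e (3 ℕ.+ m) ℤ.+ (+ 26 ℤ.* e (2 ℕ.+ m) ℤ.+ (ℤ.- + 18 ℤ.* e (1 ℕ.+ m) ℤ.+
    history (λ i → d (11 ℕ.+ i)) (suc m)))))))))))
  history-d-expand m =
    history-suc d (11 ℕ.+ m) (d≡ 0) (history-suc (λ i → d (1 ℕ.+ i)) (10 ℕ.+ m) (d≡ 1)
    (history-suc (λ i → d (2 ℕ.+ i)) (9 ℕ.+ m) (d≡ 2) (history-suc (λ i → d (3 ℕ.+ i)) (8 ℕ.+ m) (d≡ 3)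
    (history-suc (λ i → d (4 ℕ.+ i)) (7 ℕ.+ m) (d≡ 4) (history-suc (λ i → d (5 ℕ.+ i)) (6 ℕ.+ m) (d≡ 5)
    (history-suc (λ i → d (6 ℕ.+ i)) (5 ℕ.+ m) (d≡ 6) (history-suc (λ i → d (7 ℕ.+ i)) (4 ℕ.+ m) (d≡ 7)
    (history-suc (λ i → d (8 ℕ.+ i)) (3 ℕ.+ m) (d≡ 8) (history-suc (λ i → d (9 ℕ.+ i)) (2 ℕ.+ m) (d≡ 9)
    (history-suc (λ i → d (10 ℕ.+ i)) (1 ℕ.+ m) (d≡ 10) ≡.refl))))))))))

  history-d-nonneg : ∀ m → GrowsUpTo (13 ℕ.+ m) → 0ℤ ℤ.≤ history d (12 ℕ.+ m)
  history-d-nonneg m grows = ≡.subst (0ℤ ℤ.≤_)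
    -- The coefficient 5 of `e (10 + m)` is split as 4 + 1: one unit pays for the following -1, and
    -- four units form the reserve against the tail.
    (≡.trans (solve 3 (λ x y H → con (+ 4) :* x :+ (con (+ 1) :* x :+ H) := con (+ 0) :* y :+ (con (+ 5) :* x :+ H)) ≡.refl
               (e (10 ℕ.+ m)) (e (11 ℕ.+ m)) _) (≡.sym (history-d-expand m)))
    (NonNegativeSum.0≤K+H
      (absorb-pair grows 1 0 (9 ℕ.+ m) (≤ᵐ {10} {13} _)
      (absorb-pair grows 5 5 (7 ℕ.+ m) (≤ᵐ {8} {13} _)
      (absorb-pair grows 10 0 (5 ℕ.+ m) (≤ᵐ {6} {13} _)
      (absorb-pair grows 2 17 (3 ℕ.+ m) (≤ᵐ {4} {13} _)
      (absorb-pair grows 18 8 (1 ℕ.+ m) (≤ᵐ {2} {13} _) remainder))))))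
    where
    open GrowsUpTo grows
    ≤ᵐ : ∀ {i j} → (i≤j : _) → i ℕ.+ m ℕ.≤ j ℕ.+ m
    ≤ᵐ {i} {j} i≤j = ℕ.+-monoˡ-≤ m (ℕ.≤ᵇ⇒≤ i j i≤j)
    -- The first eleven coefficients are gone, so the offset 4 of the quadratic bound becomes 15,
    -- and 1548 is `capacity 15`.
    tail-nonneg : 0ℤ ℤ.≤ history (λ i → d (11 ℕ.+ i)) (suc m) ℤ.+ + 1548 ℤ.* e m
    tail-nonneg = begin
      0ℤ
        ≤⟨ history-nonneg grows (λ i → d (11 ℕ.+ i) ℤ.+ weight 4 (11 ℕ.+ i)) (λ i → d+weight-nonneg (11 ℕ.+ i)) (suc m) (ℕ.m≤n⇒m≤1+n (≤ᵐ {1} {13} _)) ⟩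
      history (λ i → d (11 ℕ.+ i) ℤ.+ weight 4 (11 ℕ.+ i)) (suc m)
        ≡⟨ history-+ (λ i → d (11 ℕ.+ i)) (λ i → weight 4 (11 ℕ.+ i)) (suc m) ⟩
      history (λ i → d (11 ℕ.+ i)) (suc m) ℤ.+ history (λ i → weight 4 (11 ℕ.+ i)) (suc m)
        ≡⟨ ≡.cong (ℤ._+_ (history (λ i → d (11 ℕ.+ i)) (suc m))) (history-cong shift-weight (suc m)) ⟩
      history (λ i → d (11 ℕ.+ i)) (suc m) ℤ.+ history (weight 15) (suc m)
        ≤⟨ ℤ.+-monoʳ-≤ (history (λ i → d (11 ℕ.+ i)) (suc m)) (history-weight grows m (≤ᵐ {0} {13} _) 15) ⟩
      history (λ i → d (11 ℕ.+ i)) (suc m) ℤ.+ + 1548 ℤ.* e m ∎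
      where
      open ℤ.≤-Reasoning
      shift-weight : ∀ i → weight 4 (11 ℕ.+ i) ≡ weight 15 i
      shift-weight i = ≡.cong (λ k → + 3 ℤ.* (+ k ℤ.* + k)) (≡.trans (≡.cong (ℕ._+ 4) (ℕ.+-comm 11 i)) (ℕ.+-assoc i 11 4))
    -- The reserve is at least `4 * 512 = 1548 + 500` times `e m`.
    remainder : NonNegativeSum (+ 4 ℤ.* e (10 ℕ.+ m)) (history (λ i → d (11 ℕ.+ i)) (suc m))
    remainder = nonNegativeSum (≡.subst (0ℤ ℤ.≤_)
      (solve 3 (λ x y H → con (+ 4) :* (x :- con (+ 512) :* y) :+ con (+ 500) :* y :+ (H :+ con (+ 1548) :* y) := con (+ 4) :* x :+ H) ≡.refl
        (e (10 ℕ.+ m)) (e m) (history (λ i → d (11 ℕ.+ i)) (suc m)))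
      (+-nonneg (+-nonneg (*-nonneg (0≤+ {4}) (0≤-minus (512e≤ m grows (≤ᵐ {10} {13} _))))
                          (*-nonneg (0≤+ {500}) (nonneg m (≤ᵐ {0} {13} _))))
                tail-nonneg))

  -- The base is 13 because `e (14 + m)` involves `history d (12 + m)`, the shortest one with eleven
  -- explicit coefficients and a nonempty tail.
  grows-initially : GrowsUpTo 13
  grows-initially = record
    { positive = λ k k≤13 → ≡.subst (+ 1 ℤ.≤_) (≡.sym (e≡c k))
                   (toWitness {a? = ℕ.allUpTo? (λ k → + 1 ℤ.≤? c k) 14} _ (ℕ.s≤s k≤13))
    ; doubles  = λ { (suc (suc k)) (ℕ.s≤s (ℕ.s≤s _)) (ℕ.s≤s (ℕ.s≤s k<11)) →
                   ≡.subst₂ (λ x y → + 2 ℤ.* x ℤ.≤ y) (≡.sym (e≡c (2 ℕ.+ k))) (≡.sym (e≡c (3 ℕ.+ k)))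
                     (toWitness {a? = ℕ.allUpTo? (λ k → + 2 ℤ.* c (2 ℕ.+ k) ℤ.≤? c (3 ℕ.+ k)) 11} _ k<11) }
    }

  grows-next : ∀ m → GrowsUpTo (13 ℕ.+ m) → GrowsUpTo (14 ℕ.+ m)
  grows-next m grows = record
    { positive = λ k k≤ → [ (λ k< → positive k (ℕ.≤-pred k<)) , (λ { ≡.refl → positive-last }) ]′ (ℕ.m≤n⇒m<n∨m≡n k≤)
    ; doubles  = λ k 2≤k k< → [ doubles k 2≤k , (λ { ≡.refl → doubles-last }) ]′ (ℕ.m≤n⇒m<n∨m≡n (ℕ.≤-pred k<))
    }
    where
    open GrowsUpTo grows
    doubles-last : + 2 ℤ.* e (13 ℕ.+ m) ℤ.≤ e (14 ℕ.+ m)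
    doubles-last = ≤-by (history-d-nonneg m grows)
      (≡.trans (solve 2 (λ x h → h := (con (+ 2) :* x :+ h) :- con (+ 2) :* x) ≡.refl (e (13 ℕ.+ m)) (history d (12 ℕ.+ m)))
        (≡.cong (ℤ._- + 2 ℤ.* e (13 ℕ.+ m)) (≡.sym (e-recurrence (11 ℕ.+ m)))))
    positive-last : + 1 ℤ.≤ e (14 ℕ.+ m)
    positive-last = ℤ.≤-trans (positive (13 ℕ.+ m) ℕ.≤-refl)
      (ℤ.≤-trans (≤-by (nonneg (13 ℕ.+ m) ℕ.≤-refl) (solve 1 (λ x → x := con (+ 2) :* x :- x) ≡.refl (e (13 ℕ.+ m)))) doubles-last)

  grows : ∀ m → GrowsUpTo (13 ℕ.+ m)
  grows zero    = grows-initially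
  grows (suc m) = grows-next m (grows m)

  c-positive : ∀ n → 0ℤ ℤ.< c n
  c-positive n = ℤ.<-≤-trans (ℤ.+<+ (ℕ.s≤s ℕ.z≤n)) (≡.subst (+ 1 ℤ.≤_) (e≡c n) (GrowsUpTo.positive (grows n) n (ℕ.m≤n+m n 13)))

-- A ring solver with integer coefficients

module IntegerCoefficientSolver {a ℓ} (R : CommutativeRing a ℓ) where
  open CommutativeRing R
  open RingProperties ring using (-‿distribˡ-*; -‿distribʳ-*; -0#≈0#)
  open AbelianGroupProperties +-abelianGroup using () renaming (⁻¹-∙-comm to -‿+-comm; ⁻¹-involutive to -‿involutive)
  open SemiringMult semiring using (1+×; ×1-homo-*; ×-homo-+) renaming (_×_ to _·_)
  open SetoidReasoning setoid

  -- The solver has to compare coefficients, and these are decidable in `ℤ` but not in the field.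
  -- The optimised multiple makes `⟦ + 1 ⟧` and `⟦ + 2 ⟧` reduce to `1#` and `1# + 1#`, so that
  -- solver expressions match goals by computation.
  ⟦_⟧ : ℤ → Carrier
  ⟦ + n ⟧      = n · 1#
  ⟦ -[1+ n ] ⟧ = - (suc n · 1#)

  neg-homo : ∀ i → ⟦ ℤ.- i ⟧ ≈ - ⟦ i ⟧
  neg-homo (+ zero)  = sym -0#≈0#
  neg-homo (+ suc n) = refl
  neg-homo -[1+ n ]  = sym (-‿involutive _)

  ⊖-homo : ∀ m n → ⟦ m ℤ.⊖ n ⟧ ≈ m · 1# - n · 1#
  ⊖-homo m       zero    = sym (trans (+-congˡ -0#≈0#) (+-identityʳ _))
  ⊖-homo zero    (suc n) = sym (+-identityˡ _)
  ⊖-homo (suc m) (suc n) = begin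
    ⟦ suc m ℤ.⊖ suc n ⟧                   ≡⟨ ≡.cong ⟦_⟧ (ℤ.[1+m]⊖[1+n]≡m⊖n m n) ⟩
    ⟦ m ℤ.⊖ n ⟧                           ≈⟨ ⊖-homo m n ⟩
    m · 1# - n · 1#                       ≈⟨ +-congʳ (+-identityˡ _) ⟨
    0# + m · 1# - n · 1#                  ≈⟨ +-congʳ (+-congʳ (-‿inverseʳ 1#)) ⟨
    1# - 1# + m · 1# - n · 1#             ≈⟨ +-congʳ (+-assoc _ _ _) ⟩
    1# + (- 1# + m · 1#) - n · 1#         ≈⟨ +-congʳ (+-congˡ (+-comm _ _)) ⟩
    1# + (m · 1# - 1#) - n · 1#           ≈⟨ +-congʳ (+-assoc _ _ _) ⟨
    1# + m · 1# - 1# - n · 1#             ≈⟨ +-assoc _ _ _ ⟩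
    1# + m · 1# + (- 1# - n · 1#)         ≈⟨ +-congˡ (-‿+-comm _ _) ⟩
    1# + m · 1# - (1# + n · 1#)           ≈⟨ +-cong (1+× m 1#) (-‿cong (1+× n 1#)) ⟨
    suc m · 1# - suc n · 1#               ∎

  +-homo : ∀ i j → ⟦ i ℤ.+ j ⟧ ≈ ⟦ i ⟧ + ⟦ j ⟧
  +-homo (+ m)    (+ n)    = ×-homo-+ 1# m n
  +-homo (+ m)    -[1+ n ] = ⊖-homo m (suc n)
  +-homo -[1+ m ] (+ n)    = trans (⊖-homo n (suc m)) (+-comm _ _)
  +-homo -[1+ m ] -[1+ n ] = begin
    - (suc (suc (m ℕ.+ n)) · 1#)        ≡⟨ ≡.cong (λ k → - (suc k · 1#)) (ℕ.+-suc m n) ⟨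
    - ((suc m ℕ.+ suc n) · 1#)          ≈⟨ -‿cong (×-homo-+ 1# (suc m) (suc n)) ⟩
    - (suc m · 1# + suc n · 1#)         ≈⟨ -‿+-comm _ _ ⟨
    - (suc m · 1#) - (suc n · 1#)       ∎

  *-homo-pos-neg : ∀ m n → ⟦ + m ℤ.* -[1+ n ] ⟧ ≈ ⟦ + m ⟧ * ⟦ -[1+ n ] ⟧
  *-homo-pos-neg m n = begin
    ⟦ + m ℤ.* -[1+ n ] ⟧        ≡⟨ ≡.cong ⟦_⟧ (ℤ.neg-distribʳ-* (+ m) (+ suc n)) ⟨
    ⟦ ℤ.- (+ m ℤ.* + suc n) ⟧   ≈⟨ neg-homo (+ m ℤ.* + suc n) ⟩
    - ⟦ + m ℤ.* + suc n ⟧       ≡⟨ ≡.cong (λ i → - ⟦ i ⟧) (ℤ.pos-* m (suc n)) ⟨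
    - ((m ℕ.* suc n) · 1#)      ≈⟨ -‿cong (×1-homo-* m (suc n)) ⟩
    - (m · 1# * (suc n · 1#))   ≈⟨ -‿distribʳ-* _ _ ⟩
    ⟦ + m ⟧ * ⟦ -[1+ n ] ⟧      ∎

  *-homo : ∀ i j → ⟦ i ℤ.* j ⟧ ≈ ⟦ i ⟧ * ⟦ j ⟧
  *-homo (+ m) (+ n) = begin
    ⟦ + m ℤ.* + n ⟧       ≡⟨ ≡.cong ⟦_⟧ (ℤ.pos-* m n) ⟨
    (m ℕ.* n) · 1#        ≈⟨ ×1-homo-* m n ⟩
    m · 1# * (n · 1#)     ∎
  *-homo (+ m) -[1+ n ] = *-homo-pos-neg m n
  *-homo -[1+ m ] (+ n) = begin
    ⟦ -[1+ m ] ℤ.* + n ⟧        ≡⟨ ≡.cong ⟦_⟧ (ℤ.*-comm -[1+ m ] (+ n)) ⟩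
    ⟦ + n ℤ.* -[1+ m ] ⟧        ≈⟨ *-homo-pos-neg n m ⟩
    ⟦ + n ⟧ * ⟦ -[1+ m ] ⟧      ≈⟨ *-comm _ _ ⟩
    ⟦ -[1+ m ] ⟧ * ⟦ + n ⟧      ∎
  *-homo -[1+ m ] -[1+ n ] = begin
    (suc m ℕ.* suc n) · 1#             ≈⟨ ×1-homo-* (suc m) (suc n) ⟩
    suc m · 1# * (suc n · 1#)          ≈⟨ -‿involutive _ ⟨
    - - (suc m · 1# * (suc n · 1#))    ≈⟨ -‿cong (-‿distribˡ-* _ _) ⟩
    - (⟦ -[1+ m ] ⟧ * (suc n · 1#))    ≈⟨ -‿distribʳ-* _ _ ⟩
    ⟦ -[1+ m ] ⟧ * ⟦ -[1+ n ] ⟧        ∎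

  morphism : ℤ.+-*-rawRing -Raw-AlmostCommutative⟶ fromCommutativeRing R
  morphism = record
    { ⟦_⟧    = ⟦_⟧
    ; +-homo = +-homo
    ; *-homo = *-homo
    ; -‿homo = neg-homo
    ; 0-homo = refl
    ; 1-homo = refl
    }

  coefficient≟ : ∀ i j → Maybe (⟦ i ⟧ ≈ ⟦ j ⟧)
  coefficient≟ i j with i ℤ.≟ j
  ... | yes i≡j = just (reflexive (≡.cong ⟦_⟧ i≡j))
  ... | no  _   = nothing

  open RingSolver ℤ.+-*-rawRing (fromCommutativeRing R) morphism coefficient≟ public
    using (Polynomial; solve; _:=_; _:+_; _:*_; :-_; _:-_; con)

  :0 :1 :2 : ∀ {n} → Polynomial n
  :0 = con (+ 0)
  :1 = con (+ 1)
  :2 = con (+ 2)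

-- Constructive arithmetic, sums and limits in the ordered field

module OrderedField {a ℓ₁ ℓ₂ ℓ₃} (ℝ : RealField a ℓ₁ ℓ₂ ℓ₃) where
  open RealMatrices ℝ hiding (zero)
  open CommutativeRing commutativeRing using (semiring)
  open RingProperties ring using (x[y-z]≈xy-xz; [y-z]x≈yx-zx)
  open IntegerCoefficientSolver commutativeRing using (solve; _:=_; _:+_; _:*_; :-_; _:-_; :0; :1; :2)
  open IsStrictPartialOrder isStrictPartialOrder public
    using (<-resp-≈; <-respʳ-≈; <-respˡ-≈)
    renaming (trans to <-trans; irrefl to <-irrefl)
  module HCR = HCRProperties heytingCommutativeRing

  private
    variable
      x y z : Carrier


  <-asym : x < y → ¬ (y < x)
  <-asym x<y y<x = <-irrefl refl (<-trans x<y y<x)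

  -- Inherited from cotransitivity of apartness. It is the substitute for trichotomy in the later
  -- case distinctions.
  <-cotrans : x < y → ∀ z → x < z ⊎ z < y
  <-cotrans {x} {y} x<y z with #-cotrans (<⇒# x<y) z
  ... | inj₁ x#z with #⇒<⊎> x#z
  ...   | inj₁ x<z = inj₁ x<z
  ...   | inj₂ z<x = inj₂ (<-trans z<x x<y)
  <-cotrans {x} {y} x<y z | inj₂ z#y with #⇒<⊎> z#y
  ...   | inj₁ z<y = inj₂ z<y
  ...   | inj₂ y<z = inj₁ (<-trans x<y y<z)

  <⇒≤ : x < y → x ≤ y
  <⇒≤ = <-asym

  ≤-reflexive : x ≈ y → x ≤ y
  ≤-reflexive x≈y y<x = <-irrefl (sym x≈y) y<x

  ≤-refl : x ≤ x
  ≤-refl = ≤-reflexive refl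

  ≤-<-trans : x ≤ y → y < z → x < z
  ≤-<-trans {x} x≤y y<z with <-cotrans y<z x
  ... | inj₁ y<x = contradiction y<x x≤y
  ... | inj₂ x<z = x<z

  <-≤-trans : x < y → y ≤ z → x < z
  <-≤-trans {z = z} x<y y≤z with <-cotrans x<y z
  ... | inj₁ x<z = x<z
  ... | inj₂ z<y = contradiction z<y y≤z

  ≤-trans : x ≤ y → y ≤ z → x ≤ z
  ≤-trans x≤y y≤z z<x = y≤z (<-≤-trans z<x x≤y)

  ≤-antisym : x ≤ y → y ≤ x → x ≈ y
  ≤-antisym {x} {y} x≤y y≤x = proj₁ (tight x y) ([ y≤x , x≤y ]′ ∘ #⇒<⊎>)

  ≤-isPreorder : IsPreorder _≈_ _≤_
  ≤-isPreorder = record { isEquivalence = isEquivalence ; reflexive = ≤-reflexive ; trans = ≤-trans }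

  module ≤-Reasoning = TripleReasoning ≤-isPreorder <-asym <-trans <-resp-≈ <⇒≤ <-≤-trans ≤-<-trans

  <⇒0<- : x < y → 0# < y - x
  <⇒0<- {x} x<y = <-respˡ-≈ (-‿inverseʳ x) (+-monoˡ-< (- x) x<y)

  0<-⇒< : 0# < y - x → x < y
  0<-⇒< {y} {x} 0<y-x = <-respʳ-≈ (solve 2 (λ x y → (y :- x) :+ x := y) refl x y)
                          (<-respˡ-≈ (+-identityˡ x) (+-monoˡ-< x 0<y-x))

  <-by : ∀ {e} → 0# < e → e ≈ y - x → x < y
  <-by 0<e e≈y-x = 0<-⇒< (<-respʳ-≈ e≈y-x 0<e)

  ≤-respʳ : y ≈ z → x ≤ y → x ≤ z
  ≤-respʳ y≈z x≤y = ≤-trans x≤y (≤-reflexive y≈z)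

  ≤-respˡ : y ≈ z → y ≤ x → z ≤ x
  ≤-respˡ y≈z y≤x = ≤-trans (≤-reflexive (sym y≈z)) y≤x

  ≤⇒0≤- : x ≤ y → 0# ≤ y - x
  ≤⇒0≤- {x} {y} x≤y y-x<0 = x≤y (<-by (<⇒0<- y-x<0) (solve 2 (λ x y → :0 :- (y :- x) := x :- y) refl x y))

  0≤-⇒≤ : 0# ≤ y - x → x ≤ y
  0≤-⇒≤ {y} {x} 0≤y-x y<x = 0≤y-x (<-by (<⇒0<- y<x) (solve 2 (λ x y → x :- y := :0 :- (y :- x)) refl x y))

  ≤-by : ∀ {e} → 0# ≤ e → e ≈ y - x → x ≤ y
  ≤-by 0≤e e≈y-x = 0≤-⇒≤ (≤-respʳ e≈y-x 0≤e)

  +-pos : 0# < x → 0# < y → 0# < x + y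
  +-pos {x} {y} 0<x 0<y = <-trans 0<y (<-respˡ-≈ (+-identityˡ y) (+-monoˡ-< y 0<x))

  +-pos-nonneg : 0# < x → 0# ≤ y → 0# < x + y
  +-pos-nonneg {x} {y} 0<x 0≤y = ≤-<-trans 0≤y (<-respˡ-≈ (+-identityˡ y) (+-monoˡ-< y 0<x))

  +-nonneg-pos : 0# ≤ x → 0# < y → 0# < x + y
  +-nonneg-pos 0≤x 0<y = <-respʳ-≈ (+-comm _ _) (+-pos-nonneg 0<y 0≤x)

  +-nonneg : 0# ≤ x → 0# ≤ y → 0# ≤ x + y
  +-nonneg {x} {y} 0≤x 0≤y x+y<0 = 0≤x (≤-<-trans (≤-by 0≤y (solve 2 (λ x y → y := (x :+ y) :- x) refl x y)) x+y<0)

  +-mono-≤ : ∀ {u v} → x ≤ y → u ≤ v → x + u ≤ y + v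
  +-mono-≤ {x} {y} {u} {v} x≤y u≤v = ≤-by (+-nonneg (≤⇒0≤- x≤y) (≤⇒0≤- u≤v))
    (solve 4 (λ x y u v → (y :- x) :+ (v :- u) := (y :+ v) :- (x :+ u)) refl x y u v)

  +-mono-< : ∀ {u v} → x < y → u < v → x + u < y + v
  +-mono-< {x} {y} {u} {v} x<y u<v = <-by (+-pos (<⇒0<- x<y) (<⇒0<- u<v))
    (solve 4 (λ x y u v → (y :- x) :+ (v :- u) := (y :+ v) :- (x :+ u)) refl x y u v)

  *-invertible⇒# : ∀ {u} → x * y * u ≈ 1# → x # 0#
  *-invertible⇒# {x} {y} {u} xyu≈1 = HCR.invertibleʳ⇒# (y * u , trans (*-congʳ (HCR.x-0≈x x)) (trans (sym (*-assoc x y u)) xyu≈1))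

  -- Apart from zero means invertible, and a factor of an invertible product is invertible.
  *-#⇒# : x * y # 0# → x # 0#
  *-#⇒# xy#0 = *-invertible⇒# (trans (*-congʳ (sym (HCR.x-0≈x _))) (proj₂ (proj₂ (#⇒invertible xy#0))))

  #∧0≤⇒0< : x # 0# → 0# ≤ x → 0# < x
  #∧0≤⇒0< x#0 0≤x with #⇒<⊎> x#0
  ... | inj₁ x<0 = contradiction x<0 0≤x
  ... | inj₂ 0<x = 0<x

  neg-pos : x < 0# → 0# < - x
  neg-pos {x} x<0 = <-respʳ-≈ (+-identityˡ _) (<⇒0<- x<0)

  #0⇒0<² : x # 0# → 0# < x * x
  #0⇒0<² {x} x#0 with #⇒<⊎> x#0
  ... | inj₁ x<0 = <-respʳ-≈ (solve 1 (λ x → (:- x) :* (:- x) := x :* x) refl x) (*-pos (neg-pos x<0) (neg-pos x<0))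
  ... | inj₂ 0<x = *-pos 0<x 0<x

  -- A negative square is apart from 0, hence so is its root, but then the square is positive.
  0≤² : ∀ x → 0# ≤ x * x
  0≤² x x²<0 = <-asym x²<0 (#0⇒0<² (*-#⇒# (<⇒# x²<0)))

  0<1 : 0# < 1#
  0<1 = <-respʳ-≈ (*-identityˡ 1#) (#0⇒0<² HCR.1#0)

  0≤1 : 0# ≤ 1#
  0≤1 = <⇒≤ 0<1

  *-cancelˡ-pos : 0# < x * y → 0# ≤ x → 0# < y
  *-cancelˡ-pos {x} {y} 0<xy 0≤x = conclude (#⇒<⊎> (*-#⇒# (#-sym (<⇒# (<-respʳ-≈ (*-comm x y) 0<xy)))))
    where
    conclude : y < 0# ⊎ 0# < y → 0# < y
    conclude (inj₂ 0<y) = 0<y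
    conclude (inj₁ y<0) = contradiction
      (<-by (*-pos (#∧0≤⇒0< (*-#⇒# (#-sym (<⇒# 0<xy))) 0≤x) (neg-pos y<0))
            (solve 2 (λ x y → x :* (:- y) := :0 :- x :* y) refl x y))
      (<-asym 0<xy)

  *-cancelʳ-pos : 0# < x * y → 0# ≤ y → 0# < x
  *-cancelʳ-pos 0<xy = *-cancelˡ-pos (<-respʳ-≈ (*-comm _ _) 0<xy)

  *-nonneg : 0# ≤ x → 0# ≤ y → 0# ≤ x * y
  *-nonneg {x} {y} 0≤x 0≤y xy<0 = <-asym xy<0 (*-pos
    (#∧0≤⇒0< (*-#⇒# (<⇒# xy<0)) 0≤x)
    (#∧0≤⇒0< (*-#⇒# (<⇒# (<-respˡ-≈ (*-comm x y) xy<0))) 0≤y))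

  *-monoʳ-≤ : 0# ≤ z → x ≤ y → z * x ≤ z * y
  *-monoʳ-≤ {z} {x} {y} 0≤z x≤y = ≤-by (*-nonneg 0≤z (≤⇒0≤- x≤y)) (x[y-z]≈xy-xz z y x)

  *-monoˡ-≤ : 0# ≤ z → x ≤ y → x * z ≤ y * z
  *-monoˡ-≤ {z} {x} {y} 0≤z x≤y = ≤-by (*-nonneg (≤⇒0≤- x≤y) 0≤z) ([y-z]x≈yx-zx z y x)

  *-mono-≤ : ∀ {u v} → 0# ≤ x → 0# ≤ v → x ≤ y → u ≤ v → x * u ≤ y * v
  *-mono-≤ 0≤x 0≤v x≤y u≤v = ≤-trans (*-monoʳ-≤ 0≤x u≤v) (*-monoˡ-≤ 0≤v x≤y)

  *-monoʳ-< : 0# < z → x < y → z * x < z * y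
  *-monoʳ-< {z} {x} {y} 0<z x<y = <-by (*-pos 0<z (<⇒0<- x<y)) (x[y-z]≈xy-xz z y x)

  *-cancelˡ-≤ : 0# < z → z * x ≤ z * y → x ≤ y
  *-cancelˡ-≤ 0<z zx≤zy y<x = zx≤zy (*-monoʳ-< 0<z y<x)

  *-cancelˡ-≈ : 0# < z → z * x ≈ z * y → x ≈ y
  *-cancelˡ-≈ 0<z eq = ≤-antisym (*-cancelˡ-≤ 0<z (≤-reflexive eq)) (*-cancelˡ-≤ 0<z (≤-reflexive (sym eq)))

  recip-pos : ∀ {x} (0<x : 0# < x) → 0# < recip x 0<x
  recip-pos {x} 0<x = *-cancelˡ-pos (<-respʳ-≈ (sym (recip-inverseʳ x 0<x)) 0<1) (<⇒≤ 0<x)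

  two : Carrier
  two = 1# + 1#

  0<2 : 0# < two
  0<2 = +-pos 0<1 0<1

  half : Carrier → Carrier
  half x = x * recip two 0<2

  half-pos : 0# < x → 0# < half x
  half-pos 0<x = *-pos 0<x (recip-pos 0<2)

  half+half : ∀ x → half x + half x ≈ x
  half+half x = begin
    half x + half x                 ≈⟨ solve 2 (λ x r → x :* r :+ x :* r := x :* (:2 :* r)) refl x (recip two 0<2) ⟩
    x * (two * recip two 0<2)       ≈⟨ *-congˡ (recip-inverseʳ two 0<2) ⟩
    x * 1#                          ≈⟨ *-identityʳ x ⟩
    x                               ∎
    where open SetoidReasoning setoid

  +-pos-split : 0# < x + y → 0# < x ⊎ 0# < y
  +-pos-split {x} {y} 0<x+y with <-cotrans 0<x+y x
  ... | inj₁ 0<x   = inj₁ 0<x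
  ... | inj₂ x<x+y = inj₂ (<-respʳ-≈ (solve 2 (λ x y → (x :+ y) :- x := y) refl x y) (<⇒0<- x<x+y))

  -- The witness `x * y / (x + y)` plays the part of the minimum: `x` exceeds it by `x² / (x + y)`,
  -- and likewise for `y`.
  positiveLowerBound₂ : 0# < x → 0# < y → ∃ λ z → 0# < z × z ≤ x × z ≤ y
  positiveLowerBound₂ {x} {y} 0<x 0<y =
    x * y * r , *-pos (*-pos 0<x 0<y) 0<r , bound x y refl refl (<⇒≤ 0<x) , bound y x (+-comm y x) (*-comm x y) (<⇒≤ 0<y)
    where
    0<x+y = +-pos 0<x 0<y
    r   = recip (x + y) 0<x+y
    0<r = recip-pos 0<x+y
    bound : ∀ u v → u + v ≈ x + y → x * y ≈ u * v → 0# ≤ u → x * y * r ≤ u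
    bound u v u+v≈x+y xy≈uv 0≤u = ≤-by {e = u * u * r} (*-nonneg (0≤² u) (<⇒≤ 0<r)) (begin
      u * u * r               ≈⟨ solve 3 (λ u v r → u :* u :* r := u :* ((u :+ v) :* r) :- u :* v :* r) refl u v r ⟩
      u * ((u + v) * r) - u * v * r    ≈⟨ +-cong (*-congˡ (trans (*-congʳ u+v≈x+y) (recip-inverseʳ _ 0<x+y))) (-‿cong (*-congʳ (sym xy≈uv))) ⟩
      u * 1# - x * y * r        ≈⟨ +-congʳ (*-identityʳ u) ⟩
      u - x * y * r             ∎)
      where
      open SetoidReasoning setoid


  positiveLowerBound : ∀ {n} (f : Vector Carrier n) → (∀ i → 0# < f i) → ∃ λ z → 0# < z × (∀ i → z ≤ f i)
  positiveLowerBound {zero}  f 0<f = 1# , 0<1 , λ ()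
  positiveLowerBound {suc n} f 0<f =
    let z′ , 0<z′ , z′≤f = positiveLowerBound (f ∘ suc) (0<f ∘ suc)
        z , 0<z , z≤f₀ , z≤z′ = positiveLowerBound₂ (0<f zero) 0<z′
    in z , 0<z , λ { zero → z≤f₀ ; (suc i) → ≤-trans z≤z′ (z′≤f i) }

  positiveLowerBound² : ∀ {m n} (f : Fin m → Vector Carrier n) → (∀ i j → 0# < f i j) → ∃ λ z → 0# < z × (∀ i j → z ≤ f i j)
  positiveLowerBound² {zero}  f 0<f = 1# , 0<1 , λ ()
  positiveLowerBound² {suc m} f 0<f =
    let z₀ , 0<z₀ , z₀≤f = positiveLowerBound (f zero) (0<f zero)
        z′ , 0<z′ , z′≤f = positiveLowerBound² (f ∘ suc) (0<f ∘ suc)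
        z , 0<z , z≤z₀ , z≤z′ = positiveLowerBound₂ 0<z₀ 0<z′
    in z , 0<z , λ { zero j → ≤-trans z≤z₀ (z₀≤f j) ; (suc i) j → ≤-trans z≤z′ (z′≤f i j) }

  smallMultiplier : ∀ {c d} → 0# ≤ c → 0# < d → ∃ λ ε → 0# < ε × ε * c < d
  smallMultiplier {c} {d} 0≤c 0<d = d * r , 0<dr , <-by {e = d * r} 0<dr (begin
    d * r                   ≈⟨ solve 3 (λ c d r → d :* r := d :* ((c :+ :1) :* r) :- d :* r :* c) refl c d r ⟩
    d * ((c + 1#) * r) - d * r * c   ≈⟨ +-congʳ (trans (*-congˡ (recip-inverseʳ _ 0<c+1)) (*-identityʳ d)) ⟩
    d - d * r * c           ∎)
    where
    open SetoidReasoning setoid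
    0<c+1 = +-nonneg-pos 0≤c 0<1
    r     = recip (c + 1#) 0<c+1
    0<dr  = *-pos 0<d (recip-pos 0<c+1)

  ≤-limit : ∀ {c} → 0# ≤ c → (∀ ε → 0# < ε → x ≤ y + ε * c) → x ≤ y
  ≤-limit {x} {y} {c} 0≤c bound y<x =
    let ε , 0<ε , εc<x-y = smallMultiplier 0≤c (<⇒0<- y<x)
    in bound ε 0<ε (<-by (<⇒0<- εc<x-y) (solve 3 (λ x y e → (x :- y) :- e := x :- (y :+ e)) refl x y (ε * c)))

  -- Finite sums

  open SemiringSum semiring public using (∑-distrib-+; ∑-comm; sum-cong-≋; sum-replicate-zero)

  *-distribˡ-sum : ∀ {n} x (f : Vector Carrier n) → x * sum f ≈ sum (λ i → x * f i)
  *-distribˡ-sum = SemiringSum.*-distribˡ-sum semiring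

  *-distribʳ-sum : ∀ {n} x (f : Vector Carrier n) → sum f * x ≈ sum (λ i → f i * x)
  *-distribʳ-sum = SemiringSum.*-distribʳ-sum semiring

  sum-nonneg : ∀ {n} (f : Vector Carrier n) → (∀ i → 0# ≤ f i) → 0# ≤ sum f
  sum-nonneg {zero}  f 0≤f = ≤-refl
  sum-nonneg {suc n} f 0≤f = +-nonneg (0≤f zero) (sum-nonneg (f ∘ suc) (0≤f ∘ suc))

  sum-mono-≤ : ∀ {n} {f g : Vector Carrier n} → (∀ i → f i ≤ g i) → sum f ≤ sum g
  sum-mono-≤ {zero}  f≤g = ≤-refl
  sum-mono-≤ {suc n} f≤g = +-mono-≤ (f≤g zero) (sum-mono-≤ (f≤g ∘ suc))

  term≤sum : ∀ {n} (f : Vector Carrier n) → (∀ i → 0# ≤ f i) → ∀ i → f i ≤ sum f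
  term≤sum f 0≤f zero    = ≤-respˡ (+-identityʳ _) (+-mono-≤ ≤-refl (sum-nonneg (f ∘ suc) (0≤f ∘ suc)))
  term≤sum f 0≤f (suc i) = ≤-respˡ (+-identityˡ _) (+-mono-≤ (0≤f zero) (term≤sum (f ∘ suc) (0≤f ∘ suc) i))

  sum-pos : ∀ {n} (f : Vector Carrier n) → (∀ i → 0# ≤ f i) → ∀ i → 0# < f i → 0# < sum f
  sum-pos f 0≤f i 0<fi = <-≤-trans 0<fi (term≤sum f 0≤f i)

  sum-pos⇒∃ : ∀ {n} (f : Vector Carrier n) → 0# < sum f → ∃ λ i → 0# < f i
  sum-pos⇒∃ {zero}  f 0<0 = contradiction 0<0 ≤-refl
  sum-pos⇒∃ {suc n} f 0<∑ with +-pos-split 0<∑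
  ... | inj₁ 0<f₀ = zero , 0<f₀
  ... | inj₂ 0<∑′ = let i , 0<fi = sum-pos⇒∃ (f ∘ suc) 0<∑′ in suc i , 0<fi

  -- Limits

  _^_ : Carrier → ℕ → Carrier
  _^_ = S._^_

  ^-nonneg : 0# ≤ x → ∀ n → 0# ≤ x ^ n
  ^-nonneg 0≤x zero    = 0≤1
  ^-nonneg 0≤x (suc n) = *-nonneg 0≤x (^-nonneg 0≤x n)

  ×1-nonneg : ∀ n → 0# ≤ n S.× 1#
  ×1-nonneg zero    = ≤-refl
  ×1-nonneg (suc n) = +-nonneg 0≤1 (×1-nonneg n)

  -- Bernoulli's inequality (1 - δ)⁻ⁿ ≥ 1 + nδ, without the inverse.
  bernoulli : ∀ {δ} → 0# ≤ δ → δ ≤ 1# → ∀ n → (1# - δ) ^ n * (1# + (n S.× 1#) * δ) ≤ 1#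
  bernoulli {δ} 0≤δ δ≤1 zero = ≤-reflexive (solve 1 (λ d → :1 :* (:1 :+ :0 :* d) := :1) refl δ)
  bernoulli {δ} 0≤δ δ≤1 (suc n) = ≤-trans
    (≤-by {e = p * (δ * δ * (1# + N))}
      (*-nonneg (^-nonneg (≤⇒0≤- δ≤1) n) (*-nonneg (0≤² δ) (+-nonneg 0≤1 (×1-nonneg n))))
      (solve 3 (λ p d N → p :* (d :* d :* (:1 :+ N))
                        := p :* (:1 :+ N :* d) :- ((:1 :- d) :* p) :* (:1 :+ (:1 :+ N) :* d)) refl p δ N))
    (bernoulli 0≤δ δ≤1 n)
    where
    p = (1# - δ) ^ n
    N = n S.× 1#

  *-cancelˡ-< : 0# ≤ z → z * x < z * y → x < y
  *-cancelˡ-< {z} {x} {y} 0≤z zx<zy = 0<-⇒< (*-cancelˡ-pos (<-respʳ-≈ (sym (x[y-z]≈xy-xz z y x)) (<⇒0<- zx<zy)) 0≤z)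

  -- With `n` above `C / (δ ε)`, Bernoulli bounds the power by `1 / (1 + n δ)`. Everything is
  -- multiplied by `D` instead of dividing by it.
  geometric-small : ∀ {δ} → 0# < δ → δ ≤ 1# → ∀ {C ε} → 0# ≤ C → 0# < ε → ∃ λ n → (1# - δ) ^ n * C < ε
  geometric-small {δ} 0<δ δ≤1 {C} {ε} 0≤C 0<ε = n , *-cancelˡ-< 0≤D (begin-strict
      D * (p * C)        ≈⟨ solve 3 (λ D p C → D :* (p :* C) := p :* D :* C) refl D p C ⟩
      p * D * C          ≤⟨ *-monoˡ-≤ 0≤C (bernoulli (<⇒≤ 0<δ) δ≤1 n) ⟩
      1# * C             ≈⟨ solve 2 (λ C e → :1 :* C := C :* :1) refl C ε ⟩
      C * 1#             ≈⟨ *-congˡ (recip-inverseʳ (δ * ε) 0<δε) ⟨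
      C * (δ * ε * r)    ≈⟨ solve 3 (λ C e r → C :* (e :* r) := e :* (C :* r)) refl C (δ * ε) r ⟩
      δ * ε * (C * r)    <⟨ *-monoʳ-< 0<δε (proj₂ (archimedean (C * r))) ⟩
      δ * ε * N          <⟨ <-by {e = ε} 0<ε (solve 3 (λ d e N → e := (:1 :+ N :* d) :* e :- d :* e :* N) refl δ ε N) ⟩
      D * ε              ∎)
    where
    open ≤-Reasoning
    0<δε = *-pos 0<δ 0<ε
    r = recip (δ * ε) 0<δε
    n = proj₁ (archimedean (C * r))
    N = n S.× 1#
    p = (1# - δ) ^ n
    D = 1# + N * δ
    0≤D : 0# ≤ D
    0≤D = +-nonneg 0≤1 (*-nonneg (×1-nonneg n) (<⇒≤ 0<δ))

  nestedIntervals : (l u : ℕ → Carrier) → (∀ n → l n ≤ l (suc n)) → (∀ n → u (suc n) ≤ u n) → (∀ n → l n ≤ u n) →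
                    (∀ ε → 0# < ε → ∃ λ n → u n - l n < ε) →
                    ∃ λ t → ∀ n → l n ≤ t × t ≤ u n
  nestedIntervals l u l↑ u↓ l≤u shrink = t , λ n → l≤t n , t≤u n
    where
    l-mono : ∀ {m n} → m ℕ.≤ n → l m ≤ l n
    l-mono = go ∘ ℕ.≤⇒≤′
      where
      go : ∀ {m n} → m ℕ.≤′ n → l m ≤ l n
      go (ℕ.≤′-reflexive ≡.refl) = ≤-refl
      go (ℕ.≤′-step m≤n)         = ≤-trans (go m≤n) (l↑ _)
    u-anti : ∀ {m n} → m ℕ.≤ n → u n ≤ u m
    u-anti = go ∘ ℕ.≤⇒≤′
      where
      go : ∀ {m n} → m ℕ.≤′ n → u n ≤ u m
      go (ℕ.≤′-reflexive ≡.refl) = ≤-refl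
      go (ℕ.≤′-step m≤n)         = ≤-trans (u↓ _) (go m≤n)
    l≤u′ : ∀ m n → l m ≤ u n
    l≤u′ m n = ≤-trans (l-mono (ℕ.m≤m⊔n m n)) (≤-trans (l≤u (m ℕ.⊔ n)) (u-anti (ℕ.m≤n⊔m m n)))
    gap : ∀ N {m n} → N ℕ.≤ n → l m - l n ≤ u N - l N
    gap N {m} {n} N≤n = ≤-by (+-nonneg (≤⇒0≤- (l≤u′ m N)) (≤⇒0≤- (l-mono N≤n)))
      (solve 4 (λ u m n N → (u :- m) :+ (n :- N) := (u :- N) :- (m :- n)) refl (u N) (l m) (l n) (l N))
    cauchy : Cauchy l
    cauchy ε 0<ε = let N , w = shrink ε 0<ε in
      N , λ m n N≤m N≤n → ≤-<-trans (gap N N≤n) w , ≤-<-trans (gap N N≤m) w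
    t = proj₁ (complete l cauchy)
    l⟶t = proj₂ (complete l cauchy)
    l≤t : ∀ n → l n ≤ t
    l≤t n t<ln = let N , close = l⟶t (l n - t) (<⇒0<- t<ln) in contradiction
      (<-by (<⇒0<- (proj₁ (close (N ℕ.⊔ n) (ℕ.m≤m⊔n N n))))
        (solve 3 (λ n t m → (n :- t) :- (m :- t) := n :- m) refl (l n) t (l (N ℕ.⊔ n))))
      (l-mono (ℕ.m≤n⊔m N n))
    t≤u : ∀ n → t ≤ u n
    t≤u n un<t = let N , close = l⟶t (t - u n) (<⇒0<- un<t) in contradiction
      (<-by (<⇒0<- (proj₂ (close N ℕ.≤-refl)))
        (solve 3 (λ u t l → (t :- u) :- (t :- l) := l :- u) refl (u n) t (l N)))
      (l≤u′ N n)

  -- The states carry whatever invariant relates the interval to its limit.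
  geometricShrinking : ∀ {s} {State : Set s} (l u : State → Carrier) (step : State → State) → State →
    ∀ {δ} → 0# < δ → δ ≤ 1# →
    (∀ s → l s ≤ u s) → (∀ s → l s ≤ l (step s)) → (∀ s → u (step s) ≤ u s) →
    (∀ s → u (step s) - l (step s) ≈ (1# - δ) * (u s - l s)) →
    ∃ λ t → ∀ ε → 0# < ε → ∃ λ s → l s ≤ t × t ≤ u s × u s - l s < ε
  geometricShrinking {State = State} l u step s₀ {δ} 0<δ δ≤1 l≤u l↑ u↓ contract =
    let t , bounds = nestedIntervals (l ∘ state) (u ∘ state) (l↑ ∘ state) (u↓ ∘ state) (l≤u ∘ state) shrink
    in t , λ ε 0<ε → let n , w<ε = shrink ε 0<ε in
         state n , proj₁ (bounds n) , proj₂ (bounds n) , w<ε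
    where
    state : ℕ → State
    state zero    = s₀
    state (suc n) = step (state n)
    width : ∀ n → u (state n) - l (state n) ≈ (1# - δ) ^ n * (u s₀ - l s₀)
    width zero    = sym (*-identityˡ _)
    width (suc n) = trans (contract (state n)) (trans (*-congˡ (width n)) (sym (*-assoc _ _ _)))
    shrink : ∀ ε → 0# < ε → ∃ λ n → u (state n) - l (state n) < ε
    shrink ε 0<ε = let n , w<ε = geometric-small 0<δ δ≤1 (≤⇒0≤- (l≤u s₀)) 0<ε in
      n , <-respˡ-≈ (sym (width n)) w<ε

  -- The fixed bound `U` makes squaring Lipschitz on all brackets: `u² - l²` is at most
  -- `2 U (u - l)`, so the squares of the ends converge together.
  record SqrtBracket (s U : Carrier) : Set (a ⊔ ℓ₃) where
    field
      l u  : Carrier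
      0≤l  : 0# ≤ l
      l<u  : l < u
      u≤U  : u ≤ U
      l²≤s : l * l ≤ s
      s≤u² : s ≤ u * u

  -- Bisection would have to decide on which side of `s` the square of the midpoint lies. Instead
  -- two points `p < q` are taken a quarter of the width inside each end. Cotransitivity applied to
  -- `p² < q²` yields `p² < s` or `s < q²`, and either way a quarter of the bracket is discarded.
  sqrt : ∀ s → 0# ≤ s → ∃ λ r → 0# ≤ r × r * r ≈ s
  sqrt s 0≤s = r , 0≤r , ≤-antisym (≤-limit 0≤2U r²≤) (≤-limit 0≤2U s≤)
    where
    open SqrtBracket
    U = s + 1#
    0≤U = +-nonneg 0≤s 0≤1
    0≤2U = +-nonneg 0≤U 0≤U
    δ = half (half 1#)
    0<δ : 0# < δ
    0<δ = half-pos (half-pos 0<1)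
    1-2δ>0 : 0# < 1# - (δ + δ)
    1-2δ>0 = <-respʳ-≈ (begin
      half 1#                         ≈⟨ solve 1 (λ h → h := (h :+ h) :- h) refl (half 1#) ⟩
      half 1# + half 1# - half 1#     ≈⟨ +-cong (half+half 1#) (-‿cong (sym (half+half (half 1#)))) ⟩
      1# - (δ + δ)                    ∎) (half-pos 0<1)
      where open SetoidReasoning setoid
    1-δ>0 : 0# < 1# - δ
    1-δ>0 = <-respʳ-≈ (solve 1 (λ d → (:1 :- (d :+ d)) :+ d := :1 :- d) refl δ) (+-pos 1-2δ>0 0<δ)
    start : SqrtBracket s U
    start = record
      { l = 0# ; u = U ; 0≤l = ≤-refl ; l<u = +-nonneg-pos 0≤s 0<1 ; u≤U = ≤-refl
      ; l²≤s = ≤-respˡ (sym (zeroˡ 0#)) 0≤s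
      ; s≤u² = ≤-by {e = s * s + s + 1#} (+-nonneg (+-nonneg (0≤² s) 0≤s) 0≤1)
                 (solve 1 (λ s → s :* s :+ s :+ :1 := (s :+ :1) :* (s :+ :1) :- s) refl s)
      }
    module _ (b : SqrtBracket s U) where
      w = u b - l b
      0<w = <⇒0<- (l<u b)
      p = l b + δ * w
      q = u b - δ * w
      0≤δw = <⇒≤ (*-pos 0<δ 0<w)
      l≤p : l b ≤ p
      l≤p = ≤-by 0≤δw (solve 2 (λ l e → e := (l :+ e) :- l) refl (l b) (δ * w))
      q≤u : q ≤ u b
      q≤u = ≤-by 0≤δw (solve 2 (λ l e → e := l :- (l :- e)) refl (u b) (δ * w))
      upperPart : u b - p ≈ (1# - δ) * w
      upperPart = solve 3 (λ l u d → u :- (l :+ d :* (u :- l)) := (:1 :- d) :* (u :- l)) refl (l b) (u b) δ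
      lowerPart : q - l b ≈ (1# - δ) * w
      lowerPart = solve 3 (λ l u d → (u :- d :* (u :- l)) :- l := (:1 :- d) :* (u :- l)) refl (l b) (u b) δ
      0≤p = ≤-trans (0≤l b) l≤p
      p<q : p < q
      p<q = <-by (*-pos 1-2δ>0 0<w)
        (solve 3 (λ l u d → (:1 :- (d :+ d)) :* (u :- l) := (u :- d :* (u :- l)) :- (l :+ d :* (u :- l))) refl (l b) (u b) δ)
      p²<q² : p * p < q * q
      p²<q² = <-by (*-pos (<⇒0<- p<q) (+-pos-nonneg (≤-<-trans 0≤p p<q) 0≤p))
        (solve 2 (λ p q → (q :- p) :* (q :+ p) := q :* q :- p :* p) refl p q)
      choose : p * p < s ⊎ s < q * q → ∃ λ b′ → l b ≤ l b′ × u b′ ≤ u b × (u b′ - l b′ ≈ (1# - δ) * w)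
      choose (inj₁ p²<s) = record
              { l = p ; u = u b ; 0≤l = 0≤p ; u≤U = u≤U b ; l²≤s = <⇒≤ p²<s ; s≤u² = s≤u² b
              ; l<u = <-by (*-pos 1-δ>0 0<w) (sym upperPart) }
            , l≤p , ≤-refl , upperPart
      choose (inj₂ s<q²) = record
              { l = l b ; u = q ; 0≤l = 0≤l b ; u≤U = ≤-trans q≤u (u≤U b) ; l²≤s = l²≤s b ; s≤u² = <⇒≤ s<q²
              ; l<u = <-by (*-pos 1-δ>0 0<w) (sym lowerPart) }
            , ≤-refl , q≤u , lowerPart
    narrow = λ b → choose b (<-cotrans (p²<q² b) s)
    limit = geometricShrinking l u (proj₁ ∘ narrow) start 0<δ (<⇒≤ (0<-⇒< 1-δ>0)) (<⇒≤ ∘ l<u)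
              (proj₁ ∘ proj₂ ∘ narrow) (proj₁ ∘ proj₂ ∘ proj₂ ∘ narrow) (proj₂ ∘ proj₂ ∘ proj₂ ∘ narrow)
    r = proj₁ limit
    0≤r : 0# ≤ r
    0≤r = let b , l≤r , _ = proj₂ limit 1# 0<1 in ≤-trans (0≤l b) l≤r
    u²≤l²+ : ∀ {ε} (b : SqrtBracket s U) → u b - l b < ε → u b * u b ≤ l b * l b + ε * (U + U)
    u²≤l²+ {ε} b w<ε = ≤-by
      (+-nonneg
        (*-nonneg (≤⇒0≤- (<⇒≤ w<ε)) 0≤2U)
        (*-nonneg (≤⇒0≤- (<⇒≤ (l<u b))) (+-nonneg (≤⇒0≤- (u≤U b)) (≤⇒0≤- (≤-trans (<⇒≤ (l<u b)) (u≤U b))))))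
      (solve 4 (λ l u U e → (e :- (u :- l)) :* (U :+ U) :+ (u :- l) :* ((U :- u) :+ (U :- l))
                           := (l :* l :+ e :* (U :+ U)) :- u :* u) refl (l b) (u b) U ε)
    r²≤ : ∀ ε → 0# < ε → r * r ≤ s + ε * (U + U)
    r²≤ ε 0<ε = let b , l≤r , r≤u , w<ε = proj₂ limit ε 0<ε in
      ≤-trans (*-mono-≤ 0≤r (≤-trans 0≤r r≤u) r≤u r≤u)
        (≤-trans (u²≤l²+ b w<ε) (+-mono-≤ (l²≤s b) ≤-refl))
    s≤ : ∀ ε → 0# < ε → s ≤ r * r + ε * (U + U)
    s≤ ε 0<ε = let b , l≤r , r≤u , w<ε = proj₂ limit ε 0<ε in
      ≤-trans (s≤u² b) (≤-trans (u²≤l²+ b w<ε) (+-mono-≤ (*-mono-≤ (0≤l b) 0≤r l≤r l≤r) ≤-refl))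

  ⟶-cong : ∀ {f g : ℕ → Carrier} {l l′} → (∀ n → f n ≈ g n) → l ≈ l′ → f ⟶ l → g ⟶ l′
  ⟶-cong f≈g l≈l′ f⟶l ε 0<ε = let N , close = f⟶l ε 0<ε in N , λ n N≤n →
    <-respˡ-≈ (+-cong (f≈g n) (-‿cong l≈l′)) (proj₁ (close n N≤n)) ,
    <-respˡ-≈ (+-cong l≈l′ (-‿cong (f≈g n))) (proj₂ (close n N≤n))

  ⟶-const : ∀ x → (λ _ → x) ⟶ x
  ⟶-const x ε 0<ε = 0 , λ _ _ → within , within
    where within = <-respˡ-≈ (sym (-‿inverseʳ x)) 0<ε

  ⟶-unique : ∀ {f : ℕ → Carrier} {l l′} → f ⟶ l → f ⟶ l′ → l ≈ l′
  ⟶-unique {f} f⟶l f⟶l′ = ≤-antisym (bound f⟶l f⟶l′) (bound f⟶l′ f⟶l)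
    where
    bound : ∀ {l l′} → f ⟶ l → f ⟶ l′ → l ≤ l′
    bound {l} {l′} f⟶l f⟶l′ = ≤-limit (<⇒≤ 0<2) λ ε 0<ε →
      let N , close = f⟶l ε 0<ε ; N′ , close′ = f⟶l′ ε 0<ε
          m = N ℕ.⊔ N′
      in ≤-by (<⇒≤ (+-pos (<⇒0<- (proj₂ (close m (ℕ.m≤m⊔n N N′)))) (<⇒0<- (proj₁ (close′ m (ℕ.m≤n⊔m N N′))))))
           (solve 4 (λ l l′ f e → (e :- (l :- f)) :+ (e :- (f :- l′)) := (l′ :+ e :* :2) :- l) refl l l′ (f m) ε)

  ⟶-+ : ∀ {f g : ℕ → Carrier} {l l′} → f ⟶ l → g ⟶ l′ → (λ n → f n + g n) ⟶ (l + l′)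
  ⟶-+ {f} {g} {l} {l′} f⟶l g⟶l′ ε 0<ε =
    let N , close = f⟶l (half ε) (half-pos 0<ε) ; N′ , close′ = g⟶l′ (half ε) (half-pos 0<ε)
    in N ℕ.⊔ N′ , λ m m≥ →
       let f≈l = close m (ℕ.≤-trans (ℕ.m≤m⊔n N N′) m≥) ; g≈l′ = close′ m (ℕ.≤-trans (ℕ.m≤n⊔m N N′) m≥)
       in <-respˡ-≈ (regroup (f m) l (g m) l′) (<-respʳ-≈ (half+half ε) (+-mono-< (proj₁ f≈l) (proj₁ g≈l′))) ,
          <-respˡ-≈ (regroup l (f m) l′ (g m)) (<-respʳ-≈ (half+half ε) (+-mono-< (proj₂ f≈l) (proj₂ g≈l′)))
    where
    regroup : ∀ a b c d → (a - b) + (c - d) ≈ (a + c) - (b + d)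
    regroup = solve 4 (λ a b c d → (a :- b) :+ (c :- d) := (a :+ c) :- (b :+ d)) refl

  -- (e - d)(k + c) + (e + d)(k - c) = 2(ek - dc)
  *-bound : ∀ {d e c k} → d ≤ e → - d ≤ e → c ≤ k → - c ≤ k → d * c ≤ e * k
  *-bound {d} {e} {c} {k} d≤e -d≤e c≤k -c≤k = *-cancelˡ-≤ 0<2 (≤-by
    (+-nonneg (*-nonneg (≤⇒0≤- d≤e) (≤⇒0≤- -c≤k)) (*-nonneg (≤⇒0≤- -d≤e) (≤⇒0≤- c≤k)))
    (solve 4 (λ d e c k → (e :- d) :* (k :- (:- c)) :+ (e :- (:- d)) :* (k :- c)
                         := :2 :* (e :* k) :- :2 :* (d :* c)) refl d e c k))

  ⟶-*ʳ : ∀ {f : ℕ → Carrier} {l} → f ⟶ l → ∀ c → (λ n → f n * c) ⟶ (l * c)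
  ⟶-*ʳ {f} {l} f⟶l c ε 0<ε =
    let m , c<m = archimedean c ; m′ , -c<m′ = archimedean (- c)
        k = m S.× 1# + m′ S.× 1#
        c≤k = ≤-respˡ (+-identityʳ c) (+-mono-≤ (<⇒≤ c<m) (×1-nonneg m′))
        -c≤k = ≤-respˡ (+-identityˡ (- c)) (+-mono-≤ (×1-nonneg m) (<⇒≤ -c<m′))
        ε′ , 0<ε′ , ε′k<ε = smallMultiplier (+-nonneg (×1-nonneg m) (×1-nonneg m′)) 0<ε
        N , close = f⟶l ε′ 0<ε′
    in N , λ n N≤n →
       let f-l≤ , l-f≤ = close n N≤n
       in ≤-<-trans (≤-respˡ ([y-z]x≈yx-zx c (f n) l)
            (*-bound (<⇒≤ f-l≤) (≤-respˡ (flip l (f n)) (<⇒≤ l-f≤)) c≤k -c≤k)) ε′k<ε ,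
          ≤-<-trans (≤-respˡ ([y-z]x≈yx-zx c l (f n))
            (*-bound (<⇒≤ l-f≤) (≤-respˡ (flip (f n) l) (<⇒≤ f-l≤)) c≤k -c≤k)) ε′k<ε
    where
    flip : ∀ x y → x - y ≈ - (y - x)
    flip = solve 2 (λ x y → x :- y := :- (y :- x)) refl

  ⟶-sum : ∀ {n} {f : ℕ → Vector Carrier n} {l} → (∀ i → (λ m → f m i) ⟶ l i) → (λ m → sum (f m)) ⟶ sum l
  ⟶-sum {zero}  f⟶l = ⟶-const 0#
  ⟶-sum {suc n} f⟶l = ⟶-+ (f⟶l zero) (⟶-sum (f⟶l ∘ suc))

  ⟶-dotʳ : ∀ {n} {f : ℕ → Vector Carrier n} {l} → (∀ i → (λ m → f m i) ⟶ l i) → ∀ v → (λ m → dot (f m) v) ⟶ dot l v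
  ⟶-dotʳ f⟶l v = ⟶-sum λ i → ⟶-*ʳ (f⟶l i) (v i)

  -- `1 - g * g ^ m` equals `(1 - g) + g * (1 - g ^ m)`. One summand of a positive sum is positive,
  -- and the second leads to a smaller exponent.
  ^<1⇒<1 : ∀ {g} → 0# ≤ g → ∀ m → g ^ suc m < 1# → g < 1#
  ^<1⇒<1 {g} 0≤g m gᵐ<1 = 0<-⇒< ([ (λ 0<1-g → 0<1-g) , recurse m ]′ (+-pos-split (<-respʳ-≈
      (solve 2 (λ g p → :1 :- g :* p := (:1 :- g) :+ g :* (:1 :- p)) refl g (g ^ m)) (<⇒0<- gᵐ<1))))
    where
    recurse : ∀ m → 0# < g * (1# - g ^ m) → 0# < 1# - g
    recurse zero    0<g*0 = contradiction (<-respʳ-≈ (solve 1 (λ g → g :* (:1 :- :1) := :0) refl g) 0<g*0) ≤-refl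
    recurse (suc m) 0<    = <⇒0<- (^<1⇒<1 0≤g m (0<-⇒< (*-cancelˡ-pos 0< 0≤g)))

  ²-cancel-< : 0# ≤ x → 0# ≤ y → x * x < y * y → x < y
  ²-cancel-< {x} {y} 0≤x 0≤y x²<y² = 0<-⇒< (*-cancelʳ-pos (<-respʳ-≈
    (solve 2 (λ x y → y :* y :- x :* x := (y :- x) :* (y :+ x)) refl x y) (<⇒0<- x²<y²)) (+-nonneg 0≤y 0≤x))

-- Matrix powers acting on vectors

module MatrixPowers {a ℓ₁ ℓ₂ ℓ₃} (ℝ : RealField a ℓ₁ ℓ₂ ℓ₃) where
  open RealMatrices ℝ hiding (zero)
  open OrderedField ℝ
  open IntegerCoefficientSolver commutativeRing using (solve; _:=_; _:+_; _:*_)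
  open SetoidReasoning setoid

  private
    variable
      n : ℕ

  dot-congʳ : (u : Vector Carrier n) {v w : Vector Carrier n} → v ≈ᵥ w → dot u v ≈ dot u w
  dot-congʳ u v≈w = sum-cong-≋ (λ i → *-congˡ (v≈w i))

  dot-congˡ : {u v : Vector Carrier n} (w : Vector Carrier n) → u ≈ᵥ v → dot u w ≈ dot v w
  dot-congˡ w u≈v = sum-cong-≋ (λ i → *-congʳ (u≈v i))

  dot-comm : (u v : Vector Carrier n) → dot u v ≈ dot v u
  dot-comm u v = sum-cong-≋ (λ i → *-comm (u i) (v i))

  combination : Carrier → Vector Carrier n → Carrier → Vector Carrier n → Vector Carrier n
  combination c v d w i = c * v i + d * w i

  dot-combination : ∀ (u : Vector Carrier n) c v d w → dot u (combination c v d w) ≈ c * dot u v + d * dot u w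
  dot-combination u c v d w = begin
    sum (λ i → u i * (c * v i + d * w i))
      ≈⟨ sum-cong-≋ (λ i → solve 5 (λ u c v d w → u :* (c :* v :+ d :* w) := c :* (u :* v) :+ d :* (u :* w)) refl (u i) c (v i) d (w i)) ⟩
    sum (λ i → c * (u i * v i) + d * (u i * w i))
      ≈⟨ ∑-distrib-+ (λ i → c * (u i * v i)) (λ i → d * (u i * w i)) ⟩
    sum (λ i → c * (u i * v i)) + sum (λ i → d * (u i * w i))
      ≈⟨ +-cong (*-distribˡ-sum c (λ i → u i * v i)) (*-distribˡ-sum d (λ i → u i * w i)) ⟨
    c * dot u v + d * dot u w ∎

  dot-scaleʳ : ∀ (u : Vector Carrier n) c v → dot u (c ·ᵥ v) ≈ c * dot u v
  dot-scaleʳ u c v = begin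
    sum (λ i → u i * (c * v i))   ≈⟨ sum-cong-≋ (λ i → solve 3 (λ u c v → u :* (c :* v) := c :* (u :* v)) refl (u i) c (v i)) ⟩
    sum (λ i → c * (u i * v i))   ≈⟨ *-distribˡ-sum c (λ i → u i * v i) ⟨
    c * dot u v                   ∎

  dot-scaleˡ : ∀ c (u v : Vector Carrier n) → dot (c ·ᵥ u) v ≈ c * dot u v
  dot-scaleˡ c u v = trans (dot-comm (c ·ᵥ u) v) (trans (dot-scaleʳ v c u) (*-congˡ (dot-comm v u)))

  dot-*ᵥ : ∀ {m n} (u : Vector Carrier m) (A : Matrix m n) v → dot u (A *ᵥ v) ≈ dot (u ᵥ* A) v
  dot-*ᵥ u A v = begin
    sum (λ i → u i * sum (λ j → A i j * v j))     ≈⟨ sum-cong-≋ (λ i → *-distribˡ-sum (u i) (λ j → A i j * v j)) ⟩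
    sum (λ i → sum (λ j → u i * (A i j * v j)))   ≈⟨ ∑-comm (λ i j → u i * (A i j * v j)) ⟩
    sum (λ j → sum (λ i → u i * (A i j * v j)))   ≈⟨ sum-cong-≋ (λ j → sum-cong-≋ (λ i → *-assoc (u i) (A i j) (v j))) ⟨
    sum (λ j → sum (λ i → u i * A i j * v j))     ≈⟨ sum-cong-≋ (λ j → *-distribʳ-sum (v j) (λ i → u i * A i j)) ⟨
    sum (λ j → sum (λ i → u i * A i j) * v j)     ∎

  basis : Fin n → Vector Carrier n
  basis j i = scalar 1# i j

  dot-scalarˡ : ∀ (i : Fin n) v → dot (scalar 1# i) v ≈ v i
  dot-scalarˡ {suc n} zero v = begin
    1# * v zero + sum (λ j → 0# * v (suc j))   ≈⟨ +-cong (*-identityˡ _) (sum-cong-≋ (λ j → zeroˡ (v (suc j)))) ⟩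
    v zero + sum {n} (λ _ → 0#)                ≈⟨ +-congˡ (sum-replicate-zero n) ⟩
    v zero + 0#                                ≈⟨ +-identityʳ _ ⟩
    v zero                                     ∎
  dot-scalarˡ (suc i) v = begin
    0# * v zero + dot (scalar 1# i) (v ∘ suc)   ≈⟨ +-cong (zeroˡ _) (dot-scalarˡ i (v ∘ suc)) ⟩
    0# + v (suc i)                              ≈⟨ +-identityˡ _ ⟩
    v (suc i)                                   ∎

  dot-basisʳ : ∀ (v : Vector Carrier n) j → dot v (basis j) ≈ v j
  dot-basisʳ {suc n} v zero = begin
    v zero * 1# + sum (λ j → v (suc j) * 0#)   ≈⟨ +-cong (*-identityʳ _) (sum-cong-≋ (λ j → zeroʳ (v (suc j)))) ⟩
    v zero + sum {n} (λ _ → 0#)                ≈⟨ +-congˡ (sum-replicate-zero n) ⟩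
    v zero + 0#                                ≈⟨ +-identityʳ _ ⟩
    v zero                                     ∎
  dot-basisʳ v (suc j) = begin
    v zero * 0# + dot (v ∘ suc) (basis j)   ≈⟨ +-cong (zeroʳ _) (dot-basisʳ (v ∘ suc) j) ⟩
    0# + v (suc j)                          ≈⟨ +-identityˡ _ ⟩
    v (suc j)                               ∎

  basis-nonneg : ∀ (j : Fin n) i → 0# ≤ basis j i
  basis-nonneg j i with does (i Fin.≟ j)
  ... | true  = 0≤1
  ... | false = ≤-refl

  basis-diagonal : ∀ (j : Fin n) → basis j j ≈ 1#
  basis-diagonal zero    = refl
  basis-diagonal (suc j) = basis-diagonal j

  module _ (A : Matrix n n) where

    act : ℕ → Vector Carrier n → Vector Carrier n
    act zero    v = v
    act (suc m) v = A *ᵥ act m v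

    act-combination : ∀ m c v d w → act m (combination c v d w) ≈ᵥ combination c (act m v) d (act m w)
    act-combination zero    c v d w i = refl
    act-combination (suc m) c v d w i = trans
      (dot-congʳ (A i) (act-combination m c v d w)) (dot-combination (A i) c (act m v) d (act m w))

    act-scale : ∀ m c v → act m (c ·ᵥ v) ≈ᵥ (c ·ᵥ act m v)
    act-scale zero    c v i = refl
    act-scale (suc m) c v i = trans (dot-congʳ (A i) (act-scale m c v)) (dot-scaleʳ (A i) c (act m v))

    act-+ : ∀ k m v → act (k ℕ.+ m) v ≡ act k (act m v)
    act-+ zero    m v = ≡.refl
    act-+ (suc k) m v = ≡.cong (A *ᵥ_) (act-+ k m v)

    act-suc : ∀ m v → act m (A *ᵥ v) ≈ᵥ act (suc m) v
    act-suc zero    v i = refl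
    act-suc (suc m) v i = dot-congʳ (A i) (act-suc m v)

    ^ₘ-act : ∀ m v → ((A ^ₘ m) *ᵥ v) ≈ᵥ act m v
    ^ₘ-act zero    v i = dot-scalarˡ i v
    ^ₘ-act (suc m) v i = begin
      dot (A i ᵥ* (A ^ₘ m)) v    ≈⟨ dot-*ᵥ (A i) (A ^ₘ m) v ⟨
      dot (A i) ((A ^ₘ m) *ᵥ v)  ≈⟨ dot-congʳ (A i) (^ₘ-act m v) ⟩
      dot (A i) (act m v)        ∎

    ^ₘ-column : ∀ m i j → (A ^ₘ m) i j ≈ act m (basis j) i
    ^ₘ-column zero    i j = refl
    ^ₘ-column (suc m) i j = dot-congʳ (A i) (λ l → ^ₘ-column m l j)

    act-eigenvector : ∀ {ρ x} → (A *ᵥ x) ≈ᵥ (ρ ·ᵥ x) → ∀ m → act m x ≈ᵥ ((ρ ^ m) ·ᵥ x)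
    act-eigenvector Ax≈ρx zero    i = sym (*-identityˡ _)
    act-eigenvector {ρ} {x} Ax≈ρx (suc m) i = begin
      dot (A i) (act m x)            ≈⟨ dot-congʳ (A i) (act-eigenvector Ax≈ρx m) ⟩
      dot (A i) ((ρ ^ m) ·ᵥ x)       ≈⟨ dot-scaleʳ (A i) (ρ ^ m) x ⟩
      ρ ^ m * dot (A i) x            ≈⟨ *-congˡ (Ax≈ρx i) ⟩
      ρ ^ m * (ρ * x i)              ≈⟨ solve 3 (λ p r x → p :* (r :* x) := r :* p :* x) refl (ρ ^ m) ρ (x i) ⟩
      ρ ^ suc m * x i                ∎

  _ᵀ : ∀ {m n} → Matrix m n → Matrix n m
  (A ᵀ) i j = A j i

  -- Powers unfold on the left, while transposition puts the new factor on the right. Reading the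
  -- entry as a coordinate of `Aᵐ (A eᵢ)` lets `act-suc` move that factor back.
  ^ₘ-ᵀ : ∀ (A : Matrix n n) m i j → ((A ᵀ) ^ₘ m) i j ≈ (A ^ₘ m) j i
  ^ₘ-ᵀ A zero i j = scalar-sym i j
    where
    scalar-sym : ∀ {n} (i j : Fin n) → scalar 1# i j ≈ scalar 1# j i
    scalar-sym zero    zero    = refl
    scalar-sym zero    (suc j) = refl
    scalar-sym (suc i) zero    = refl
    scalar-sym (suc i) (suc j) = scalar-sym i j
  ^ₘ-ᵀ A (suc m) i j = begin
    sum (λ l → A l i * ((A ᵀ) ^ₘ m) l j)      ≈⟨ sum-cong-≋ (λ l → trans (*-congˡ (^ₘ-ᵀ A m l j)) (*-comm _ _)) ⟩
    dot ((A ^ₘ m) j) (λ l → A l i)           ≈⟨ dot-congʳ ((A ^ₘ m) j) (λ l → dot-basisʳ (A l) i) ⟨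
    dot ((A ^ₘ m) j) (A *ᵥ basis i)          ≈⟨ ^ₘ-act A m (A *ᵥ basis i) j ⟩
    act A m (A *ᵥ basis i) j                 ≈⟨ act-suc A m (basis i) j ⟩
    act A (suc m) (basis i) j                ≈⟨ ^ₘ-column A (suc m) j i ⟨
    (A ^ₘ suc m) j i                         ∎

  ᵀ-primitive : ∀ {A : Matrix n n} → IsPrimitive A → IsPrimitive (A ᵀ)
  ᵀ-primitive {A = A} (0≤A , k , 1≤k , 0<Aᵏ) =
    (λ i j → 0≤A j i) , k , 1≤k , λ i j → <-respʳ-≈ (sym (^ₘ-ᵀ A k i j)) (0<Aᵏ j i)

  ^ₘ-nonneg : ∀ {A : Matrix n n} → (∀ i j → 0# ≤ A i j) → ∀ m i j → 0# ≤ (A ^ₘ m) i j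
  ^ₘ-nonneg 0≤A zero    i j = basis-nonneg j i
  ^ₘ-nonneg 0≤A (suc m) i j = sum-nonneg _ (λ l → *-nonneg (0≤A i l) (^ₘ-nonneg 0≤A m l j))

  -- The diagonal entry of the positive power is a positive sum of products with entries of row `i`,
  -- so one such product, and with it an entry of the row, is positive.
  primitive⇒row-pos : ∀ {A : Matrix n n} → IsPrimitive A → ∀ i → ∃ λ j → 0# < A i j
  primitive⇒row-pos {A = A} (0≤A , suc k , _ , 0<Aᵏ) i =
    let j , 0<Aij*_ = sum-pos⇒∃ _ (0<Aᵏ i i)
    in j , *-cancelʳ-pos 0<Aij*_ (^ₘ-nonneg 0≤A k j i)

-- Growth functionals of a primitive matrix

module Perron {a ℓ₁ ℓ₂ ℓ₃} (ℝ : RealField a ℓ₁ ℓ₂ ℓ₃) where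
  open RealMatrices ℝ hiding (zero)
  open OrderedField ℝ
  open MatrixPowers ℝ
  open IntegerCoefficientSolver commutativeRing using (solve; _:=_; _:+_; _:*_; :-_; _:-_; :0; :1; :2)

  -- The linear functional sending `v` to the limit of the quotients of the coordinates of `Aᵐ v` by
  -- those of `Aᵐ u`, a limit that is the same in every coordinate. `weight j` is its value at the
  -- basis vector `eⱼ`.
  record GrowthFunctional {n} (A : Matrix n n) (u : Vector Carrier n) : Set (a ⊔ ℓ₁ ⊔ ℓ₃) where
    field
      weight             : Vector Carrier n
      weight-pos         : ∀ j → 0# < weight j
      dot-weight-u       : dot weight u ≈ 1#
      ρ                  : Carrier
      ρ-pos              : 0# < ρ
      dot-weight-Au      : dot weight (A *ᵥ u) ≈ ρ
      weight-eigenvector : (weight ᵥ* A) ≈ᵥ (ρ ·ᵥ weight)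
      column-growth      : ∀ j ε → 0# < ε → ∃ λ N → ∀ m → N ℕ.≤ m → ∀ i →
        ((weight j - ε) * act A m u i ≤ (A ^ₘ m) i j) × ((A ^ₘ m) i j ≤ (weight j + ε) * act A m u i)

  -- The growth of A v is measured against that of A u.
  module Growth {n} (A : Matrix (suc n) (suc n)) (A-primitive : IsPrimitive A)
                (u : Vector Carrier (suc n)) (0<u : ∀ i → 0# < u i) where

    private
      variable
        v w v′ w′ : Vector Carrier (suc n)
        b κ s t : Carrier

    0≤A = proj₁ A-primitive
    k = proj₁ (proj₂ A-primitive)
    0<Aᵏ = proj₂ (proj₂ (proj₂ A-primitive))

    infix 4 _≼_

    _≼[_]_ : Vector Carrier (suc n) → ℕ → Vector Carrier (suc n) → Set ℓ₃
    v ≼[ m ] w = ∀ i → act A m v i ≤ act A m w i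

    -- Eventual domination. As `A` has nonnegative entries, an inequality between `Aᵐ v` and `Aᵐ w`
    -- persists for all larger exponents, and this is why the relation is transitive.
    _≼_ : Vector Carrier (suc n) → Vector Carrier (suc n) → Set ℓ₃
    v ≼ w = ∃ λ m → v ≼[ m ] w

    act-pos : ∀ m → (∀ i → 0# < v i) → ∀ i → 0# < act A m v i
    act-pos zero    0<v = 0<v
    act-pos (suc m) 0<v i =
      let j , 0<Aij = primitive⇒row-pos A-primitive i
          0<mv = act-pos m 0<v
      in sum-pos _ (λ l → *-nonneg (0≤A i l) (<⇒≤ (0<mv l))) j (*-pos 0<Aij (0<mv j))

    ≼-persists : ∀ {m m′} → m ℕ.≤ m′ → v ≼[ m ] w → v ≼[ m′ ] w
    ≼-persists {v = v} {w} m≤m′ = go (ℕ.≤⇒≤′ m≤m′)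
      where
      go : ∀ {m m′} → m ℕ.≤′ m′ → v ≼[ m ] w → v ≼[ m′ ] w
      go (ℕ.≤′-reflexive ≡.refl) v≼w = v≼w
      go (ℕ.≤′-step m≤m′) v≼w i = sum-mono-≤ (λ l → *-monoʳ-≤ (0≤A i l) (go m≤m′ v≼w l))

    ≤⇒≼ : (∀ i → v i ≤ w i) → v ≼ w
    ≤⇒≼ v≤w = 0 , v≤w

    ≼-trans : v ≼ w → w ≼ w′ → v ≼ w′
    ≼-trans (m , v≼w) (m′ , w≼w′) = m ℕ.⊔ m′ , λ i →
      ≤-trans (≼-persists (ℕ.m≤m⊔n m m′) v≼w i) (≼-persists (ℕ.m≤n⊔m m m′) w≼w′ i)

    ≼-respʳ : w ≈ᵥ w′ → v ≼ w → v ≼ w′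
    ≼-respʳ w≈w′ v≼w = ≼-trans v≼w (≤⇒≼ (λ i → ≤-reflexive (w≈w′ i)))

    ≼-respˡ : v ≈ᵥ v′ → v ≼ w → v′ ≼ w
    ≼-respˡ v≈v′ = ≼-trans (≤⇒≼ (λ i → ≤-reflexive (sym (v≈v′ i))))

    ≼-combination : 0# ≤ b → 0# ≤ κ → v ≼ v′ → w ≼ w′ → combination b v κ w ≼ combination b v′ κ w′
    ≼-combination {b} {κ} {v} {v′} {w} {w′} 0≤b 0≤κ (m , v≼v′) (m′ , w≼w′) = m ℕ.⊔ m′ , λ i →
      ≤-respˡ (sym (act-combination A (m ℕ.⊔ m′) b v κ w i)) (≤-respʳ (sym (act-combination A (m ℕ.⊔ m′) b v′ κ w′ i))
        (+-mono-≤ (*-monoʳ-≤ 0≤b (≼-persists (ℕ.m≤m⊔n m m′) v≼v′ i))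
                  (*-monoʳ-≤ 0≤κ (≼-persists (ℕ.m≤n⊔m m m′) w≼w′ i))))

    ≼-translate : ∀ z → v ≼ w → (λ i → v i + z i) ≼ (λ i → w i + z i)
    ≼-translate {v} {w} z v≼w = ≼-respˡ (λ i → +-cong (*-identityˡ (v i)) (*-identityˡ (z i)))
      (≼-respʳ (λ i → +-cong (*-identityˡ (w i)) (*-identityˡ (z i)))
        (≼-combination 0≤1 0≤1 v≼w (≤⇒≼ {z} (λ i → ≤-refl))))

    ≼-act : v ≼ w → A *ᵥ v ≼ A *ᵥ w
    ≼-act {v} {w} (m , v≼w) = m , λ i →
      ≤-respˡ (sym (act-suc A m v i)) (≤-respʳ (sym (act-suc A m w i)) (≼-persists (ℕ.n≤1+n m) v≼w i))

    ≤⇒·≼ : b ≤ κ → b ·ᵥ u ≼ κ ·ᵥ u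
    ≤⇒·≼ b≤κ = ≤⇒≼ (λ i → *-monoˡ-≤ (<⇒≤ (0<u i)) b≤κ)

    ·≼⇒≤ : b ·ᵥ u ≼ κ ·ᵥ u → b ≤ κ
    ·≼⇒≤ {b} {κ} (m , bu≼cu) = *-cancelˡ-≤ (act-pos m 0<u zero)
      (≤-respˡ (trans (act-scale A m b u zero) (*-comm _ _))
        (≤-respʳ (trans (act-scale A m κ u zero) (*-comm _ _)) (bu≼cu zero)))

    -- A positive power of A spreads mass: min Aᵏ / max Aᵏ of the average
    -- survives everywhere.
    μ-exists : ∃ λ μ → 0# < μ × (∀ i j → μ ≤ (A ^ₘ k) i j)
    μ-exists = positiveLowerBound² (A ^ₘ k) 0<Aᵏ

    μ = proj₁ μ-exists
    0<μ = proj₁ (proj₂ μ-exists)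
    μ≤Aᵏ = proj₂ (proj₂ μ-exists)

    K : Carrier
    K = sum (λ i → sum (λ j → (A ^ₘ k) i j))

    Aᵏ≤K : ∀ i j → (A ^ₘ k) i j ≤ K
    Aᵏ≤K i j = ≤-trans (term≤sum _ (λ j → <⇒≤ (0<Aᵏ i j)) j)
                       (term≤sum _ (λ i → sum-nonneg _ (λ j → <⇒≤ (0<Aᵏ i j))) i)

    0<K : 0# < K
    0<K = <-≤-trans (0<Aᵏ zero zero) (Aᵏ≤K zero zero)

    δ : Carrier
    δ = μ * recip K 0<K

    0<δ : 0# < δ
    0<δ = *-pos 0<μ (recip-pos 0<K)

    δK≈μ : δ * K ≈ μ
    δK≈μ = trans (*-assoc μ _ K) (trans (*-congˡ (trans (*-comm _ K) (recip-inverseʳ K 0<K))) (*-identityʳ μ))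

    δ≤1 : δ ≤ 1#
    δ≤1 = *-cancelˡ-≤ 0<K (≤-respˡ (trans (sym δK≈μ) (*-comm δ K))
            (≤-respʳ (sym (*-identityʳ K)) (≤-trans (μ≤Aᵏ zero zero) (Aᵏ≤K zero zero))))

    module Spread (m : ℕ) where
      total = sum (act A m u)
      0<total : 0# < total
      0<total = sum-pos _ (λ i → <⇒≤ (act-pos m 0<u i)) zero (act-pos m 0<u zero)

      share : Vector Carrier (suc n) → Carrier
      share p = δ * (sum (act A m p) * recip total 0<total)

      -- Write `p'` and `u'` for `Aᵐ p` and `Aᵐ u`. Each coordinate of `Aᵏ p'` is at least `μ` times
      -- the sum of `p'`, each coordinate of `Aᵏ u'` is at most `K` times the sum of `u'`, and `δ`
      -- is `μ / K`.
      spread : ∀ p → (∀ i → 0# ≤ act A m p i) → share p ·ᵥ u ≼ p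
      spread p 0≤p = k ℕ.+ m , λ i → ≤-respˡ (sym (act-scale A (k ℕ.+ m) (share p) u i))
        (≤-respˡ (*-congˡ (act-k u i)) (≤-respʳ (act-k p i) (bound i)))
        where
        open ≤-Reasoning
        act-k : ∀ v → ((A ^ₘ k) *ᵥ act A m v) ≈ᵥ act A (k ℕ.+ m) v
        act-k v i = trans (^ₘ-act A k (act A m v) i) (reflexive (≡.cong (_$ i) (≡.sym (act-+ A k m v))))
        r = recip total 0<total
        0≤sum : 0# ≤ sum (act A m p)
        0≤sum = sum-nonneg _ 0≤p
        bound : ∀ i → share p * ((A ^ₘ k) *ᵥ act A m u) i ≤ ((A ^ₘ k) *ᵥ act A m p) i
        bound i = begin
          share p * ((A ^ₘ k) *ᵥ act A m u) i
            ≤⟨ *-monoʳ-≤ (*-nonneg (<⇒≤ 0<δ) (*-nonneg 0≤sum (<⇒≤ (recip-pos 0<total))))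
                 (sum-mono-≤ (λ j → *-monoˡ-≤ (<⇒≤ (act-pos m 0<u j)) (Aᵏ≤K i j))) ⟩
          share p * sum (λ j → K * act A m u j)
            ≈⟨ *-congˡ (*-distribˡ-sum K (act A m u)) ⟨
          share p * (K * total)
            ≈⟨ solve 5 (λ d S r K T → d :* (S :* r) :* (K :* T) := (d :* K) :* (S :* (T :* r))) refl δ (sum (act A m p)) r K total ⟩
          δ * K * (sum (act A m p) * (total * r))
            ≈⟨ *-cong δK≈μ (trans (*-congˡ (recip-inverseʳ total 0<total)) (*-identityʳ _)) ⟩
          μ * sum (act A m p)
            ≈⟨ *-distribˡ-sum μ (act A m p) ⟩
          sum (λ j → μ * act A m p j)
            ≤⟨ sum-mono-≤ (λ j → *-monoˡ-≤ (0≤p j) (μ≤Aᵏ i j)) ⟩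
          ((A ^ₘ k) *ᵥ act A m p) i ∎

    record Bracket (v : Vector Carrier (suc n)) : Set (a ⊔ ℓ₃) where
      field
        lo hi : Carrier
        lower : lo ·ᵥ u ≼ v
        upper : v ≼ hi ·ᵥ u

    module _ {v : Vector Carrier (suc n)} (bracket : Bracket v) where
      open Bracket bracket
      private
        m = proj₁ lower ℕ.⊔ proj₁ upper
        below = combination 1# v (- lo) u
        above = combination hi u (- 1#) v
      open Spread m

      below≥0 : ∀ i → 0# ≤ act A m below i
      below≥0 i = ≤-respʳ (begin
        act A m v i - act A m (lo ·ᵥ u) i       ≈⟨ +-congˡ (-‿cong (act-scale A m lo u i)) ⟩
        act A m v i - lo * act A m u i          ≈⟨ solve 3 (λ v l u → v :- l :* u := :1 :* v :+ (:- l) :* u) refl _ lo _ ⟩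
        1# * act A m v i + (- lo) * act A m u i ≈⟨ act-combination A m 1# v (- lo) u i ⟨
        act A m below i                         ∎)
        (≤⇒0≤- (≼-persists {v = lo ·ᵥ u} {w = v} (ℕ.m≤m⊔n (proj₁ lower) (proj₁ upper)) (proj₂ lower) i))
        where open SetoidReasoning setoid

      above≥0 : ∀ i → 0# ≤ act A m above i
      above≥0 i = ≤-respʳ (begin
        act A m (hi ·ᵥ u) i - act A m v i       ≈⟨ +-congʳ (act-scale A m hi u i) ⟩
        hi * act A m u i - act A m v i          ≈⟨ solve 3 (λ v h u → h :* u :- v := h :* u :+ (:- :1) :* v) refl _ hi _ ⟩
        hi * act A m u i + (- 1#) * act A m v i ≈⟨ act-combination A m hi u (- 1#) v i ⟨
        act A m above i                         ∎)
        (≤⇒0≤- (≼-persists {v = v} {w = hi ·ᵥ u} (ℕ.m≤n⊔m (proj₁ lower) (proj₁ upper)) (proj₂ upper) i))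
        where open SetoidReasoning setoid

      share-nonneg : ∀ p → (∀ i → 0# ≤ act A m p i) → 0# ≤ share p
      share-nonneg p 0≤p = *-nonneg (<⇒≤ 0<δ) (*-nonneg (sum-nonneg _ 0≤p) (<⇒≤ (recip-pos 0<total)))

      -- Both `v - lo u` and `hi u - v` are nonnegative after `m` steps, so each eventually
      -- dominates its share of `u`. The ends move inwards by these shares.
      tighten : Bracket v
      tighten = record
        { lo = lo + share below
        ; hi = hi - share above
        ; lower = ≼-respˡ (λ i → solve 3 (λ s l u → s :* u :+ l :* u := (l :+ s) :* u) refl (share below) lo (u i))
            (≼-respʳ (λ i → solve 3 (λ v l u → (:1 :* v :+ (:- l) :* u) :+ l :* u := v) refl (v i) lo (u i))
              (≼-translate (lo ·ᵥ u) (spread below below≥0)))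
        ; upper = ≼-respˡ (λ i → solve 3 (λ s v u → s :* u :+ (v :- s :* u) := v) refl (share above) (v i) (u i))
            (≼-respʳ (λ i → solve 4 (λ s v h u → (h :* u :+ (:- :1) :* v) :+ (v :- s :* u) := (h :- s) :* u) refl (share above) (v i) hi (u i))
              (≼-translate (λ i → v i - share above * u i) (spread above above≥0)))
        }

      sum-below+above : sum (act A m below) + sum (act A m above) ≈ (hi - lo) * total
      sum-below+above = begin
        sum (act A m below) + sum (act A m above)
          ≈⟨ ∑-distrib-+ (act A m below) (act A m above) ⟨
        sum (λ i → act A m below i + act A m above i)
          ≈⟨ sum-cong-≋ (λ i → trans (+-cong (act-combination A m 1# v (- lo) u i) (act-combination A m hi u (- 1#) v i))
               (solve 4 (λ v l h u → (:1 :* v :+ (:- l) :* u) :+ (h :* u :+ (:- :1) :* v) := (h :- l) :* u) refl _ lo hi _)) ⟩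
        sum (λ i → (hi - lo) * act A m u i)
          ≈⟨ *-distribˡ-sum (hi - lo) (act A m u) ⟨
        (hi - lo) * total ∎
        where open SetoidReasoning setoid

      -- `below` and `above` add up to `(hi - lo) u`, so the two shares total `δ (hi - lo)` no
      -- matter how the mass is divided between them.
      tighten-gap : hi - share above - (lo + share below) ≈ (1# - δ) * (hi - lo)
      tighten-gap = begin
        hi - δ * (Sₐ * r) - (lo + δ * (Sᵦ * r))
          ≈⟨ solve 6 (λ h l d a b r → h :- d :* (a :* r) :- (l :+ d :* (b :* r)) := (h :- l) :- d :* ((b :+ a) :* r)) refl hi lo δ Sₐ Sᵦ r ⟩
        (hi - lo) - δ * ((Sᵦ + Sₐ) * r)
          ≈⟨ +-congˡ (-‿cong (*-congˡ (*-congʳ sum-below+above))) ⟩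
        (hi - lo) - δ * ((hi - lo) * total * r)
          ≈⟨ solve 4 (λ w d T r → w :- d :* (w :* T :* r) := w :- d :* w :* (T :* r)) refl (hi - lo) δ total r ⟩
        (hi - lo) - δ * (hi - lo) * (total * r)
          ≈⟨ +-congˡ (-‿cong (*-congˡ (recip-inverseʳ total 0<total))) ⟩
        (hi - lo) - δ * (hi - lo) * 1#
          ≈⟨ solve 2 (λ w d → w :- d :* w :* :1 := (:1 :- d) :* w) refl (hi - lo) δ ⟩
        (1# - δ) * (hi - lo) ∎
        where
        open SetoidReasoning setoid
        Sₐ = sum (act A m above)
        Sᵦ = sum (act A m below)
        r  = recip total 0<total

      lo-tighten : lo ≤ lo + share below
      lo-tighten = ≤-by (share-nonneg below below≥0) (solve 2 (λ l s → s := (l :+ s) :- l) refl lo (share below))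

      hi-tighten : hi - share above ≤ hi
      hi-tighten = ≤-by (share-nonneg above above≥0) (solve 2 (λ h s → s := h :- (h :- s)) refl hi (share above))

    infix 4 _∼_
    -- States that `t` is the limit of the quotients of `Aᵐ v` by `Aᵐ u`, phrased with `_≼_` so that
    -- no quotients have to be formed.
    _∼_ : Vector Carrier (suc n) → Carrier → Set (a ⊔ ℓ₃)
    v ∼ t = ∀ ε → 0# < ε → ((t - ε) ·ᵥ u ≼ v) × (v ≼ (t + ε) ·ᵥ u)

    ∼-limit : Bracket v → ∃ λ t → v ∼ t
    ∼-limit {v} bracket =
      let t , approx = geometricShrinking lo hi tighten bracket 0<δ δ≤1
            (λ b → ·≼⇒≤ (≼-trans (lower b) (upper b))) lo-tighten hi-tighten tighten-gap
      in t , λ ε 0<ε →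
         let b , lo≤t , t≤hi , gap<ε = approx ε 0<ε
         in ≼-trans (≤⇒·≼ (≤-by (+-nonneg (≤⇒0≤- t≤hi) (≤⇒0≤- (<⇒≤ gap<ε)))
              (solve 4 (λ l h t e → (h :- t) :+ (e :- (h :- l)) := l :- (t :- e)) refl (lo b) (hi b) t ε))) (lower b) ,
            ≼-trans (upper b) (≤⇒·≼ (≤-by (+-nonneg (≤⇒0≤- lo≤t) (≤⇒0≤- (<⇒≤ gap<ε)))
              (solve 4 (λ l h t e → (t :- l) :+ (e :- (h :- l)) := (t :+ e) :- h) refl (lo b) (hi b) t ε)))
      where open Bracket

    ∼-mono : v ∼ s → w ∼ t → v ≼ w → s ≤ t
    ∼-mono {v} {s} {w} {t} v∼s w∼t v≼w = ≤-limit (<⇒≤ 0<2) λ ε 0<ε →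
      ≤-by (≤⇒0≤- (·≼⇒≤ (≼-trans (proj₁ (v∼s ε 0<ε)) (≼-trans v≼w (proj₂ (w∼t ε 0<ε))))))
        (solve 3 (λ s t e → (t :+ e) :- (s :- e) := (t :+ e :* :2) :- s) refl s t ε)

    ∼-cong : v ≈ᵥ w → s ≈ t → v ∼ s → w ∼ t
    ∼-cong v≈w s≈t v∼s ε 0<ε =
      ≼-respˡ (λ i → *-congʳ (+-congʳ s≈t)) (≼-respʳ v≈w (proj₁ (v∼s ε 0<ε))) ,
      ≼-respʳ (λ i → *-congʳ (+-congʳ s≈t)) (≼-respˡ v≈w (proj₂ (v∼s ε 0<ε)))

    ∼-unique : v ∼ s → v ∼ t → s ≈ t
    ∼-unique v∼s v∼t = ≤-antisym (∼-mono v∼s v∼t (≤⇒≼ (λ i → ≤-refl))) (∼-mono v∼t v∼s (≤⇒≼ (λ i → ≤-refl)))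

    ∼-scaled-u : ∀ κ → κ ·ᵥ u ∼ κ
    ∼-scaled-u κ ε 0<ε =
      ≤⇒·≼ (≤-by (<⇒≤ 0<ε) (solve 2 (λ κ e → e := κ :- (κ :- e)) refl κ ε)) ,
      ≤⇒·≼ (≤-by (<⇒≤ 0<ε) (solve 2 (λ κ e → e := (κ :+ e) :- κ) refl κ ε))

    ∼-combination : 0# ≤ b → 0# ≤ κ → v ∼ s → w ∼ t → combination b v κ w ∼ b * s + κ * t
    ∼-combination {b} {κ} {v} {s} {w} {t} 0≤b 0≤κ v∼s w∼t ε 0<ε =
      let η , 0<η , ηbc<ε = smallMultiplier (+-nonneg 0≤b 0≤κ) 0<ε
          slack = ≤⇒0≤- (<⇒≤ ηbc<ε)
          v≽ , v≼ = v∼s η 0<η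
          w≽ , w≼ = w∼t η 0<η
      in ≼-trans (≤⇒·≼ (≤-by slack (solve 6 (λ b κ s t e h → e :- h :* (b :+ κ)
              := (b :* (s :- h) :+ κ :* (t :- h)) :- ((b :* s :+ κ :* t) :- e)) refl b κ s t ε η)))
           (≼-respˡ (λ i → assemble b (s - η) κ (t - η) (u i)) (≼-combination 0≤b 0≤κ v≽ w≽)) ,
         ≼-trans (≼-respʳ (λ i → assemble b (s + η) κ (t + η) (u i)) (≼-combination 0≤b 0≤κ v≼ w≼))
           (≤⇒·≼ (≤-by slack (solve 6 (λ b κ s t e h → e :- h :* (b :+ κ)
              := ((b :* s :+ κ :* t) :+ e) :- (b :* (s :+ h) :+ κ :* (t :+ h))) refl b κ s t ε η)))
      where
      assemble : ∀ b s κ t u → b * (s * u) + κ * (t * u) ≈ (b * s + κ * t) * u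
      assemble = solve 5 (λ b s κ t u → b :* (s :* u) :+ κ :* (t :* u) := (b :* s :+ κ :* t) :* u) refl

    ∼-dot : ∀ {m} (f : Fin m → Vector Carrier (suc n)) (τ : Vector Carrier m) → (∀ j → f j ∼ τ j) →
            ∀ κ → (∀ j → 0# ≤ κ j) → (λ i → dot κ (λ j → f j i)) ∼ dot κ τ
    ∼-dot {zero}  f τ f∼τ κ 0≤κ = ∼-cong (λ i → zeroˡ (u i)) refl (∼-scaled-u 0#)
    ∼-dot {suc m} f τ f∼τ κ 0≤κ = ∼-cong (λ i → +-congˡ (*-identityˡ _)) (+-congˡ (*-identityˡ _))
      (∼-combination (0≤κ zero) 0≤1 (f∼τ zero) (∼-dot (f ∘ suc) (τ ∘ suc) (f∼τ ∘ suc) (κ ∘ suc) (0≤κ ∘ suc)))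

    ∼-scale : 0# ≤ b → v ∼ s → b ·ᵥ v ∼ b * s
    ∼-scale {b} {v} {s} 0≤b v∼s = ∼-cong
      (λ i → solve 3 (λ b v u → b :* v :+ :0 :* (:0 :* u) := b :* v) refl b (v i) (u i))
      (solve 2 (λ b s → b :* s :+ :0 :* :0 := b :* s) refl b s)
      (∼-combination 0≤b ≤-refl v∼s (∼-scaled-u 0#))

    basis-bracket : ∀ j → Bracket (basis j)
    basis-bracket j = record
      { lo = 0#
      ; hi = r
      ; lower = ≤⇒≼ (λ i → ≤-respˡ (sym (zeroˡ (u i))) (basis-nonneg j i))
      ; upper = ≤⇒≼ (bound j)
      }
      where
      r = recip (u j) (0<u j)
      bound : ∀ j i → basis j i ≤ recip (u j) (0<u j) * u i
      bound j i with i Fin.≟ j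
      ... | yes ≡.refl = ≤-reflexive (sym (trans (*-comm _ _) (recip-inverseʳ (u j) (0<u j))))
      ... | no  _      = *-nonneg (<⇒≤ (recip-pos (0<u j))) (<⇒≤ (0<u i))

    abstract
      -- Abstract, so that the limit construction is never unfolded; all later facts rest on
      -- `basis∼weight`.
      weight : Vector Carrier (suc n)
      weight j = proj₁ (∼-limit (basis-bracket j))

      basis∼weight : ∀ j → basis j ∼ weight j
      basis∼weight j = proj₂ (∼-limit (basis-bracket j))

    ∼-weight : (∀ i → 0# ≤ v i) → v ∼ dot v weight
    ∼-weight {v} 0≤v = ∼-cong (λ i → trans (dot-comm v (λ j → basis j i)) (dot-scalarˡ i v)) refl
                         (∼-dot basis weight basis∼weight v 0≤v)

    -- Already at exponent 0 the vector `eⱼ` has positive mass, and `spread` turns this into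
    -- domination of a positive multiple of `u`.
    weight-pos : ∀ j → 0# < weight j
    weight-pos j = <-≤-trans 0<share (∼-mono (∼-scaled-u (share (basis j))) (basis∼weight j) (spread (basis j) (basis-nonneg j)))
      where
      open Spread 0
      0<share : 0# < share (basis j)
      0<share = *-pos 0<δ (*-pos (sum-pos _ (basis-nonneg j) j (<-respʳ-≈ (sym (basis-diagonal j)) 0<1)) (recip-pos 0<total))

    dot-weight-u : dot weight u ≈ 1#
    dot-weight-u = trans (dot-comm weight u)
      (∼-unique (∼-weight (λ i → <⇒≤ (0<u i))) (∼-cong (λ i → *-identityˡ (u i)) refl (∼-scaled-u 1#)))

    ρ : Carrier
    ρ = dot weight (A *ᵥ u)

    ρ-pos : 0# < ρ
    ρ-pos = sum-pos _ (λ i → <⇒≤ (*-pos (weight-pos i) (act-pos 1 0<u i))) zero (*-pos (weight-pos zero) (act-pos 1 0<u zero))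

    -- `A` is applied to the two approximations of `eⱼ` by multiples of `u`, and the results are
    -- compared under the functional, where `A eⱼ` has value `(weight ᵥ* A) j` and `A u` has value
    -- `ρ`.
    weight-eigenvector : (weight ᵥ* A) ≈ᵥ (ρ ·ᵥ weight)
    weight-eigenvector j = ≤-antisym
      (≤-limit 0≤ρ λ ε 0<ε →
        ≤-respʳ (solve 3 (λ r t e → (t :+ e) :* r := r :* t :+ e :* r) refl ρ (weight j) ε)
          (∼-mono Aeⱼ∼ (∼-scale (<⇒≤ (+-pos (weight-pos j) 0<ε)) Au∼ρ)
            (≼-respʳ (λ i → dot-scaleʳ (A i) (weight j + ε) u) (≼-act (proj₂ (basis∼weight j ε 0<ε))))))
      -- The coefficient `weight j - ε` may be negative, while `∼-scale` wants a nonnegative one.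
      -- Adding `ε A u` to both sides leaves the coefficient `weight j`.
      (≤-limit 0≤ρ λ ε 0<ε →
        ≤-respˡ (*-comm _ _) (≤-respʳ (+-congʳ (*-identityˡ _))
          (∼-mono (∼-scale (<⇒≤ (weight-pos j)) Au∼ρ) (∼-combination 0≤1 (<⇒≤ 0<ε) Aeⱼ∼ Au∼ρ)
            (≼-respˡ (λ i → trans (+-congʳ (dot-scaleʳ (A i) (weight j - ε) u))
                                  (solve 3 (λ t e z → (t :- e) :* z :+ e :* z := t :* z) refl (weight j) ε _))
              (≼-respʳ (λ i → +-congʳ (sym (*-identityˡ _)))
                (≼-translate (ε ·ᵥ (A *ᵥ u)) (≼-act (proj₁ (basis∼weight j ε 0<ε)))))))))
      where
      0≤ρ = <⇒≤ ρ-pos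
      Aeⱼ∼ : A *ᵥ basis j ∼ (weight ᵥ* A) j
      Aeⱼ∼ = ∼-cong (λ i → refl) (trans (dot-congˡ weight (λ i → dot-basisʳ (A i) j)) (dot-comm (λ i → A i j) weight))
        (∼-weight (λ i → ≤-respʳ (sym (dot-basisʳ (A i) j)) (0≤A i j)))
      Au∼ρ : A *ᵥ u ∼ ρ
      Au∼ρ = ∼-cong (λ i → refl) (dot-comm (A *ᵥ u) weight) (∼-weight (λ i → <⇒≤ (act-pos 1 0<u i)))

    column-growth : ∀ j ε → 0# < ε → ∃ λ N → ∀ m → N ℕ.≤ m → ∀ i →
                    ((weight j - ε) * act A m u i ≤ (A ^ₘ m) i j) × ((A ^ₘ m) i j ≤ (weight j + ε) * act A m u i)
    column-growth j ε 0<ε =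
      let (N , below) , (N′ , above) = basis∼weight j ε 0<ε
      in N ℕ.⊔ N′ , λ m m≥ i →
         ≤-respˡ (act-scale A m (weight j - ε) u i) (≤-respʳ (sym (^ₘ-column A m i j))
           (≼-persists (ℕ.≤-trans (ℕ.m≤m⊔n N N′) m≥) below i)) ,
         ≤-respˡ (sym (^ₘ-column A m i j)) (≤-respʳ (act-scale A m (weight j + ε) u i)
           (≼-persists (ℕ.≤-trans (ℕ.m≤n⊔m N N′) m≥) above i))

    abstract
      growthFunctional : GrowthFunctional A u
      growthFunctional = record
        { weight             = weight
        ; weight-pos         = weight-pos
        ; dot-weight-u       = dot-weight-u
        ; ρ                  = ρ
        ; ρ-pos              = ρ-pos
        ; dot-weight-Au      = refl
        ; weight-eigenvector = weight-eigenvector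
        ; column-growth      = column-growth
        }

-- Perron vectors, the limit of the powers, and the other eigenvalues

module PerronFrobenius {a ℓ₁ ℓ₂ ℓ₃} (ℝ : RealField a ℓ₁ ℓ₂ ℓ₃) where
  open RealMatrices ℝ hiding (zero)
  open OrderedField ℝ
  open MatrixPowers ℝ
  open IntegerCoefficientSolver commutativeRing using (solve; _:=_; _:+_; _:*_; :-_; _:-_; :0; :1; :2)

  scaled-^ₘ : ∀ {n} (A : Matrix n n) ρ (0<ρ : 0# < ρ) m i j →
              ((A /[ ρ , 0<ρ ]) ^ₘ m) i j ≈ (A ^ₘ m) i j * recip ρ 0<ρ ^ m
  scaled-^ₘ A ρ 0<ρ zero    i j = sym (*-identityʳ _)
  scaled-^ₘ A ρ 0<ρ (suc m) i j = begin
    sum (λ l → A i l * r * ((A /[ ρ , 0<ρ ]) ^ₘ m) l j)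
      ≈⟨ sum-cong-≋ (λ l → trans (*-congˡ (scaled-^ₘ A ρ 0<ρ m l j))
           (solve 4 (λ a r b p → a :* r :* (b :* p) := a :* b :* (r :* p)) refl (A i l) r ((A ^ₘ m) l j) (r ^ m))) ⟩
    sum (λ l → A i l * (A ^ₘ m) l j * r ^ suc m)
      ≈⟨ *-distribʳ-sum (r ^ suc m) (λ l → A i l * (A ^ₘ m) l j) ⟨
    (A ^ₘ suc m) i j * r ^ suc m ∎
    where
    open SetoidReasoning setoid
    r = recip ρ 0<ρ

  ^-recip : ∀ ρ (0<ρ : 0# < ρ) m → ρ ^ m * recip ρ 0<ρ ^ m ≈ 1#
  ^-recip ρ 0<ρ zero    = *-identityˡ 1#
  ^-recip ρ 0<ρ (suc m) = begin
    ρ * ρ ^ m * (r * r ^ m)     ≈⟨ solve 4 (λ x p r q → x :* p :* (r :* q) := (x :* r) :* (p :* q)) refl ρ (ρ ^ m) r (r ^ m) ⟩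
    (ρ * r) * (ρ ^ m * r ^ m)   ≈⟨ *-cong (recip-inverseʳ ρ 0<ρ) (^-recip ρ 0<ρ m) ⟩
    1# * 1#                     ≈⟨ *-identityˡ 1# ⟩
    1#                          ∎
    where
    open SetoidReasoning setoid
    r = recip ρ 0<ρ

  -- Since `Aᵐ x = ρᵐ x`, multiplying the growth estimate by `ρ⁻ᵐ` puts the scaled entry within
  -- `η * x i` of `x i * y j`.
  growth⇒limit : ∀ {n} (A : Matrix n n) ρ (0<ρ : 0# < ρ) (x y : Vector Carrier n) → (∀ i → 0# < x i) → (A *ᵥ x) ≈ᵥ (ρ ·ᵥ x) →
    (∀ j ε → 0# < ε → ∃ λ N → ∀ m → N ℕ.≤ m → ∀ i →
      ((y j - ε) * act A m x i ≤ (A ^ₘ m) i j) × ((A ^ₘ m) i j ≤ (y j + ε) * act A m x i)) →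
    (λ m → (A /[ ρ , 0<ρ ]) ^ₘ m) ⟶ₘ outer x y
  growth⇒limit A ρ 0<ρ x y 0<x Ax≈ρx column-growth i j ε 0<ε =
    let η , 0<η , ηx<ε = smallMultiplier (<⇒≤ (0<x i)) 0<ε
        N , growth = column-growth j η 0<η
    in N , λ m N≤m →
       let below , above = growth m N≤m i
       in ≤-<-trans (≤-by (≤⇒0≤- (*-monoˡ-≤ (r^≥0 m) above))
            (trans (+-cong (rescale (y j + η) m) (-‿cong (sym (scaled-^ₘ A ρ _ m i j))))
              (solve 4 (λ x y e c → (y :+ e) :* x :- c := e :* x :- (c :- x :* y)) refl (x i) (y j) η _))) ηx<ε ,
          ≤-<-trans (≤-by (≤⇒0≤- (*-monoˡ-≤ (r^≥0 m) below))
            (trans (+-cong (sym (scaled-^ₘ A ρ _ m i j)) (-‿cong (rescale (y j - η) m)))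
              (solve 4 (λ x y e c → c :- (y :- e) :* x := e :* x :- (x :* y :- c)) refl (x i) (y j) η _))) ηx<ε
    where
    r = recip ρ 0<ρ
    r^≥0 : ∀ m → 0# ≤ r ^ m
    r^≥0 m = ^-nonneg (<⇒≤ (recip-pos 0<ρ)) m
    rescale : ∀ t m → t * act A m x i * r ^ m ≈ t * x i
    rescale t m = begin
      t * act A m x i * r ^ m          ≈⟨ *-congʳ (*-congˡ (act-eigenvector A Ax≈ρx m i)) ⟩
      t * (ρ ^ m * x i) * r ^ m        ≈⟨ solve 4 (λ t p x q → t :* (p :* x) :* q := t :* x :* (p :* q)) refl t (ρ ^ m) (x i) (r ^ m) ⟩
      t * x i * (ρ ^ m * r ^ m)        ≈⟨ *-congˡ (^-recip ρ _ m) ⟩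
      t * x i * 1#                     ≈⟨ *-identityʳ _ ⟩
      t * x i                          ∎
      where open SetoidReasoning setoid

  record PerronPair {n} (A : Matrix n n) : Set (a ⊔ ℓ₁ ⊔ ℓ₃) where
    field
      ρ     : Carrier
      0<ρ   : 0# < ρ
      x y   : Vector Carrier n
      0<x   : ∀ i → 0# < x i
      0<y   : ∀ i → 0# < y i
      ∑x≈1  : sum x ≈ 1#
      yx≈1  : dot y x ≈ 1#
      Ax≈ρx : (A *ᵥ x) ≈ᵥ (ρ ·ᵥ x)
      yA≈ρy : (y ᵥ* A) ≈ᵥ (ρ ·ᵥ y)
      limit : (λ m → (A /[ ρ , 0<ρ ]) ^ₘ m) ⟶ₘ outer x y

  -- The growth functional of Aᵀ relative to (1, …, 1) is the right
  -- eigenvector x; that of A relative to x is the left eigenvector y, and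
  -- since Aᵐ x = ρᵐ x, its defining growth estimate is the limit itself.
  module _ {n} {A : Matrix n n} (right : Perron.GrowthFunctional ℝ (A ᵀ) (λ _ → 1#)) where
    open Perron.GrowthFunctional right using (ρ; ρ-pos) renaming (weight to x; weight-pos to 0<x)

    right-eigenvector : (A *ᵥ x) ≈ᵥ (ρ ·ᵥ x)
    right-eigenvector i = trans (dot-comm (A i) x) (Perron.GrowthFunctional.weight-eigenvector right i)

    perronPairFrom : Perron.GrowthFunctional ℝ A x → PerronPair A
    perronPairFrom left = record
      { ρ     = ρ
      ; 0<ρ   = ρ-pos
      ; x     = x
      ; y     = Left.weight
      ; 0<x   = 0<x
      ; 0<y   = Left.weight-pos
      ; ∑x≈1  = trans (sum-cong-≋ (λ i → sym (*-identityʳ (x i)))) (Perron.GrowthFunctional.dot-weight-u right)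
      ; yx≈1  = Left.dot-weight-u
      ; Ax≈ρx = right-eigenvector
      ; yA≈ρy = λ j → trans (Left.weight-eigenvector j) (*-congʳ ρ-left)
      ; limit = growth⇒limit A ρ ρ-pos x Left.weight 0<x right-eigenvector Left.column-growth
      }
      where
      module Left = Perron.GrowthFunctional left
      ρ-left : Left.ρ ≈ ρ
      ρ-left = begin
        Left.ρ                   ≈⟨ Left.dot-weight-Au ⟨
        dot Left.weight (A *ᵥ x) ≈⟨ dot-congʳ Left.weight right-eigenvector ⟩
        dot Left.weight (ρ ·ᵥ x) ≈⟨ dot-scaleʳ Left.weight ρ x ⟩
        ρ * dot Left.weight x    ≈⟨ *-congˡ Left.dot-weight-u ⟩
        ρ * 1#                   ≈⟨ *-identityʳ ρ ⟩
        ρ                        ∎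
        where open SetoidReasoning setoid

  perronPair : ∀ {n} (A : Matrix (suc n) (suc n)) → IsPrimitive A → PerronPair A
  perronPair A A-primitive = perronPairFrom right
    (Perron.Growth.growthFunctional ℝ A A-primitive weight weight-pos)
    where
    right = Perron.Growth.growthFunctional ℝ (A ᵀ) (ᵀ-primitive A-primitive) (λ _ → 1#) (λ _ → 0<1)
    open Perron.GrowthFunctional right using (weight; weight-pos)

  Re Im : ∀ {n} → Vector ℂ n → Vector Carrier n
  Re v i = proj₁ (v i)
  Im v i = proj₂ (v i)

  module Spectrum {n} {A : Matrix n n} (pair : PerronPair A) where
    open PerronPair pair

    C : Matrix n n
    C = A /[ ρ , 0<ρ ]

    r : Carrier
    r = recip ρ 0<ρ

    limit-dotʳ : ∀ v i → (λ m → act C m v i) ⟶ (x i * dot y v)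
    limit-dotʳ v i = ⟶-cong (λ m → ^ₘ-act C m v i)
      (trans (sum-cong-≋ (λ j → *-assoc (x i) (y j) (v j))) (sym (*-distribˡ-sum (x i) (λ j → y j * v j))))
      (⟶-dotʳ (limit i) v)

    limit-dotˡ : ∀ v j → (λ m → (v ᵥ* (C ^ₘ m)) j) ⟶ (dot v x * y j)
    limit-dotˡ v j = ⟶-cong (λ m → dot-comm (λ i → (C ^ₘ m) i j) v)
      (trans (sum-cong-≋ (λ i → solve 3 (λ x y v → x :* y :* v := v :* x :* y) refl (x i) (y j) (v i)))
             (sym (*-distribʳ-sum (y j) (λ i → v i * x i))))
      (⟶-dotʳ (λ i → limit i j) v)

    module _ {p q : Carrier} {vr vi : Vector Carrier n}
             (Avr : ∀ i → (A *ᵥ vr) i ≈ p * vr i - q * vi i)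
             (Avi : ∀ i → (A *ᵥ vi) i ≈ p * vi i + q * vr i) where

      private
        Y = dot y vr
        Z = dot y vi
        D = (p - ρ) * (p - ρ) + q * q

      ρ-dot : ∀ v → ρ * dot y v ≈ dot y (A *ᵥ v)
      ρ-dot v = trans (sym (dot-scaleˡ ρ y v)) (trans (dot-congˡ v (λ j → sym (yA≈ρy j))) (sym (dot-*ᵥ y A v)))

      ρY : ρ * Y ≈ p * Y - q * Z
      ρY = begin
        ρ * Y                                 ≈⟨ ρ-dot vr ⟩
        dot y (A *ᵥ vr)                       ≈⟨ dot-congʳ y (λ i → trans (Avr i) (solve 4 (λ p v q w → p :* v :- q :* w := p :* v :+ (:- q) :* w) refl p (vr i) q (vi i))) ⟩
        dot y (combination p vr (- q) vi)     ≈⟨ dot-combination y p vr (- q) vi ⟩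
        p * Y + (- q) * Z                     ≈⟨ solve 4 (λ p v q w → p :* v :+ (:- q) :* w := p :* v :- q :* w) refl p Y q Z ⟩
        p * Y - q * Z                         ∎
        where open SetoidReasoning setoid

      ρZ : ρ * Z ≈ p * Z + q * Y
      ρZ = trans (ρ-dot vi) (trans (dot-congʳ y Avi) (dot-combination y p vi q vr))

      -- Pairing the eigenvector equation with `y` gives `(ρ - β)(Y + i Z) = 0`. Multiplying by the
      -- conjugate of `ρ - β` leaves the real factor `D`, which is the squared modulus of `β - ρ`.
      D*Y≈0 : D * Y ≈ 0#
      D*Y≈0 = begin
        ((p - ρ) * (p - ρ) + q * q) * Y
          ≈⟨ solve 4 (λ p r q Y → ((p :- r) :* (p :- r) :+ q :* q) :* Y := (p :- r) :* (p :* Y :- r :* Y) :+ q :* (q :* Y)) refl p ρ q Y ⟩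
        (p - ρ) * (p * Y - ρ * Y) + q * (q * Y)
          ≈⟨ +-congʳ (*-congˡ (+-congˡ (-‿cong ρY))) ⟩
        (p - ρ) * (p * Y - (p * Y - q * Z)) + q * (q * Y)
          ≈⟨ solve 5 (λ p r q Y Z → (p :- r) :* (p :* Y :- (p :* Y :- q :* Z)) :+ q :* (q :* Y) := q :* ((p :* Z :+ q :* Y) :- r :* Z)) refl p ρ q Y Z ⟩
        q * ((p * Z + q * Y) - ρ * Z)
          ≈⟨ *-congˡ (+-congˡ (-‿cong ρZ)) ⟩
        q * ((p * Z + q * Y) - (p * Z + q * Y))
          ≈⟨ trans (*-congˡ (-‿inverseʳ _)) (zeroʳ q) ⟩
        0# ∎
        where open SetoidReasoning setoid

      D*Z≈0 : D * Z ≈ 0#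
      D*Z≈0 = begin
        ((p - ρ) * (p - ρ) + q * q) * Z
          ≈⟨ solve 4 (λ p r q Z → ((p :- r) :* (p :- r) :+ q :* q) :* Z := (p :- r) :* (p :* Z :- r :* Z) :+ q :* (q :* Z)) refl p ρ q Z ⟩
        (p - ρ) * (p * Z - ρ * Z) + q * (q * Z)
          ≈⟨ +-congʳ (*-congˡ (+-congˡ (-‿cong ρZ))) ⟩
        (p - ρ) * (p * Z - (p * Z + q * Y)) + q * (q * Z)
          ≈⟨ solve 5 (λ p r q Y Z → (p :- r) :* (p :* Z :- (p :* Z :+ q :* Y)) :+ q :* (q :* Z) := q :* (r :* Y :- (p :* Y :- q :* Z))) refl p ρ q Y Z ⟩
        q * (ρ * Y - (p * Y - q * Z))
          ≈⟨ *-congˡ (+-congʳ ρY) ⟩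
        q * ((p * Y - q * Z) - (p * Y - q * Z))
          ≈⟨ trans (*-congˡ (-‿inverseʳ _)) (zeroʳ q) ⟩
        0# ∎
        where open SetoidReasoning setoid

      module _ (β≉ρ : ¬ ((p , q) ≈ᶜ fromReal ρ)) where

        ¬D≈0 : ¬ (D ≈ 0#)
        ¬D≈0 D≈0 = β≉ρ
          ( trans (solve 2 (λ p r → p := (p :- r) :+ r) refl p ρ) (trans (+-congʳ p-ρ≈0) (+-identityˡ ρ))
          , proj₁ (tight q 0#) (λ q#0 → <-irrefl (sym D≈0) (+-nonneg-pos (0≤² (p - ρ)) (#0⇒0<² q#0))) )
          where
          p-ρ≈0 : p - ρ ≈ 0#
          p-ρ≈0 = proj₁ (tight (p - ρ) 0#) (λ p-ρ#0 → <-irrefl (sym D≈0) (+-pos-nonneg (#0⇒0<² p-ρ#0) (0≤² q)))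

        -- From `β ≉ ρ` only `¬ (D ≈ 0#)` follows, not `D # 0#`, so division by `D` is impossible.
        -- But `w ≈ 0#` is a negated apartness by tightness, and under the assumption `w # 0#` both
        -- possibilities for `D` can be refuted.
        annihilated : ∀ {w} → D * w ≈ 0# → w ≈ 0#
        annihilated {w} Dw≈0 = proj₁ (tight w 0#) λ w#0 → ¬D≈0 (proj₁ (tight D 0#) λ D#0 →
          proj₂ (tight (D * w) 0#) Dw≈0 (HCR.x#0y#0→xy#0 D#0 w#0))

        act-vr⟶0 : ∀ i → (λ m → act C m vr i) ⟶ 0#
        act-vr⟶0 i = ⟶-cong (λ _ → refl) (trans (*-congˡ (annihilated D*Y≈0)) (zeroʳ (x i))) (limit-dotʳ vr i)

        act-vi⟶0 : ∀ i → (λ m → act C m vi i) ⟶ 0#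
        act-vi⟶0 i = ⟶-cong (λ _ → refl) (trans (*-congˡ (annihilated D*Z≈0)) (zeroʳ (x i))) (limit-dotʳ vi i)

      -- The squared modulus of `β / ρ`.
      g : Carrier
      g = (p * p + q * q) * (r * r)

      -- Real and imaginary part of (β/ρ)ᵐ, where β = p + q i.
      reᵐ imᵐ : ℕ → Carrier
      reᵐ zero    = 1#
      reᵐ (suc m) = (p * reᵐ m - q * imᵐ m) * r
      imᵐ zero    = 0#
      imᵐ (suc m) = (p * imᵐ m + q * reᵐ m) * r

      modulusᵐ : ∀ m → reᵐ m * reᵐ m + imᵐ m * imᵐ m ≈ g ^ m
      modulusᵐ zero    = solve 0 (:1 :* :1 :+ :0 :* :0 := :1) refl
      modulusᵐ (suc m) = trans
        (solve 5 (λ p q a b r → (p :* a :- q :* b) :* r :* ((p :* a :- q :* b) :* r) :+ (p :* b :+ q :* a) :* r :* ((p :* b :+ q :* a) :* r)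
                              := (p :* p :+ q :* q) :* (r :* r) :* (a :* a :+ b :* b)) refl p q (reᵐ m) (imᵐ m) r)
        (*-congˡ (modulusᵐ m))

      C*ᵥ : ∀ v i → (C *ᵥ v) i ≈ (A *ᵥ v) i * r
      C*ᵥ v i = trans (sum-cong-≋ (λ j → solve 3 (λ a r v → a :* r :* v := a :* v :* r) refl (A i j) r (v j)))
                      (sym (*-distribʳ-sum r (λ j → A i j * v j)))

      C*ᵥ-combination : ∀ c d i → (C *ᵥ combination c vr d vi) i ≈
                        (c * (p * vr i - q * vi i) + d * (p * vi i + q * vr i)) * r
      C*ᵥ-combination c d i = trans (C*ᵥ _ i) (*-congʳ (trans (dot-combination (A i) c vr d vi)
        (+-cong (*-congˡ (Avr i)) (*-congˡ (Avi i)))))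

      act-vr : ∀ m i → act C m vr i ≈ reᵐ m * vr i + (- imᵐ m) * vi i
      act-vr zero    i = solve 2 (λ v w → v := :1 :* v :+ (:- :0) :* w) refl (vr i) (vi i)
      act-vr (suc m) i = trans (dot-congʳ (C i) (act-vr m)) (trans (C*ᵥ-combination (reᵐ m) (- imᵐ m) i)
        (solve 7 (λ p q a b r v w → (a :* (p :* v :- q :* w) :+ (:- b) :* (p :* w :+ q :* v)) :* r
                 := (p :* a :- q :* b) :* r :* v :+ (:- ((p :* b :+ q :* a) :* r)) :* w) refl p q (reᵐ m) (imᵐ m) r (vr i) (vi i)))

      act-vi : ∀ m i → act C m vi i ≈ imᵐ m * vr i + reᵐ m * vi i
      act-vi zero    i = solve 2 (λ v w → w := :0 :* v :+ :1 :* w) refl (vr i) (vi i)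
      act-vi (suc m) i = trans (dot-congʳ (C i) (act-vi m)) (trans (C*ᵥ-combination (imᵐ m) (reᵐ m) i)
        (solve 7 (λ p q a b r v w → (b :* (p :* v :- q :* w) :+ a :* (p :* w :+ q :* v)) :* r
                 := (p :* b :+ q :* a) :* r :* v :+ (p :* a :- q :* b) :* r :* w) refl p q (reᵐ m) (imᵐ m) r (vr i) (vi i)))

      act-modulus : ∀ m i → act C m vr i * act C m vr i + act C m vi i * act C m vi i ≈ g ^ m * (vr i * vr i + vi i * vi i)
      act-modulus m i = trans (+-cong (*-cong (act-vr m i) (act-vr m i)) (*-cong (act-vi m i) (act-vi m i)))
        (trans (solve 4 (λ a b v w → (a :* v :+ (:- b) :* w) :* (a :* v :+ (:- b) :* w) :+ (b :* v :+ a :* w) :* (b :* v :+ a :* w)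
                                 := (a :* a :+ b :* b) :* (v :* v :+ w :* w)) refl (reᵐ m) (imᵐ m) (vr i) (vi i))
               (*-congʳ (modulusᵐ m)))

      -- The squared modulus of the coordinate `i` of `Cᵐ v` is `g ^ m * κ`, and it tends to 0. Once
      -- it is below `κ` at a positive exponent, `g < 1`; the exponent `suc m` guarantees
      -- positivity.
      modulus<ρ : ¬ ((p , q) ≈ᶜ fromReal ρ) → ∀ i → 0# < vr i * vr i + vi i * vi i → ∀ s → IsModulus (p , q) s → s < ρ
      modulus<ρ β≉ρ i 0<κ s (0≤s , s²≈) =
        let ε , 0<ε , ε2<κ = smallMultiplier (<⇒≤ 0<2) 0<κ
            -- `η ≤ ε` and `η ≤ 1` give `η² ≤ ε` without a square root, so the two squared parts
            -- together stay below `κ`.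
            η , 0<η , η≤ε , η≤1 = positiveLowerBound₂ 0<ε 0<1
            N , close = act-vr⟶0 β≉ρ i η 0<η
            N′ , close′ = act-vi⟶0 β≉ρ i η 0<η
            m = N ℕ.⊔ N′
            η²≤ε = ≤-trans (*-monoʳ-≤ (<⇒≤ 0<η) η≤1) (≤-respˡ (sym (*-identityʳ η)) η≤ε)
        in ²-cancel-< 0≤s (<⇒≤ 0<ρ) (g<1⇒s²<ρ² (^<1⇒<1 0≤g m (gᵐκ<κ⇒gᵐ<1 (suc m)
             (≤-<-trans (≤-respˡ (act-modulus (suc m) i) (≤-respʳ (solve 1 (λ e → e :+ e := e :* :2) refl ε)
               (+-mono-≤ (≤-trans (square-bound (close (suc m) (ℕ.m≤n⇒m≤1+n (ℕ.m≤m⊔n N N′)))) η²≤ε)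
                         (≤-trans (square-bound (close′ (suc m) (ℕ.m≤n⇒m≤1+n (ℕ.m≤n⊔m N N′)))) η²≤ε))))
               ε2<κ))))
        where
        κ = vr i * vr i + vi i * vi i
        0≤g : 0# ≤ g
        0≤g = *-nonneg (+-nonneg (0≤² p) (0≤² q)) (0≤² r)
        square-bound : ∀ {η u} → Within η u 0# → u * u ≤ η * η
        square-bound {η} {u} (u<η , -u<η) = *-bound u≤η -u≤η u≤η -u≤η
          where
          u≤η = ≤-respˡ (solve 1 (λ u → u :- :0 := u) refl u) (<⇒≤ u<η)
          -u≤η = ≤-respˡ (solve 1 (λ u → :0 :- u := :- u) refl u) (<⇒≤ -u<η)
        gᵐκ<κ⇒gᵐ<1 : ∀ m → g ^ m * κ < κ → g ^ m < 1#
        gᵐκ<κ⇒gᵐ<1 m lt = 0<-⇒< (*-cancelʳ-pos (<-respʳ-≈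
          (solve 2 (λ k p → k :- p :* k := (:1 :- p) :* k) refl κ (g ^ m)) (<⇒0<- lt)) (<⇒≤ 0<κ))
        g<1⇒s²<ρ² : g < 1# → s * s < ρ * ρ
        g<1⇒s²<ρ² g<1 = <-by (*-pos (<⇒0<- g<1) (*-pos 0<ρ 0<ρ)) (begin
          (1# - (p * p + q * q) * (r * r)) * (ρ * ρ)
            ≈⟨ solve 3 (λ d r x → (:1 :- d :* (r :* r)) :* (x :* x) := x :* x :- d :* ((x :* r) :* (x :* r))) refl (p * p + q * q) r ρ ⟩
          ρ * ρ - (p * p + q * q) * ((ρ * r) * (ρ * r))
            ≈⟨ +-congˡ (-‿cong (*-cong (sym s²≈) (*-cong (recip-inverseʳ ρ 0<ρ) (recip-inverseʳ ρ 0<ρ)))) ⟩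
          ρ * ρ - s * s * (1# * 1#)
            ≈⟨ solve 2 (λ s x → x :* x :- s :* s :* (:1 :* :1) := x :* x :- s :* s) refl s ρ ⟩
          ρ * ρ - s * s ∎)
          where open SetoidReasoning setoid

    sumᶜ : ∀ {m} → Vector ℂ m → ℂ
    sumᶜ = RawSemiringDefs.sum (RawRing.rawSemiring ℂ-rawRing)

    sumᶜ-re : ∀ {m} (f : Vector ℂ m) → proj₁ (sumᶜ f) ≡ sum (Re f)
    sumᶜ-re {zero}  f = ≡.refl
    sumᶜ-re {suc m} f = ≡.cong (λ t → proj₁ (f zero) + t) (sumᶜ-re (f ∘ suc))

    sumᶜ-im : ∀ {m} (f : Vector ℂ m) → proj₂ (sumᶜ f) ≡ sum (Im f)
    sumᶜ-im {zero}  f = ≡.refl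
    sumᶜ-im {suc m} f = ≡.cong (λ t → proj₂ (f zero) + t) (sumᶜ-im (f ∘ suc))

    Aᶜ : Mᶜ.Matrix n n
    Aᶜ i j = fromReal (A i j)

    Aᶜ*ᵥ-re : ∀ v i → proj₁ ((Aᶜ Mᶜ.*ᵥ v) i) ≈ (A *ᵥ Re v) i
    Aᶜ*ᵥ-re v i = trans (reflexive (sumᶜ-re (λ j → RawRing._*_ ℂ-rawRing (Aᶜ i j) (v j))))
      (sum-cong-≋ (λ j → solve 3 (λ a x y → a :* x :- :0 :* y := a :* x) refl (A i j) (Re v j) (Im v j)))

    Aᶜ*ᵥ-im : ∀ v i → proj₂ ((Aᶜ Mᶜ.*ᵥ v) i) ≈ (A *ᵥ Im v) i
    Aᶜ*ᵥ-im v i = trans (reflexive (sumᶜ-im (λ j → RawRing._*_ ℂ-rawRing (Aᶜ i j) (v j))))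
      (sum-cong-≋ (λ j → solve 3 (λ a x y → a :* y :+ :0 :* x := a :* y) refl (A i j) (Re v j) (Im v j)))

    eigenvalue-modulus<ρ : ∀ β → IsEigenvalue A β → ¬ (β ≈ᶜ fromReal ρ) → ∀ s → IsModulus β s → s < ρ
    eigenvalue-modulus<ρ β (v , (i , vᵢ#0) , Av≈βv) β≉ρ = modulus<ρ
      {vr = Re v} {vi = Im v}
      (λ j → trans (sym (Aᶜ*ᵥ-re v j)) (proj₁ (Av≈βv j)))
      (λ j → trans (sym (Aᶜ*ᵥ-im v j)) (proj₂ (Av≈βv j))) β≉ρ i
      ([ (λ re#0 → +-pos-nonneg (#0⇒0<² re#0) (0≤² _)) , (λ im#0 → +-nonneg-pos (0≤² _) (#0⇒0<² im#0)) ]′ vᵢ#0)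

    modulus : ∀ β → ∃ λ s → IsModulus β s
    modulus (p , q) = sqrt (p * p + q * q) (+-nonneg (0≤² p) (0≤² q))

    ρ-eigenvalue : ∀ i → IsEigenvalue A (fromReal ρ)
    ρ-eigenvalue i = (λ j → fromReal (x j)) , (i , inj₁ (#-sym (<⇒# (0<x i)))) , λ j →
      trans (Aᶜ*ᵥ-re (λ j → fromReal (x j)) j) (trans (Ax≈ρx j) (solve 2 (λ r x → r :* x := r :* x :- :0 :* :0) refl ρ (x j))) ,
      trans (Aᶜ*ᵥ-im (λ j → fromReal (x j)) j) (trans (trans (dot-congʳ (A j) (λ l → sym (zeroˡ 1#))) (trans (dot-scaleʳ (A j) 0# (λ _ → 1#)) (zeroˡ _)))
        (solve 2 (λ r x → :0 := r :* :0 :+ :0 :* x) refl ρ (x j)))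

    ρ-modulus : IsModulus (fromReal ρ) ρ
    ρ-modulus = <⇒≤ 0<ρ , solve 1 (λ r → r :* r := r :* r :+ :0 :* :0) refl ρ

    -- The bound `s ≤ ρ` is the negation of `ρ < s`, and `ρ < s` by itself excludes
    -- `β ≈ᶜ fromReal ρ`. So whether `β` equals `ρ` never has to be decided.
    ρ-spectralRadius : Fin n → IsSpectralRadius A ρ
    ρ-spectralRadius i = (fromReal ρ , ρ-eigenvalue i , ρ-modulus) , λ β βeigen →
      let s , s-modulus = modulus β
      in s , s-modulus , λ ρ<s → <-asym ρ<s (eigenvalue-modulus<ρ β βeigen (β≉ρ β s s-modulus ρ<s) s s-modulus)
      where
      β≉ρ : ∀ β s → IsModulus β s → ρ < s → ¬ (β ≈ᶜ fromReal ρ)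
      β≉ρ (p , q) s (0≤s , s²≈) ρ<s (p≈ρ , q≈0) = <-irrefl refl (<-≤-trans (*-monoʳ-< 0<ρ ρ<s)
        (≤-trans (*-monoˡ-≤ 0≤s (<⇒≤ ρ<s)) (≤-reflexive (trans s²≈
          (trans (+-cong (*-cong p≈ρ p≈ρ) (*-cong q≈0 q≈0)) (sym (proj₂ ρ-modulus)))))))

-- Polynomials through their coefficient sequences

module PolynomialCoefficients {a ℓ₁ ℓ₂ ℓ₃} (ℝ : RealField a ℓ₁ ℓ₂ ℓ₃) where
  open RealMatrices ℝ hiding (zero)
  open OrderedField ℝ
  open IntegerCoefficientSolver commutativeRing using (solve; _:=_; _:+_; _:*_; :0)
  open P

  shift : (ℕ → Carrier) → ℕ → Carrier
  shift f zero    = 0#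
  shift f (suc m) = f m

  shift-cong : ∀ {f g} → (∀ m → f m ≈ g m) → ∀ m → shift f m ≈ shift g m
  shift-cong f≈g zero    = refl
  shift-cong f≈g (suc m) = f≈g m

  infixr 7 _⊛_
  -- Multiplication by `p` on coefficient sequences, with `shift` as multiplication by `X`.
  -- Polynomial equality is coefficientwise and lists may end in zeros, so products are compared
  -- here, where only sequences have to agree pointwise.
  _⊛_ : Poly → (ℕ → Carrier) → ℕ → Carrier
  ([]      ⊛ f) m = 0#
  ((a ∷ p) ⊛ f) m = a * f m + shift (p ⊛ f) m

  ⊛-cong : ∀ p {f g} → (∀ m → f m ≈ g m) → ∀ m → (p ⊛ f) m ≈ (p ⊛ g) m
  ⊛-cong []      f≈g m = refl
  ⊛-cong (a ∷ p) f≈g m = +-cong (*-congˡ (f≈g m)) (shift-cong (⊛-cong p f≈g) m)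

  ⊛-zeroˡ : ∀ p f → (∀ m → coeff p m ≈ 0#) → ∀ m → (p ⊛ f) m ≈ 0#
  ⊛-zeroˡ []      f p≈0 m       = refl
  ⊛-zeroˡ (a ∷ p) f p≈0 zero    = trans (+-identityʳ _) (trans (*-congʳ (p≈0 0)) (zeroˡ _))
  ⊛-zeroˡ (a ∷ p) f p≈0 (suc m) = trans (+-cong (trans (*-congʳ (p≈0 0)) (zeroˡ _)) (⊛-zeroˡ p f (λ k → p≈0 (suc k)) m)) (+-identityˡ 0#)

  ⊛-constant : ∀ p f → (∀ m → coeff p (suc m) ≈ 0#) → ∀ m → (p ⊛ f) m ≈ coeff p 0 * f m
  ⊛-constant []      f p≈0 m       = sym (zeroˡ _)
  ⊛-constant (a ∷ p) f p≈0 zero    = +-identityʳ _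
  ⊛-constant (a ∷ p) f p≈0 (suc m) = trans (+-congˡ (⊛-zeroˡ p f p≈0 m)) (+-identityʳ _)

  ⊛-scale : ∀ p b f m → (p ⊛ (λ l → b * f l)) m ≈ b * (p ⊛ f) m
  ⊛-scale []      b f m       = sym (zeroʳ b)
  ⊛-scale (a ∷ p) b f zero    = solve 3 (λ a b f → a :* (b :* f) :+ :0 := b :* (a :* f :+ :0)) refl a b (f 0)
  ⊛-scale (a ∷ p) b f (suc m) = trans (+-congˡ (⊛-scale p b f m))
    (solve 4 (λ a b f g → a :* (b :* f) :+ b :* g := b :* (a :* f :+ g)) refl a b (f (suc m)) ((p ⊛ f) m))

  coeff-+ : ∀ p q m → coeff (p +ₚ q) m ≈ coeff p m + coeff q m
  coeff-+ []      q       m       = sym (+-identityˡ _)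
  coeff-+ (a ∷ p) []      m       = sym (+-identityʳ _)
  coeff-+ (a ∷ p) (b ∷ q) zero    = refl
  coeff-+ (a ∷ p) (b ∷ q) (suc m) = coeff-+ p q m

  coeff-scale : ∀ a p m → coeff (List.map (a *_) p) m ≈ a * coeff p m
  coeff-scale a []      m       = sym (zeroʳ a)
  coeff-scale a (b ∷ p) zero    = refl
  coeff-scale a (b ∷ p) (suc m) = coeff-scale a p m

  coeff-* : ∀ p q m → coeff (p *ₚ q) m ≈ (p ⊛ coeff q) m
  coeff-* []      q m = refl
  coeff-* (a ∷ p) q m = trans (coeff-+ (List.map (a *_) q) (0# ∷ (p *ₚ q)) m) (+-cong (coeff-scale a q m) (shifted m))
    where
    shifted : ∀ m → coeff (0# ∷ (p *ₚ q)) m ≈ shift (p ⊛ coeff q) m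
    shifted zero    = refl
    shifted (suc m) = coeff-* p q m

  sumₚ : ∀ {n} → Vector Poly n → Poly
  sumₚ = RawSemiringDefs.sum Pᴿ.rawSemiring

  coeff-sum : ∀ {n} (f : Vector Poly n) m → coeff (sumₚ f) m ≈ sum (λ k → coeff (f k) m)
  coeff-sum {zero}  f m = refl
  coeff-sum {suc n} f m = trans (coeff-+ (f zero) (sumₚ (f ∘ suc)) m) (+-congˡ (coeff-sum (f ∘ suc) m))

  eval-+ : ∀ p q x → eval (p +ₚ q) x ≈ eval p x + eval q x
  eval-+ []      q       x = sym (+-identityˡ _)
  eval-+ (a ∷ p) []      x = sym (+-identityʳ _)
  eval-+ (a ∷ p) (b ∷ q) x = trans (+-congˡ (*-congˡ (eval-+ p q x)))
    (solve 5 (λ a b x p q → (a :+ b) :+ x :* (p :+ q) := (a :+ x :* p) :+ (b :+ x :* q)) refl a b x (eval p x) (eval q x))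

  eval-scale : ∀ a p x → eval (List.map (a *_) p) x ≈ a * eval p x
  eval-scale a []      x = sym (zeroʳ a)
  eval-scale a (b ∷ p) x = trans (+-congˡ (*-congˡ (eval-scale a p x)))
    (solve 4 (λ a b x p → a :* b :+ x :* (a :* p) := a :* (b :+ x :* p)) refl a b x (eval p x))

  eval-* : ∀ p q x → eval (p *ₚ q) x ≈ eval p x * eval q x
  eval-* []      q x = sym (zeroˡ _)
  eval-* (a ∷ p) q x = trans (eval-+ (List.map (a *_) q) (0# ∷ (p *ₚ q)) x)
    (trans (+-cong (eval-scale a q x) (+-congˡ (*-congˡ (eval-* p q x))))
      (solve 4 (λ a x p q → a :* q :+ (:0 :+ x :* (p :* q)) := (a :+ x :* p) :* q) refl a x (eval p x) (eval q x)))

  eval-sum : ∀ {n} (f : Vector Poly n) x → eval (sumₚ f) x ≈ sum (λ k → eval (f k) x)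
  eval-sum {zero}  f x = refl
  eval-sum {suc n} f x = trans (eval-+ (f zero) (sumₚ (f ∘ suc)) x) (+-congˡ (eval-sum (f ∘ suc) x))

  eval-zero : ∀ p x → (∀ m → coeff p m ≈ 0#) → eval p x ≈ 0#
  eval-zero []      x p≈0 = refl
  eval-zero (a ∷ p) x p≈0 = trans (+-cong (p≈0 0) (trans (*-congˡ (eval-zero p x (p≈0 ∘ suc))) (zeroʳ x))) (+-identityˡ 0#)

  eval-constant : ∀ p x → (∀ m → coeff p (suc m) ≈ 0#) → eval p x ≈ coeff p 0
  eval-constant []      x p≈0 = refl
  eval-constant (a ∷ p) x p≈0 = trans (+-congˡ (trans (*-congˡ (eval-zero p x p≈0)) (zeroʳ x))) (+-identityʳ a)

-- Determinants and cofactors of Hessenberg matrices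

module HessenbergDeterminant {a ℓ₁ ℓ₂ ℓ₃} (ℝ : RealField a ℓ₁ ℓ₂ ℓ₃) where
  open RealMatrices ℝ hiding (zero)
  open OrderedField ℝ
  open PolynomialCoefficients ℝ
  open IntegerCoefficientSolver commutativeRing using (solve; _:=_; _:+_; _:*_; :-_; :0; :1)
  open P

  -- T holds the columns of a Hessenberg matrix but the first, so that its
  -- column j has its constant superdiagonal entry in row j.
  record IsHessenbergTail {n} (T : Mₚ.Matrix (suc n) n) : Set ℓ₁ where
    field
      vanishes : ∀ i j → toℕ i ℕ.< toℕ j → ∀ m → coeff (T i j) m ≈ 0#
      constant : ∀ i m → coeff (T (inject₁ i) i) (suc m) ≈ 0#

  minorTail : ∀ {n} → Mₚ.Matrix (suc (suc n)) (suc n) → Mₚ.Matrix (suc n) n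
  minorTail T i j = T (suc i) (suc j)

  minorTail-hessenberg : ∀ {n} {T : Mₚ.Matrix (suc (suc n)) (suc n)} → IsHessenbergTail T → IsHessenbergTail (minorTail T)
  minorTail-hessenberg hT = record
    { vanishes = λ i j i<j → vanishes (suc i) (suc j) (ℕ.s≤s i<j)
    ; constant = λ i → constant (suc i)
    }
    where open IsHessenbergTail hT

  -- The cofactors of the missing first column.  They annihilate T, so they
  -- are also a left eigenvector as soon as the determinant vanishes.
  cofactor : ∀ {n} → Mₚ.Matrix (suc n) n → Fin (suc n) → Poly
  cofactor {zero}  T _       = const 1#
  cofactor {suc n} T zero    = sumₚ (λ k → T (suc k) zero *ₚ cofactor (minorTail T) k)
  cofactor {suc n} T (suc k) = List.map (- coeff (T zero zero) 0 *_) (cofactor (minorTail T) k)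

  coeff-cofactor-zero : ∀ {n} (T : Mₚ.Matrix (suc (suc n)) (suc n)) m → coeff (cofactor T zero) m ≈
    sum (λ k → (T (suc k) zero ⊛ coeff (cofactor (minorTail T) k)) m)
  coeff-cofactor-zero T m = trans (coeff-sum (λ k → T (suc k) zero *ₚ cofactor (minorTail T) k) m)
    (sum-cong-≋ (λ k → coeff-* (T (suc k) zero) (cofactor (minorTail T) k) m))

  column-below : ∀ {n} (T : Mₚ.Matrix (suc (suc n)) (suc n)) (v : Vector Poly (suc n)) m →
    sum (λ k → (v k ⊛ coeff (cofactor T (suc k))) m) ≈
    - coeff (T zero zero) 0 * sum (λ k → (v k ⊛ coeff (cofactor (minorTail T) k)) m)
  column-below T v m = trans
    (sum-cong-≋ (λ k → trans (⊛-cong (v k) (coeff-scale b (cofactor (minorTail T) k)) m) (⊛-scale (v k) b (coeff (cofactor (minorTail T) k)) m)))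
    (sym (*-distribˡ-sum b (λ k → (v k ⊛ coeff (cofactor (minorTail T) k)) m)))
    where b = - coeff (T zero zero) 0

  -- In column zero the top entry times the top cofactor cancels against the rows below, which all
  -- carry the factor `- T zero zero`. In a later column the top entry vanishes, and the claim
  -- reduces to `minorTail T`.
  cofactor-orthogonal : ∀ {n} (T : Mₚ.Matrix (suc n) n) → IsHessenbergTail T → ∀ j m →
                        sum (λ k → (T k j ⊛ coeff (cofactor T k)) m) ≈ 0#
  cofactor-orthogonal {suc n} T hT zero m = trans
    (+-cong (trans (⊛-constant (T zero zero) (coeff (cofactor T zero)) (constant zero) m) (*-congˡ (coeff-cofactor-zero T m)))
            (column-below T (λ k → T (suc k) zero) m))
    (solve 2 (λ t s → t :* s :+ (:- t) :* s := :0) refl (coeff (T zero zero) 0) _)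
    where open IsHessenbergTail hT
  cofactor-orthogonal {suc n} T hT (suc j) m = trans
    (+-cong (⊛-zeroˡ (T zero (suc j)) (coeff (cofactor T zero)) (vanishes zero (suc j) (ℕ.s≤s ℕ.z≤n)) m)
            (trans (column-below T (λ k → T (suc k) (suc j)) m)
              (trans (*-congˡ (cofactor-orthogonal (minorTail T) (minorTail-hessenberg hT) j m)) (zeroʳ _))))
    (+-identityˡ 0#)
    where open IsHessenbergTail hT

  -- Unfolding the recursion along the last index only collects the negated superdiagonal entries.
  cofactor-last : ∀ {n} (T : Mₚ.Matrix (suc n) n) → (∀ i → coeff (T (inject₁ i) i) 0 < 0#) →
                  0# < coeff (cofactor T (fromℕ n)) 0 × (∀ m → coeff (cofactor T (fromℕ n)) (suc m) ≈ 0#)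
  cofactor-last {zero}  T T<0 = 0<1 , λ m → refl
  cofactor-last {suc n} T T<0 =
    let 0<w , w≈0 = cofactor-last (minorTail T) (T<0 ∘ suc) in
    <-respʳ-≈ (sym (coeff-scale b w 0)) (*-pos (neg-pos (T<0 zero)) 0<w) ,
    λ m → trans (coeff-scale b w (suc m)) (trans (*-congˡ (w≈0 m)) (zeroʳ b))
    where
    b = - coeff (T zero zero) 0
    w = cofactor (minorTail T) (fromℕ n)

  _^ₚ_ : Poly → ℕ → Poly
  _^ₚ_ = RawSemiringDefs._^_ Pᴿ.rawSemiring

  -- Only the first two entries of the top row can be nonzero. Their minors differ in the first
  -- column alone and share the tail `minorTail T`, so induction expresses both through the same
  -- cofactors.
  det-hessenberg : ∀ {n} (B : Mₚ.Matrix (suc n) (suc n)) → IsHessenbergTail (λ i j → B i (suc j)) → ∀ m →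
    coeff (Mₚ.det B) m ≈ sum (λ k → (B k zero ⊛ coeff (cofactor (λ i j → B i (suc j)) k)) m)
  det-hessenberg {n} B hB m = trans (trans (coeff-sum expansion m) (sum-cong-≋ (λ j → coeff-expansion j m))) (terms B hB m)
    where
    minor : ∀ {n} (B : Mₚ.Matrix (suc n) (suc n)) → Fin (suc n) → Mₚ.Matrix n n
    minor B j i k = B (suc i) (punchIn j k)
    expansion : Vector Poly (suc n)
    expansion j = ((Pᴿ.- Pᴿ.1#) ^ₚ toℕ j) *ₚ (B zero j *ₚ Mₚ.det (minor B j))
    term : ∀ {n} (B : Mₚ.Matrix (suc n) (suc n)) → Fin (suc n) → ℕ → Carrier
    term B j = ((Pᴿ.- Pᴿ.1#) ^ₚ toℕ j) ⊛ (B zero j ⊛ coeff (Mₚ.det (minor B j)))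
    coeff-expansion : ∀ j m → coeff (expansion j) m ≈ term B j m
    coeff-expansion j m = trans (coeff-* ((Pᴿ.- Pᴿ.1#) ^ₚ toℕ j) (B zero j *ₚ Mₚ.det (minor B j)) m)
      (⊛-cong ((Pᴿ.- Pᴿ.1#) ^ₚ toℕ j) (coeff-* (B zero j) (Mₚ.det (minor B j))) m)
    one-⊛ : ∀ f m → (Pᴿ.1# ⊛ f) m ≈ f m
    one-⊛ f m = trans (⊛-constant Pᴿ.1# f (λ _ → refl) m) (*-identityˡ (f m))
    neg-one-⊛ : ∀ f m → (((Pᴿ.- Pᴿ.1#) ^ₚ 1) ⊛ f) m ≈ - f m
    neg-one-⊛ f m = trans (⊛-constant ((Pᴿ.- Pᴿ.1#) ^ₚ 1) f (λ _ → refl) m)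
      (solve 1 (λ x → ((:- :1) :* :1 :+ :0) :* x := :- x) refl (f m))
    terms : ∀ {n} (B : Mₚ.Matrix (suc n) (suc n)) → IsHessenbergTail (λ i j → B i (suc j)) → ∀ m →
      sum (λ j → term B j m) ≈ sum (λ k → (B k zero ⊛ coeff (cofactor (λ i j → B i (suc j)) k)) m)
    terms {zero}  B hB m = +-congʳ (one-⊛ (B zero zero ⊛ coeff Pᴿ.1#) m)
    terms {suc n} B hB m = begin
      term B zero m + (term B (suc zero) m + sum (λ j → term B (suc (suc j)) m))
        ≈⟨ +-cong (trans (one-⊛ (B zero zero ⊛ D₀) m) (⊛-cong (B zero zero) D₀≈ m))
             (+-cong term₁ (trans (sum-cong-≋ vanishing-term) (sum-replicate-zero n))) ⟩
      (B zero zero ⊛ coeff (cofactor T zero)) m + (b * S + 0#)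
        ≈⟨ +-congˡ (+-identityʳ _) ⟩
      (B zero zero ⊛ coeff (cofactor T zero)) m + b * S
        ≈⟨ +-congˡ (column-below T (λ k → B (suc k) zero) m) ⟨
      (B zero zero ⊛ coeff (cofactor T zero)) m + sum (λ k → (B (suc k) zero ⊛ coeff (cofactor T (suc k))) m) ∎
      where
      open SetoidReasoning setoid
      open IsHessenbergTail hB
      T = λ i j → B i (suc j)
      b = - coeff (T zero zero) 0
      S = sum (λ k → (B (suc k) zero ⊛ coeff (cofactor (minorTail T) k)) m)
      D₀ = coeff (Mₚ.det (minor B zero))
      D₁ = coeff (Mₚ.det (minor B (suc zero)))
      D₀≈ : ∀ m → D₀ m ≈ coeff (cofactor T zero) m
      D₀≈ m = trans (det-hessenberg (minor B zero) (minorTail-hessenberg hB) m) (sym (coeff-cofactor-zero T m))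
      term₁ : term B (suc zero) m ≈ b * S
      term₁ = begin
        term B (suc zero) m                    ≈⟨ neg-one-⊛ (T zero zero ⊛ D₁) m ⟩
        - (T zero zero ⊛ D₁) m                 ≈⟨ -‿cong (⊛-constant (T zero zero) D₁ (constant zero) m) ⟩
        - (coeff (T zero zero) 0 * D₁ m)       ≈⟨ solve 2 (λ t d → :- (t :* d) := (:- t) :* d) refl (coeff (T zero zero) 0) (D₁ m) ⟩
        b * D₁ m                               ≈⟨ *-congˡ (det-hessenberg (minor B (suc zero)) (minorTail-hessenberg hB) m) ⟩
        b * S                                  ∎
      vanishing-term : ∀ j → term B (suc (suc j)) m ≈ 0#
      vanishing-term j = trans
        (⊛-cong sign (⊛-zeroˡ (T zero (suc j)) (coeff (Mₚ.det (minor B (suc (suc j))))) (vanishes zero (suc j) (ℕ.s≤s ℕ.z≤n))) m)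
        -- The zero sequence is rewritten as `0#` times itself, so that `⊛-scale` can pull the
        -- factor out.
        (trans (⊛-cong sign (λ _ → sym (zeroˡ 0#)) m) (trans (⊛-scale sign 0# (λ _ → 0#) m) (zeroˡ _)))
        where sign = (Pᴿ.- Pᴿ.1#) ^ₚ toℕ (suc (suc j))

-- Algebraic simplicity of the Perron eigenvalue

module SimpleRoot {a ℓ₁ ℓ₂ ℓ₃} (ℝ : RealField a ℓ₁ ℓ₂ ℓ₃) where
  open RealMatrices ℝ hiding (zero)
  open OrderedField ℝ
  open MatrixPowers ℝ
  open PerronFrobenius ℝ
  open PolynomialCoefficients ℝ
  open HessenbergDeterminant ℝ
  open IntegerCoefficientSolver commutativeRing using (solve; _:=_; _:+_; _:*_; :-_; _:-_; :0; :1)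
  open P

  charMatrix : ∀ {n} → Matrix n n → Mₚ.Matrix n n
  charMatrix A i j = Mₚ.scalar X i j Pᴿ.+ Pᴿ.- const (A i j)

  charMatrix-⊛ : ∀ {n} (A : Matrix n n) i j f m → (charMatrix A i j ⊛ f) m ≈ scalar 1# i j * shift f m - A i j * f m
  charMatrix-⊛ A i j f m with does (i Fin.≟ j)
  ... | false = trans (⊛-constant (- A i j ∷ []) f (λ _ → refl) m)
                  (solve 3 (λ a f g → (:- a) :* f := :0 :* g :- a :* f) refl (A i j) (f m) (shift f m))
  ... | true  = trans (+-congˡ (shift-cong (λ l → trans (⊛-constant (1# ∷ []) f (λ _ → refl) l) (*-identityˡ (f l))) m))
                  (solve 3 (λ a f g → (:0 :- a) :* f :+ g := :1 :* g :- a :* f) refl (A i j) (f m) (shift f m))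

  charMatrix-eval : ∀ {n} (A : Matrix n n) i j s → eval (charMatrix A i j) s ≈ scalar 1# i j * s - A i j
  charMatrix-eval A i j s with does (i Fin.≟ j)
  ... | false = solve 2 (λ a s → (:- a) :+ s :* :0 := :0 :* s :- a) refl (A i j) s
  ... | true  = solve 2 (λ a s → (:0 :- a) :+ s :* (:1 :+ s :* :0) := :1 :* s :- a) refl (A i j) s

  linearFactor-⊛ : ∀ ρ f m → (((X Pᴿ.+ Pᴿ.- const ρ) ^ₚ 1) ⊛ f) m ≈ shift f m - ρ * f m
  linearFactor-⊛ ρ f zero    = solve 2 (λ r f → ((:0 :- r) :* :1 :+ :0) :* f :+ :0 := :0 :- r :* f) refl ρ (f 0)
  linearFactor-⊛ ρ f (suc m) = trans (+-congˡ (⊛-constant ((1# * 1# + 0#) ∷ []) f (λ _ → refl) m))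
    (solve 3 (λ r f g → ((:0 :- r) :* :1 :+ :0) :* f :+ (:1 :* :1 :+ :0) :* g := g :- r :* f) refl ρ (f (suc m)) (f m))

  module _ {n} (A : Matrix (suc n) (suc n)) (pair : PerronPair A)
           (A-hessenberg : ∀ i j → suc (toℕ i) ℕ.< toℕ j → A i j ≈ 0#)
           (0<A-super : ∀ (i : Fin n) → 0# < A (inject₁ i) (suc i)) where
    open PerronPair pair
    open Spectrum pair
    open SetoidReasoning setoid

    private
      B = charMatrix A
      T = λ (i : Fin (suc n)) (j : Fin n) → B i (suc j)

    off-diagonal : ∀ i j → toℕ i ℕ.< toℕ j → B i j ≡ (- A i j ∷ [])
    off-diagonal i j i<j with i Fin.≟ j
    ... | yes ≡.refl = contradiction i<j (ℕ.<-irrefl ≡.refl)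
    ... | no  _      = ≡.refl

    T-super : ∀ i → T (inject₁ i) i ≡ (- A (inject₁ i) (suc i) ∷ [])
    T-super i = off-diagonal (inject₁ i) (suc i) (ℕ.s≤s (ℕ.≤-reflexive (Fin.toℕ-inject₁ i)))

    T-hessenberg : IsHessenbergTail T
    T-hessenberg = record
      { vanishes = λ i j i<j m → trans (reflexive (≡.cong (λ p → coeff p m) (off-diagonal i (suc j) (ℕ.m<n⇒m<1+n i<j)))) (zero-entry i j i<j m)
      ; constant = λ i m → reflexive (≡.cong (λ p → coeff p (suc m)) (T-super i))
      }
      where
      zero-entry : ∀ i j → toℕ i ℕ.< toℕ j → ∀ m → coeff (- A i (suc j) ∷ []) m ≈ 0#
      zero-entry i j i<j zero    = trans (-‿cong (A-hessenberg i (suc j) (ℕ.s≤s i<j))) (solve 0 (:- :0 := :0) refl)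
      zero-entry i j i<j (suc m) = refl

    w : Fin (suc n) → Poly
    w = cofactor T

    r₀ : Carrier
    r₀ = recip (x zero) (0<x zero)

    quotient : Poly
    quotient = sumₚ (λ k → List.map (r₀ * x k *_) (w k))

    -- The double sum `wᵀ (X - A) x` read by columns; `row-pairing` reads the same sum by rows,
    -- where `A x = ρ x` produces the factor `X - ρ`. Comparing the two readings gives the
    -- factorisation.
    pairing : ∀ m → sum (λ k → sum (λ j → (B k j ⊛ coeff (w k)) m * x j)) ≈ x zero * coeff (charPoly A) m
    pairing m = begin
      sum (λ k → sum (λ j → (B k j ⊛ coeff (w k)) m * x j))
        ≈⟨ ∑-comm (λ k j → (B k j ⊛ coeff (w k)) m * x j) ⟩
      sum (λ j → sum (λ k → (B k j ⊛ coeff (w k)) m * x j))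
        ≈⟨ sum-cong-≋ (λ j → *-distribʳ-sum (x j) (λ k → (B k j ⊛ coeff (w k)) m)) ⟨
      sum (λ k → (B k zero ⊛ coeff (w k)) m) * x zero + sum (λ j → sum (λ k → (T k j ⊛ coeff (w k)) m) * x (suc j))
        ≈⟨ +-cong (*-congʳ (sym (det-hessenberg B T-hessenberg m)))
             (trans (sum-cong-≋ (λ j → trans (*-congʳ (cofactor-orthogonal T T-hessenberg j m)) (zeroˡ (x (suc j))))) (sum-replicate-zero n)) ⟩
      coeff (charPoly A) m * x zero + 0#
        ≈⟨ trans (+-identityʳ _) (*-comm _ _) ⟩
      x zero * coeff (charPoly A) m ∎

    row-pairing : ∀ k m → sum (λ j → (B k j ⊛ coeff (w k)) m * x j) ≈ x k * (shift (coeff (w k)) m - ρ * coeff (w k) m)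
    row-pairing k m = begin
      sum (λ j → (B k j ⊛ coeff (w k)) m * x j)
        ≈⟨ sum-cong-≋ (λ j → trans (*-congʳ (charMatrix-⊛ A k j (coeff (w k)) m))
             (solve 5 (λ d s a f x → (d :* s :- a :* f) :* x := s :* (d :* x) :+ (:- f) :* (a :* x)) refl (scalar 1# k j) s (A k j) f (x j))) ⟩
      sum (λ j → s * (scalar 1# k j * x j) + (- f) * (A k j * x j))
        ≈⟨ ∑-distrib-+ (λ j → s * (scalar 1# k j * x j)) (λ j → (- f) * (A k j * x j)) ⟩
      sum (λ j → s * (scalar 1# k j * x j)) + sum (λ j → (- f) * (A k j * x j))
        ≈⟨ +-cong (*-distribˡ-sum s (λ j → scalar 1# k j * x j)) (*-distribˡ-sum (- f) (λ j → A k j * x j)) ⟨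
      s * dot (scalar 1# k) x + (- f) * (A *ᵥ x) k
        ≈⟨ +-cong (*-congˡ (dot-scalarˡ k x)) (*-congˡ (Ax≈ρx k)) ⟩
      s * x k + (- f) * (ρ * x k)
        ≈⟨ solve 4 (λ s x f r → s :* x :+ (:- f) :* (r :* x) := x :* (s :- r :* f)) refl s (x k) f ρ ⟩
      x k * (s - ρ * f) ∎
      where
      s = shift (coeff (w k)) m
      f = coeff (w k) m

    coeff-quotient : ∀ m → coeff quotient m ≈ sum (λ k → r₀ * x k * coeff (w k) m)
    coeff-quotient m = trans (coeff-sum (λ k → List.map (r₀ * x k *_) (w k)) m) (sum-cong-≋ (λ k → coeff-scale (r₀ * x k) (w k) m))

    shift-coeff-quotient : ∀ m → shift (coeff quotient) m ≈ sum (λ k → r₀ * x k * shift (coeff (w k)) m)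
    shift-coeff-quotient zero    = sym (trans (sum-cong-≋ (λ k → zeroʳ (r₀ * x k))) (sum-replicate-zero (suc n)))
    shift-coeff-quotient (suc m) = coeff-quotient m

    factorisation : ∀ m → coeff (charPoly A) m ≈ coeff ((X Pᴿ.+ Pᴿ.- const ρ) ^ₚ 1 Pᴿ.* quotient) m
    factorisation m = begin
      coeff (charPoly A) m
        ≈⟨ *-identityˡ _ ⟨
      1# * coeff (charPoly A) m
        ≈⟨ *-congʳ (trans (*-comm _ _) (recip-inverseʳ (x zero) (0<x zero))) ⟨
      r₀ * x zero * coeff (charPoly A) m
        ≈⟨ *-assoc _ _ _ ⟩
      r₀ * (x zero * coeff (charPoly A) m)
        ≈⟨ *-congˡ (pairing m) ⟨
      r₀ * sum (λ k → sum (λ j → (B k j ⊛ coeff (w k)) m * x j))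
        ≈⟨ *-congˡ (sum-cong-≋ (λ k → row-pairing k m)) ⟩
      r₀ * sum (λ k → x k * (shift (coeff (w k)) m - ρ * coeff (w k) m))
        ≈⟨ *-distribˡ-sum r₀ (λ k → x k * (shift (coeff (w k)) m - ρ * coeff (w k) m)) ⟩
      sum (λ k → r₀ * (x k * (shift (coeff (w k)) m - ρ * coeff (w k) m)))
        ≈⟨ sum-cong-≋ (λ k → solve 5 (λ r x s p f → r :* (x :* (s :- p :* f)) := r :* x :* s :+ (:- p) :* (r :* x :* f)) refl r₀ (x k) (shift (coeff (w k)) m) ρ (coeff (w k) m)) ⟩
      sum (λ k → r₀ * x k * shift (coeff (w k)) m + (- ρ) * (r₀ * x k * coeff (w k) m))
        ≈⟨ ∑-distrib-+ (λ k → r₀ * x k * shift (coeff (w k)) m) (λ k → (- ρ) * (r₀ * x k * coeff (w k) m)) ⟩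
      sum (λ k → r₀ * x k * shift (coeff (w k)) m) + sum (λ k → (- ρ) * (r₀ * x k * coeff (w k) m))
        ≈⟨ +-cong (sym (shift-coeff-quotient m)) (trans (sym (*-distribˡ-sum (- ρ) (λ k → r₀ * x k * coeff (w k) m))) (*-congˡ (sym (coeff-quotient m)))) ⟩
      shift (coeff quotient) m + (- ρ) * coeff quotient m
        ≈⟨ solve 3 (λ s r q → s :+ (:- r) :* q := s :- r :* q) refl (shift (coeff quotient) m) ρ (coeff quotient m) ⟩
      shift (coeff quotient) m - ρ * coeff quotient m
        ≈⟨ linearFactor-⊛ ρ (coeff quotient) m ⟨
      (((X Pᴿ.+ Pᴿ.- const ρ) ^ₚ 1) ⊛ coeff quotient) m
        ≈⟨ coeff-* ((X Pᴿ.+ Pᴿ.- const ρ) ^ₚ 1) quotient m ⟨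
      coeff ((X Pᴿ.+ Pᴿ.- const ρ) ^ₚ 1 Pᴿ.* quotient) m ∎

    z : Vector Carrier (suc n)
    z k = eval (w k) ρ

    -- The row vector `zᵀ (ρ - A)`.
    residual : Vector Carrier (suc n)
    residual j = sum (λ k → (scalar 1# k j * ρ - A k j) * z k)

    residual≈ : ∀ j → residual j ≈ ρ * z j - (z ᵥ* A) j
    residual≈ j = begin
      sum (λ k → (scalar 1# k j * ρ - A k j) * z k)
        ≈⟨ sum-cong-≋ (λ k → solve 4 (λ d r a z → (d :* r :- a) :* z := r :* (z :* d) :+ (:- :1) :* (z :* a)) refl (scalar 1# k j) ρ (A k j) (z k)) ⟩
      sum (λ k → ρ * (z k * basis j k) + (- 1#) * (z k * A k j))
        ≈⟨ ∑-distrib-+ (λ k → ρ * (z k * basis j k)) (λ k → (- 1#) * (z k * A k j)) ⟩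
      sum (λ k → ρ * (z k * basis j k)) + sum (λ k → (- 1#) * (z k * A k j))
        ≈⟨ +-cong (*-distribˡ-sum ρ (λ k → z k * basis j k)) (*-distribˡ-sum (- 1#) (λ k → z k * A k j)) ⟨
      ρ * dot z (basis j) + (- 1#) * (z ᵥ* A) j
        ≈⟨ +-congʳ (*-congˡ (dot-basisʳ z j)) ⟩
      ρ * z j + (- 1#) * (z ᵥ* A) j
        ≈⟨ solve 2 (λ p q → p :+ (:- :1) :* q := p :- q) refl (ρ * z j) ((z ᵥ* A) j) ⟩
      ρ * z j - (z ᵥ* A) j ∎

    residual-suc : ∀ j → residual (suc j) ≈ 0#
    residual-suc j = begin
      residual (suc j)
        ≈⟨ sum-cong-≋ (λ k → trans (*-congʳ (sym (charMatrix-eval A k (suc j) ρ))) (sym (eval-* (T k j) (w k) ρ))) ⟩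
      sum (λ k → eval (T k j *ₚ w k) ρ)
        ≈⟨ eval-sum (λ k → T k j *ₚ w k) ρ ⟨
      eval (sumₚ (λ k → T k j *ₚ w k)) ρ
        ≈⟨ eval-zero (sumₚ (λ k → T k j *ₚ w k)) ρ (λ m → trans (coeff-sum (λ k → T k j *ₚ w k) m)
             (trans (sum-cong-≋ (λ k → coeff-* (T k j) (w k) m)) (cofactor-orthogonal T T-hessenberg j m))) ⟩
      0# ∎

    -- Cofactor orthogonality settles all coordinates but the first. That one is isolated by pairing
    -- with `x`, since `zᵀ (ρ - A) x = 0`.
    residual-x : residual zero * x zero ≈ 0#
    residual-x = begin
      residual zero * x zero
        ≈⟨ +-identityʳ _ ⟨
      residual zero * x zero + 0#
        ≈⟨ +-congˡ (trans (sum-cong-≋ (λ j → trans (*-congʳ (residual-suc j)) (zeroˡ (x (suc j))))) (sum-replicate-zero n)) ⟨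
      dot residual x
        ≈⟨ dot-congˡ x (λ j → trans (residual≈ j) (solve 3 (λ r z q → r :* z :- q := r :* z :+ (:- :1) :* q) refl ρ (z j) ((z ᵥ* A) j))) ⟩
      dot (combination ρ z (- 1#) (z ᵥ* A)) x
        ≈⟨ trans (dot-comm (combination ρ z (- 1#) (z ᵥ* A)) x) (dot-combination x ρ z (- 1#) (z ᵥ* A)) ⟩
      ρ * dot x z + (- 1#) * dot x (z ᵥ* A)
        ≈⟨ +-cong (*-congˡ (dot-comm x z)) (*-congˡ (trans (dot-comm x (z ᵥ* A)) (trans (sym (dot-*ᵥ z A x))
             (trans (dot-congʳ z Ax≈ρx) (dot-scaleʳ z ρ x))))) ⟩
      ρ * dot z x + (- 1#) * (ρ * dot z x)
        ≈⟨ solve 1 (λ p → p :+ (:- :1) :* p := :0) refl (ρ * dot z x) ⟩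
      0# ∎

    residual≈0 : ∀ j → residual j ≈ 0#
    residual≈0 zero    = *-cancelˡ-≈ (0<x zero) (trans (*-comm _ _) (trans residual-x (sym (zeroʳ _))))
    residual≈0 (suc j) = residual-suc j

    z-eigenvector : (z ᵥ* A) ≈ᵥ (ρ ·ᵥ z)
    z-eigenvector j = trans (solve 2 (λ p q → q := p :- (p :- q)) refl (ρ * z j) ((z ᵥ* A) j))
      (trans (+-congˡ (-‿cong (trans (sym (residual≈ j)) (residual≈0 j)))) (solve 1 (λ p → p :- :0 := p) refl (ρ * z j)))

    z-fixed : ∀ m j → (z ᵥ* (C ^ₘ m)) j ≈ z j
    z-fixed zero    j = dot-basisʳ z j
    z-fixed (suc m) j = begin
      dot z (C *ᵥ (λ l → (C ^ₘ m) l j))     ≈⟨ dot-*ᵥ z C (λ l → (C ^ₘ m) l j) ⟩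
      dot (z ᵥ* C) (λ l → (C ^ₘ m) l j)     ≈⟨ dot-congˡ (λ l → (C ^ₘ m) l j) zC≈z ⟩
      (z ᵥ* (C ^ₘ m)) j                     ≈⟨ z-fixed m j ⟩
      z j                                   ∎
      where
      zC≈z : (z ᵥ* C) ≈ᵥ z
      zC≈z j = begin
        sum (λ i → z i * (A i j * r))   ≈⟨ sum-cong-≋ (λ i → sym (*-assoc (z i) (A i j) r)) ⟩
        sum (λ i → z i * A i j * r)     ≈⟨ *-distribʳ-sum r (λ i → z i * A i j) ⟨
        (z ᵥ* A) j * r                  ≈⟨ *-congʳ (z-eigenvector j) ⟩
        ρ * z j * r                     ≈⟨ solve 3 (λ p z r → p :* z :* r := z :* (p :* r)) refl ρ (z j) r ⟩
        z j * (ρ * r)                   ≈⟨ *-congˡ (recip-inverseʳ ρ 0<ρ) ⟩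
        z j * 1#                        ≈⟨ *-identityʳ (z j) ⟩
        z j                             ∎

    -- `zᵀ Cᵐ` is constantly `zᵀ`, while its limit is `(z · x) yᵀ`.
    z∝y : ∀ j → z j ≈ dot z x * y j
    z∝y j = ⟶-unique (⟶-cong (λ m → sym (z-fixed m j)) refl (⟶-const (z j))) (limit-dotˡ z j)

    0<z-last : 0# < z (fromℕ n)
    0<z-last =
      let 0<w , w≈0 = cofactor-last T (λ i → <-respˡ-≈ (reflexive (≡.cong (λ p → coeff p 0) (≡.sym (T-super i))))
                        (<-by (0<A-super i) (solve 1 (λ a → a := :0 :- (:- a)) refl (A (inject₁ i) (suc i)))))
      in <-respʳ-≈ (sym (eval-constant (w (fromℕ n)) ρ w≈0)) 0<w

    -- `z` is `dot z x` times the positive vector `y`, so the sign of its last coordinate determines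
    -- that of the factor.
    0<zx : 0# < dot z x
    0<zx = *-cancelʳ-pos (<-respʳ-≈ (z∝y (fromℕ n)) 0<z-last) (<⇒≤ (0<y (fromℕ n)))

    eval-quotient : eval quotient ρ ≈ r₀ * dot z x
    eval-quotient = begin
      eval quotient ρ                                        ≈⟨ eval-sum (λ k → List.map (r₀ * x k *_) (w k)) ρ ⟩
      sum (λ k → eval (List.map (r₀ * x k *_) (w k)) ρ)      ≈⟨ sum-cong-≋ (λ k → trans (eval-scale (r₀ * x k) (w k) ρ)
                                                                 (solve 3 (λ r x z → r :* x :* z := r :* (z :* x)) refl r₀ (x k) (z k))) ⟩
      sum (λ k → r₀ * (z k * x k))                           ≈⟨ *-distribˡ-sum r₀ (λ k → z k * x k) ⟨
      r₀ * dot z x                                           ∎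

    ρ-algebraicallySimple : IsAlgebraicallySimpleEigenvalue A ρ
    ρ-algebraicallySimple = ρ-eigenvalue zero , quotient , factorisation ,
      #-sym (<⇒# (<-respʳ-≈ (sym eval-quotient) (*-pos (recip-pos (0<x zero)) 0<zx)))

-- Primitivity of positive Hessenberg matrices

module HessenbergPrimitivity {a ℓ₁ ℓ₂ ℓ₃} (ℝ : RealField a ℓ₁ ℓ₂ ℓ₃) where
  open RealMatrices ℝ hiding (zero)
  open OrderedField ℝ
  open MatrixPowers ℝ

  module _ {n} {A : Matrix (suc n) (suc n)} (0≤A : ∀ i j → 0# ≤ A i j)
           (0<A : ∀ i j → toℕ j ℕ.≤ suc (toℕ i) → 0# < A i j) where

    -- Each further factor lets a path reach one column further right: it waits on the diagonal if
    -- `j` is already within reach, and otherwise first climbs along the superdiagonal.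
    ^ₘ-pos : ∀ k i j → toℕ j ℕ.≤ suc k ℕ.+ toℕ i → 0# < (A ^ₘ suc k) i j
    ^ₘ-pos zero    i j j≤1+i = <-respʳ-≈ (sym (dot-basisʳ (A i) j)) (0<A i j j≤1+i)
    ^ₘ-pos (suc k) i j j≤2+k+i = step (ℕ.m≤n⇒m<n∨m≡n j≤2+k+i)
      where
      via : ∀ l → 0# < A i l → 0# < (A ^ₘ suc k) l j → 0# < (A ^ₘ suc (suc k)) i j
      via l 0<Ail 0<Alj = sum-pos _ (λ l → *-nonneg (0≤A i l) (^ₘ-nonneg 0≤A (suc k) l j)) l (*-pos 0<Ail 0<Alj)
      step : (toℕ j ℕ.< suc (suc k) ℕ.+ toℕ i) ⊎ (toℕ j ≡ suc (suc k) ℕ.+ toℕ i) → 0# < (A ^ₘ suc (suc k)) i j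
      step (inj₁ j<) = via i (0<A i i (ℕ.n≤1+n _)) (^ₘ-pos k i j (ℕ.≤-pred j<))
      step (inj₂ j≡) = via l (0<A i l (ℕ.≤-reflexive l≡1+i))
        (^ₘ-pos k l j (ℕ.≤-reflexive (≡.trans j≡ (≡.trans (≡.sym (ℕ.+-suc (suc k) (toℕ i))) (≡.cong (suc k ℕ.+_) (≡.sym l≡1+i))))))
        where
        -- Row `i` has a successor because column `j` lies at least two places to the right of it.
        1+i<1+n : suc (toℕ i) ℕ.< suc n
        1+i<1+n = ℕ.≤-<-trans (≡.subst (suc (toℕ i) ℕ.≤_) (≡.sym j≡) (ℕ.s≤s (ℕ.m≤n+m (toℕ i) (suc k)))) (Fin.toℕ<n j)
        l = fromℕ< 1+i<1+n
        l≡1+i : toℕ l ≡ suc (toℕ i)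
        l≡1+i = Fin.toℕ-fromℕ< 1+i<1+n

    hessenberg⇒primitive : IsPrimitive A
    hessenberg⇒primitive = 0≤A , suc n , ℕ.s≤s ℕ.z≤n , λ i j →
      ^ₘ-pos n i j (ℕ.≤-trans (ℕ.<⇒≤ (Fin.toℕ<n j)) (ℕ.m≤m+n (suc n) (toℕ i)))

-- Signs of the entries of `M`

module HessenbergMatrixProperties {a ℓ₁ ℓ₂ ℓ₃} (ℝ : RealField a ℓ₁ ℓ₂ ℓ₃) where
  open RealMatrices ℝ hiding (zero)
  open OrderedField ℝ
  open HessenbergMatrix ℝ

  fromℤ-pos : ∀ {i} → ℤ.0ℤ ℤ.< i → 0# < fromℤ i
  fromℤ-pos (ℤ.+<+ {n = suc n} _) = +-pos-nonneg 0<1 (×1-nonneg n)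

  if-yes : ∀ {p} {P : Set p} (P? : Dec P) {x y : Carrier} → P → (if does P? then x else y) ≡ x
  if-yes (yes _) p = ≡.refl
  if-yes (no ¬p) p = contradiction p ¬p

  if-no : ∀ {p} {P : Set p} (P? : Dec P) {x y : Carrier} → ¬ P → (if does P? then x else y) ≡ y
  if-no (yes p) ¬p = contradiction p ¬p
  if-no (no _)  ¬p = ≡.refl

  module _ (h : ℕ → Carrier) (0<h : ∀ k → 1 ℕ.≤ k → 0# < h k) (n : ℕ) where

    M-pos : ∀ i j → toℕ j ℕ.≤ suc (toℕ i) → 0# < M h n i j
    -- After the shift of both indices by one, the test `j ∸ 1 ≤ i` in the definition of `M` reduces
    -- to `toℕ j ≤ suc (toℕ i)`.
    M-pos i j j≤1+i = <-respʳ-≈ (reflexive (≡.sym (if-yes (toℕ j ℕ.≤? suc (toℕ i)) j≤1+i)))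
      (*-pos (fromℤ-pos (CPositive.c-positive (suc (toℕ i) ℕ.+ 1 ℕ.∸ suc (toℕ j)))) (0<h (suc (toℕ j)) (ℕ.s≤s ℕ.z≤n)))

    M-zero : ∀ i j → suc (toℕ i) ℕ.< toℕ j → M h n i j ≈ 0#
    M-zero i j 1+i<j = reflexive (if-no (toℕ j ℕ.≤? suc (toℕ i)) (ℕ.<⇒≱ 1+i<j))

    M-nonneg : ∀ i j → 0# ≤ M h n i j
    M-nonneg i j with ℕ.<-≤-connex (suc (toℕ i)) (toℕ j)
    ... | inj₁ 1+i<j = ≤-reflexive (sym (M-zero i j 1+i<j))
    ... | inj₂ j≤1+i = <⇒≤ (M-pos i j j≤1+i)

theorem2p4 : ∀ {c ℓ₁ ℓ₂ ℓ₃} (ℝ : RealField c ℓ₁ ℓ₂ ℓ₃) →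
    let open RealMatrices ℝ
        open HessenbergMatrix ℝ
    in
    (h : ℕ → Carrier) →
    (∀ k → 1 ℕ.≤ k → 0# < h k) →
    h 1 ≈ 1# →
    (n : ℕ) → 2 ℕ.≤ n →
    IsPrimitive (M h n) ×
    (∃ λ (ρ : Carrier) →
      IsSpectralRadius (M h n) ρ ×
      (Σ (0# < ρ) λ 0<ρ →
        IsAlgebraicallySimpleEigenvalue (M h n) ρ ×
        (∀ β → IsEigenvalue (M h n) β → ¬ (β ≈ᶜ fromReal ρ) →
          ∃ λ r → IsModulus β r × r < ρ) ×
        (∃ λ (x : Vector Carrier (n ℕ.∸ 1)) → ∃ λ (y : Vector Carrier (n ℕ.∸ 1)) →
          (∀ k → 0# < x k) ×
          (∀ k → 0# < y k) ×
          (sum x ≈ 1#) ×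
          (dot y x ≈ 1#) ×
          ((M h n *ᵥ x) ≈ᵥ (ρ ·ᵥ x)) ×
          ((y ᵥ* M h n) ≈ᵥ (ρ ·ᵥ y)) ×
          ((λ m → (M h n /[ ρ , 0<ρ ]) ^ₘ m) ⟶ₘ outer x y))))
theorem2p4 ℝ h 0<h h₁≈1 n@(suc (suc n-2)) (ℕ.s≤s (ℕ.s≤s _)) =
  M-primitive , ρ , ρ-spectralRadius zero , 0<ρ , ρ-algebraicallySimple ,
  (λ β β-eigenvalue β≉ρ → let r , r-modulus = modulus β in r , r-modulus , eigenvalue-modulus<ρ β β-eigenvalue β≉ρ r r-modulus) ,
  x , y , 0<x , 0<y , ∑x≈1 , yx≈1 , Ax≈ρx , yA≈ρy , limit
  where
  open RealMatrices ℝ using (IsPrimitive; IsAlgebraicallySimpleEigenvalue)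
  open HessenbergMatrix ℝ
  open HessenbergMatrixProperties ℝ
  open PerronFrobenius ℝ
  M-primitive : IsPrimitive (M h n)
  M-primitive = HessenbergPrimitivity.hessenberg⇒primitive ℝ (M-nonneg h 0<h n) (M-pos h 0<h n)
  pair : PerronPair (M h n)
  pair = perronPair (M h n) M-primitive
  open PerronPair pair
  open Spectrum pair using (ρ-spectralRadius; modulus; eigenvalue-modulus<ρ)
  ρ-algebraicallySimple : IsAlgebraicallySimpleEigenvalue (M h n) ρ
  ρ-algebraicallySimple = SimpleRoot.ρ-algebraicallySimple ℝ (M h n) pair (M-zero h 0<h n)
    (λ i → M-pos h 0<h n (inject₁ i) (suc i) (ℕ.s≤s (ℕ.≤-reflexive (≡.sym (Fin.toℕ-inject₁ i)))))
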